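{- Let $n\geq1$ and $v,w\in\mathfrak{S}_n$, and put $\mathsf{S}=\mathrm{GDes}(v)$. Let $\kappa(v,w)$ be the number of $\zeta\in\mathfrak{S}^{\mathsf{S}}$ satisfying: (i) $v_\mathsf{S}\zeta^{ -1}\leq w$; (ii) if $v'\in\mathfrak{S}_n$ with $v\leq v'$ and $v'_\mathsf{S}\zeta^{ -1}\leq w$, then $v'=v$; and (iii) if $\mathsf{R}$ satisfies $\mathrm{Des}(\zeta)\subseteq\mathsf{R}\subseteq\mathsf{S}$ and $v_\mathsf{R}\zeta^{ -1}\leq w$, then $\mathsf{R}=\mathsf{S}$. Then the antipode $S$ of $\mathfrak{S}\mathit{Sym}$ satisfies \[S(\mathcal{M}_v)=(-1)^{\#\mathrm{GDes}(v)+1}\sum_{w\in\mathfrak{S}_n}\kappa(v,w)\,\mathcal{M}_w.\]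
   Context: $\mathfrak{S}_n$ is the symmetric group on $[n]$ ($\mathfrak{S}_0$ has one element); $u$ is written as the word $u_1\cdots u_n$, $u_i=u(i)$; permutations multiply as functions, $(uv)(i)=u(v(i))$. $\ell(u)=\#\{i<j\mid u_i>u_j\}$; the weak order on $\mathfrak{S}_n$: $u\leq v$ iff $v=wu$ for some $w$ with $\ell(v)=\ell(w)+\ell(u)$. $\mathrm{Des}(u)=\{p\in[n-1]\mid u_p>u_{p+1}\}$; a global descent of $u$ is $p\in[n-1]$ with $u_i>u_j$ whenever $i\leq p<j$, and $\mathrm{GDes}(u)$ is the set of global descents. For $\mathsf{S}\subseteq[n-1]$, $\mathfrak{S}^{\mathsf{S}}=\{\zeta\in\mathfrak{S}_n\mid\mathrm{Des}(\zeta)\subseteq\mathsf{S}\}$. For distinct integers $a_1,\dots,a_p$, $\mathrm{st}(a_1,\dots,a_p)\in\mathfrak{S}_p$ is the permutation $u$ with $u_i<u_j\iff a_i<a_j$. For $u\in\mathfrak{S}_p,v\in\mathfrak{S}_q$, $u\times v\in\mathfrak{S}_{p+q}$ has word $u_1\cdots u_p(v_1+p)\cdots(v_q+p)$. For $\mathsf{S}=\{p_1<\dots<p_k\}\subseteq[n-1]$, $v_\mathsf{S}=\mathrm{st}(v_1,\dots,v_{p_1})\times\mathrm{st}(v_{p_1+1},\dots,v_{p_2})\times\cdots\times\mathrm{st}(v_{p_k+1},\dots,v_n)$. $\mathfrak{S}^{(p,q)}$ is the set of $\zeta\in\mathfrak{S}_{p+q}$ with no descent except possibly at $p$. $\mathfrak{S}\mathit{Sym}$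 is the graded $\mathbb{Q}$-vector space with basis $\{\mathcal{F}_u\mid u\in\mathfrak{S}_n,n\geq0\}$, product $\mathcal{F}_u\cdot\mathcal{F}_v=\sum_{\zeta\in\mathfrak{S}^{(p,q)}}\mathcal{F}_{(u\times v)\zeta^{ -1}}$ ($u\in\mathfrak{S}_p,v\in\mathfrak{S}_q$), coproduct $\Delta(\mathcal{F}_u)=\sum_{p=0}^n\mathcal{F}_{\mathrm{st}(u_1,\dots,u_p)}\otimes\mathcal{F}_{\mathrm{st}(u_{p+1},\dots,u_n)}$; it is a graded connected Hopf algebra (Malvenuto–Reutenauer), $S$ its antipode. The monomial basis is $\mathcal{M}_u=\sum_{v\geq u}\mu_{\mathfrak{S}_n}(u,v)\mathcal{F}_v$, $\mu_{\mathfrak{S}_n}$ the Möbius function of the weak order. -}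

module Defs where

-- Malvenuto–Reutenauer Hopf algebra 𝔖Sym, computationally.
-- Permutations of [n] are words (List ℕ) with letters 1..n (1-indexed as in the paper).
-- Elements of 𝔖Sym are finite formal ℚ-linear combinations of F-basis elements,
-- represented as lists of (coefficient , word); two elements are equal iff
-- all their coefficients agree.

open import Data.Bool using (Bool; true; false; _∧_; _∨_; not; if_then_else_)
open import Data.Nat as ℕ using (ℕ; zero; suc; _+_; _∸_; _<ᵇ_; _≡ᵇ_)
open import Data.Integer using (+_)
open import Data.List using (List; []; _∷_; _++_; map; concatMap; length; take; drop; upTo; foldr)
open import Data.List.Relation.Binary.Permutation.Propositional using (_↭_)
open import Data.Product using (_×_; _,_)
open import Data.Rational using (ℚ; 0ℚ; 1ℚ; -_; _/_)
import Data.Rational as Q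
open import Relation.Binary.PropositionalEquality using (_≡_)

filterB : {A : Set} → (A → Bool) → List A → List A
filterB p [] = []
filterB p (x ∷ xs) = if p x then x ∷ filterB p xs else filterB p xs

countB : {A : Set} → (A → Bool) → List A → ℕ
countB p xs = length (filterB p xs)

anyB : {A : Set} → (A → Bool) → List A → Bool
anyB p [] = false
anyB p (x ∷ xs) = p x ∨ anyB p xs

allB : {A : Set} → (A → Bool) → List A → Bool
allB p [] = true
allB p (x ∷ xs) = p x ∧ allB p xs

eqW : List ℕ → List ℕ → Bool
eqW [] [] = true
eqW (x ∷ xs) (y ∷ ys) = (x ≡ᵇ y) ∧ eqW xs ys
eqW _ _ = false

memB : ℕ → List ℕ → Bool
memB x = anyB (λ y → x ≡ᵇ y)

subB : List ℕ → List ℕ → Bool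
subB xs ys = allB (λ x → memB x ys) xs

range : ℕ → List ℕ
range n = map suc (upTo n)

-- 1-based lookup u(i) (0 outside range)
at : List ℕ → ℕ → ℕ
at [] i = 0
at (x ∷ xs) zero = 0
at (x ∷ xs) (suc zero) = x
at (x ∷ xs) (suc (suc i)) = at xs (suc i)

-- 1-based position of letter i in u (0 if absent)
indexOf : ℕ → List ℕ → ℕ
indexOf i [] = 0
indexOf i (x ∷ xs) = if i ≡ᵇ x then 1 else (if memB i xs then suc (indexOf i xs) else 0)

IsPerm : ℕ → List ℕ → Set
IsPerm n u = u ↭ range n

insertAll : ℕ → List ℕ → List (List ℕ)
insertAll x [] = (x ∷ []) ∷ []
insertAll x (y ∷ ys) = (x ∷ y ∷ ys) ∷ map (y ∷_) (insertAll x ys)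

perms : ℕ → List (List ℕ)
perms zero = [] ∷ []
perms (suc n) = concatMap (insertAll (suc n)) (perms n)

comp : List ℕ → List ℕ → List ℕ
comp u v = map (at u) v

inverse : List ℕ → List ℕ
inverse u = map (λ i → indexOf i u) (range (length u))

len : List ℕ → ℕ
len [] = 0
len (x ∷ xs) = countB (λ y → y <ᵇ x) xs + len xs

desAux : ℕ → List ℕ → List ℕ
desAux i [] = []
desAux i (x ∷ []) = []
desAux i (x ∷ y ∷ r) = if y <ᵇ x then i ∷ desAux (suc i) (y ∷ r) else desAux (suc i) (y ∷ r)

Des : List ℕ → List ℕ
Des u = desAux 1 u

GDes : List ℕ → List ℕ
GDes u = filterB (λ p → allB (λ a → allB (λ b → b <ᵇ a) (drop p u)) (take p u))
                 (range (length u ∸ 1))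

st : List ℕ → List ℕ
st a = map (λ x → suc (countB (λ y → y <ᵇ x) a)) a

cross : List ℕ → List ℕ → List ℕ
cross u v = u ++ map (λ x → x + length u) v

segs : ℕ → List ℕ → List ℕ → List (List ℕ)
segs i S [] = [] ∷ []
segs i S (x ∷ xs) with segs (suc i) S xs
... | rest = if memB i S then (x ∷ []) ∷ rest else consHd rest
  where
  consHd : List (List ℕ) → List (List ℕ)
  consHd [] = (x ∷ []) ∷ []
  consHd (b ∷ bs) = (x ∷ b) ∷ bs

restrictS : List ℕ → List ℕ → List ℕ
restrictS S v = foldr cross [] (map st (segs 1 S v))

weakLe : List ℕ → List ℕ → Bool
weakLe u v = anyB (λ w → eqW v (comp w u) ∧ (len v ≡ᵇ (len w + len u))) (perms (length u))

-- Möbius function of the weak order, μ(u,v); the fuel ℓ(v) suffices since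
-- every z < v has ℓ(z) < ℓ(v).
sumQ : List ℚ → ℚ
sumQ = foldr Q._+_ 0ℚ

muF : ℕ → List ℕ → List ℕ → ℚ
muF k u v with eqW u v
... | true = 1ℚ
muF zero u v | false = 0ℚ
muF (suc k) u v | false =
  if weakLe u v
  then - sumQ (map (muF k u)
                   (filterB (λ z → weakLe u z ∧ weakLe z v ∧ not (eqW z v)) (perms (length u))))
  else 0ℚ

mu : List ℕ → List ℕ → ℚ
mu u v = muF (len v) u v

Elem : Set
Elem = List (ℚ × List ℕ)

F : List ℕ → Elem
F u = (1ℚ , u) ∷ []

scale : ℚ → Elem → Elem
scale c = map (λ { (a , u) → (c Q.* a , u) })

coeff : Elem → List ℕ → ℚ
coeff x u = sumQ (map (λ { (a , w) → if eqW w u then a else 0ℚ }) x)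

infix 4 _≈_
_≈_ : Elem → Elem → Set
x ≈ y = ∀ u → coeff x u ≡ coeff y u

fromℕQ : ℕ → ℚ
fromℕQ k = (+ k) / 1

shuffles : ℕ → ℕ → List (List ℕ)
shuffles p q = filterB (λ ζ → subB (Des ζ) (p ∷ [])) (perms (p + q))

mulF : List ℕ → List ℕ → Elem
mulF u v = map (λ ζ → (1ℚ , comp (cross u v) (inverse ζ))) (shuffles (length u) (length v))

mul : Elem → Elem → Elem
mul x y = concatMap (λ { (a , u) → concatMap (λ { (b , v) → scale (a Q.* b) (mulF u v) }) y }) x

lin : (List ℕ → Elem) → Elem → Elem
lin f x = concatMap (λ { (a , u) → scale a (f u) }) x

etaEps : List ℕ → Elem
etaEps [] = F []
etaEps (_ ∷ _) = []

-- antipode axioms  m ∘ (S ⊗ id) ∘ Δ = η ∘ ε = m ∘ (id ⊗ S) ∘ Δ, checked on the F-basis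
IsAntipode : (List ℕ → Elem) → Set
IsAntipode S = ∀ n u → IsPerm n u →
    (concatMap (λ p → mul (S (st (take p u))) (F (st (drop p u)))) (0 ∷ range n) ≈ etaEps u)
  × (concatMap (λ p → mul (F (st (take p u))) (S (st (drop p u)))) (0 ∷ range n) ≈ etaEps u)

M : List ℕ → Elem
M u = map (λ v → (mu u v , v)) (filterB (weakLe u) (perms (length u)))

sublists : List ℕ → List (List ℕ)
sublists [] = [] ∷ []
sublists (x ∷ xs) = map (x ∷_) (sublists xs) ++ sublists xs

kappa : List ℕ → List ℕ → ℕ
kappa v w = countB cond (perms n)
  where
  n = length v
  S = GDes v
  cond : List ℕ → Bool
  cond ζ = subB (Des ζ) S
         ∧ weakLe (comp (restrictS S v) (inverse ζ)) w
         ∧ allB (λ v' → if weakLe v v' ∧ weakLe (comp (restrictS S v') (inverse ζ)) w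
                          then eqW v' v else true) (perms n)
         ∧ allB (λ R → if subB (Des ζ) R ∧ weakLe (comp (restrictS R v) (inverse ζ)) w
                         then eqW R S else true) (sublists S)

signQ : ℕ → ℚ
signQ zero = 1ℚ
signQ (suc k) = - signQ k

{-# OPTIONS --safe #-}
-- Pairing with the functional x ↦ Σ_{u ≤ w} (coefficient of F u in x) reads off the coefficient of M w, and Takeuchi's
-- formula S(F_v) = Σ_S (-1)^(#S+1) Σ_ζ F_(v_S ζ⁻¹), with S ⊆ [n-1] and ζ ∈ 𝔖^S, follows by induction from one antipode axiom.
-- By Möbius inversion in v, it is then enough to show, for each fixed ζ and w,
--   Σ_{S ⊇ Des ζ} (-1)^(#S+1) [v_S ζ⁻¹ ≤ w] = Σ_{v' ≥ v} (-1)^(#GDes(v')+1) [ζ is counted by κ(v', w)].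
-- Put x = wζ. Then v_S ζ⁻¹ ≤ w iff ζ⁻¹ ≤ w and v ≤ m_S, where an inversion of m_S is a pair i < j which S separates or
-- which is an inversion of x. Call p ∉ Des ζ free for S if adding p to S or removing it from S does not change m_S.
-- Toggling a free position preserves the set of free positions, so the terms with S having a free position cancel in pairs;
-- the v' counted on the right are exactly the m_S, with GDes(m_S) = S, for the S without free positions.

module Submission where

open import Defs
open import Data.Bool using (Bool; true; false; _∧_; _∨_; not; if_then_else_)
open import Data.Nat using (ℕ; zero; suc; _+_; _*_; _∸_; _≤_; _<_; _<ᵇ_; _≡ᵇ_; z≤n; s≤s; _≤?_; _<?_)
open import Data.Nat.Properties
open import Data.Integer using () renaming (+_ to pos)
open import Data.List using (List; []; _∷_; _++_; map; concatMap; length; take; drop; upTo; foldr)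
open import Data.List.Properties using (map-++; map-∘; map-cong; length-map; length-upTo; length-++; upTo-∷ʳ; ++-identityʳ; length-take; length-drop; map-id)
open import Data.List.Relation.Binary.Permutation.Propositional using (_↭_; refl; prep; swap; ↭-refl; ↭-sym; ↭-trans; ↭-prep; ↭-swap; ↭-reflexive) renaming (trans to ↭trans)
open import Data.List.Relation.Binary.Permutation.Propositional.Properties using (∈-resp-↭; ↭-length; shift; ++-comm; drop-∷)
open import Data.List.Relation.Unary.Any using (here; there)
open import Data.List.Relation.Unary.All using (All; []; _∷_) renaming (lookup to All-lookup; tabulate to All-tabulate)
open import Data.List.Relation.Unary.AllPairs using (AllPairs; []; _∷_)
import Data.List.Relation.Unary.AllPairs.Properties as AllPairsₚ
open import Data.List.Relation.Unary.Unique.Propositional using (Unique)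
open import Data.List.Relation.Unary.Unique.Propositional.Properties using (upTo⁺; ++⁺; map⁺)
open import Data.List.Membership.Propositional using (_∈_; _∉_)
open import Data.List.Membership.Propositional.Properties using (∈-map⁺; ∈-map⁻; ∈-++⁺ˡ; ∈-++⁺ʳ; ∈-++⁻; ∈-∃++; ∈-upTo⁺; ∈-upTo⁻)
open import Data.List.Membership.Propositional.Properties.WithK using (unique∧set⇒bag)
open import Data.List.Relation.Binary.BagAndSetEquality using (∼bag⇒↭)
open import Data.Product using (_×_; _,_; proj₁; proj₂; ∃-syntax)
open import Data.Sum using (_⊎_; inj₁; inj₂; [_,_]′)
open import Data.Rational using (ℚ; 0ℚ; 1ℚ; -_)
import Data.Rational as Q
import Data.Rational.Properties as Qₚ
import Data.Rational.Unnormalised as Qᵘ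
import Data.Rational.Unnormalised.Properties as Qᵘₚ
import Data.Integer as ℤ
import Data.Integer.Properties as ℤₚ
open import Data.Rational.Solver using (module +-*-Solver)
open import Data.Empty using (⊥; ⊥-elim)
open import Function using (_∘_; id)
open import Function.Bundles using (mk⇔)
open import Relation.Nullary using (¬_; yes; no)
open import Relation.Binary.Definitions using (tri<; tri≈; tri>)
open import Relation.Binary.PropositionalEquality using (_≡_; _≢_; refl; sym; trans; cong; cong₂; subst; subst₂; module ≡-Reasoning)
open import Algebra.Properties.CommutativeSemigroup +-commutativeSemigroup using (interchange)

-- The conditions defining κ become statements about m_S. Let S = GDes(v) contain Des ζ. The v' with
-- v'_S ζ⁻¹ ≤ w are then those below m_S, so (ii) says v = m_S. A free p in S would let S without p
-- violate (iii), and a free p outside S would be a global descent of m_S = v missing from S. Hence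
-- S has no free position, and each S accounts for at most one v. The delicate point is that
-- toggling one free position keeps the other ones free. It could fail only for p < q, both in S,
-- that alone separate some ascent i < j of x. Comparing with the letter at q then gives an ascent
-- that crosses just one of the two cuts, and freeness of that cut provides a third separator.
-- Formal combinations are lists with repeated words, and nothing is known in advance about the
-- words in `S u`. Identities are therefore stated for values at an arbitrary functional g. The
-- induction for Takeuchi's formula relies on this: multiplying by one more block b replaces g by
-- the functional whose value at u is the value of g at F_u · F_b.

infix 1 _↔_
_↔_ : Set → Set → Set
A ↔ B = (A → B) × (B → A)

-- Boolean tests as propositions, and lists without repetition

∧-intro : ∀ {a b} → a ≡ true → b ≡ true → a ∧ b ≡ true
∧-intro refl refl = refl

∧-elim : ∀ {a b} → a ∧ b ≡ true → a ≡ true × b ≡ true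
∧-elim {true} {true} refl = refl , refl

∨-elim : ∀ {a b} → a ∨ b ≡ true → a ≡ true ⊎ b ≡ true
∨-elim {true} _ = inj₁ refl
∨-elim {false} p = inj₂ p

∨-introʳ : ∀ {a b} → b ≡ true → a ∨ b ≡ true
∨-introʳ {true} _ = refl
∨-introʳ {false} p = p

∨-introˡ : ∀ {a b} → a ≡ true → a ∨ b ≡ true
∨-introˡ refl = refl

not-false : ∀ {b} → not b ≡ true → b ≢ true
not-false {false} _ ()

not-true : ∀ {b} → b ≢ true → not b ≡ true
not-true {true} h = ⊥-elim (h refl)
not-true {false} _ = refl

≢true⇒≡false : ∀ {b} → b ≢ true → b ≡ false
≢true⇒≡false {true} h = ⊥-elim (h refl)
≢true⇒≡false {false} _ = refl

bool? : (b : Bool) → b ≡ true ⊎ b ≢ true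
bool? true = inj₁ refl
bool? false = inj₂ λ ()

bool-ext : ∀ {a b} → (a ≡ true ↔ b ≡ true) → a ≡ b
bool-ext {true} {true} _ = refl
bool-ext {true} {false} (f , _) = sym (f refl)
bool-ext {false} {true} (_ , g) = g refl
bool-ext {false} {false} _ = refl

≡ᵇ-true : ∀ m n → (m ≡ᵇ n) ≡ true ↔ m ≡ n
≡ᵇ-true zero zero = (λ _ → refl) , (λ _ → refl)
≡ᵇ-true zero (suc n) = (λ ()) , (λ ())
≡ᵇ-true (suc m) zero = (λ ()) , (λ ())
≡ᵇ-true (suc m) (suc n) = (cong suc ∘ proj₁ (≡ᵇ-true m n)) , (proj₂ (≡ᵇ-true m n) ∘ suc-injective)

<ᵇ-true : ∀ m n → (m <ᵇ n) ≡ true ↔ m < n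
<ᵇ-true m zero = (λ ()) , (λ ())
<ᵇ-true zero (suc n) = (λ _ → s≤s z≤n) , (λ _ → refl)
<ᵇ-true (suc m) (suc n) = (s≤s ∘ proj₁ (<ᵇ-true m n)) , (λ { (s≤s p) → proj₂ (<ᵇ-true m n) p })

eqW-true : ∀ u v → eqW u v ≡ true ↔ u ≡ v
eqW-true [] [] = (λ _ → refl) , (λ _ → refl)
eqW-true [] (y ∷ v) = (λ ()) , (λ ())
eqW-true (x ∷ u) [] = (λ ()) , (λ ())
eqW-true (x ∷ u) (y ∷ v) =
  (λ p → cong₂ _∷_ (proj₁ (≡ᵇ-true x y) (proj₁ (∧-elim p))) (proj₁ (eqW-true u v) (proj₂ (∧-elim p)))) ,
  (λ { refl → ∧-intro (proj₂ (≡ᵇ-true x x) refl) (proj₂ (eqW-true u u) refl) })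

eqW-refl : ∀ u → eqW u u ≡ true
eqW-refl u = proj₂ (eqW-true u u) refl

eqW-sym : ∀ u v → eqW u v ≡ eqW v u
eqW-sym u v = bool-ext ((λ p → proj₂ (eqW-true v u) (sym (proj₁ (eqW-true u v) p))) ,
                        (λ p → proj₂ (eqW-true u v) (sym (proj₁ (eqW-true v u) p))))

eqW-false : ∀ {u v} → u ≢ v → eqW u v ≡ false
eqW-false {u} {v} h = ≢true⇒≡false (h ∘ proj₁ (eqW-true u v))

eqW? : (u v : List ℕ) → u ≡ v ⊎ u ≢ v
eqW? u v with bool? (eqW u v)
... | inj₁ p = inj₁ (proj₁ (eqW-true u v) p)
... | inj₂ p = inj₂ (p ∘ proj₂ (eqW-true u v))

module _ {A : Set} where

  anyB-true : (p : A → Bool) (xs : List A) → anyB p xs ≡ true ↔ (∃[ x ] (x ∈ xs × p x ≡ true))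
  anyB-true p [] = (λ ()) , (λ ())
  anyB-true p (x ∷ xs) = to , from
    where
    to : p x ∨ anyB p xs ≡ true → ∃[ y ] (y ∈ x ∷ xs × p y ≡ true)
    to h with ∨-elim {p x} h
    ... | inj₁ px = x , here refl , px
    ... | inj₂ h' with proj₁ (anyB-true p xs) h'
    ... | y , y∈ , py = y , there y∈ , py
    from : ∃[ y ] (y ∈ x ∷ xs × p y ≡ true) → p x ∨ anyB p xs ≡ true
    from (y , here refl , py) = ∨-introˡ py
    from (y , there y∈ , py) = ∨-introʳ {p x} (proj₂ (anyB-true p xs) (y , y∈ , py))

  allB-true : (p : A → Bool) (xs : List A) → allB p xs ≡ true ↔ (∀ x → x ∈ xs → p x ≡ true)
  allB-true p [] = (λ _ _ ()) , (λ _ → refl)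
  allB-true p (x ∷ xs) = to , from
    where
    to : p x ∧ allB p xs ≡ true → ∀ y → y ∈ x ∷ xs → p y ≡ true
    to h y (here refl) = proj₁ (∧-elim h)
    to h y (there y∈) = proj₁ (allB-true p xs) (proj₂ (∧-elim {p x} h)) y y∈
    from : (∀ y → y ∈ x ∷ xs → p y ≡ true) → p x ∧ allB p xs ≡ true
    from h = ∧-intro (h x (here refl)) (proj₂ (allB-true p xs) (λ y y∈ → h y (there y∈)))

  ∈-filterB : (p : A → Bool) (xs : List A) (y : A) → y ∈ filterB p xs ↔ (y ∈ xs × p y ≡ true)
  ∈-filterB p [] y = (λ ()) , (λ { (() , _) })
  ∈-filterB p (x ∷ xs) y with p x in eq
  ... | true = to , from
    where
    to : y ∈ x ∷ filterB p xs → y ∈ x ∷ xs × p y ≡ true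
    to (here refl) = here refl , eq
    to (there y∈) = there (proj₁ (proj₁ (∈-filterB p xs y) y∈)) , proj₂ (proj₁ (∈-filterB p xs y) y∈)
    from : y ∈ x ∷ xs × p y ≡ true → y ∈ x ∷ filterB p xs
    from (here refl , py) = here refl
    from (there y∈ , py) = there (proj₂ (∈-filterB p xs y) (y∈ , py))
  ... | false = to , from
    where
    to : y ∈ filterB p xs → y ∈ x ∷ xs × p y ≡ true
    to y∈ = there (proj₁ (proj₁ (∈-filterB p xs y) y∈)) , proj₂ (proj₁ (∈-filterB p xs y) y∈)
    from : y ∈ x ∷ xs × p y ≡ true → y ∈ filterB p xs
    from (here refl , py) with trans (sym eq) py
    ... | ()
    from (there y∈ , py) = proj₂ (∈-filterB p xs y) (y∈ , py)

  filterB-cong : {p q : A → Bool} (xs : List A) → (∀ x → x ∈ xs → p x ≡ q x) → filterB p xs ≡ filterB q xs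
  filterB-cong [] h = refl
  filterB-cong {p} {q} (x ∷ xs) h rewrite h x (here refl) | filterB-cong {p} {q} xs (λ y y∈ → h y (there y∈)) = refl

  Unique-∷ : {x : A} {xs : List A} → x ∉ xs → Unique xs → Unique (x ∷ xs)
  Unique-∷ {x} h u = All-tabulate (λ { y∈ refl → h y∈ }) ∷ u

  Unique-head : {x : A} {xs : List A} → Unique (x ∷ xs) → x ∉ xs
  Unique-head (h ∷ _) x∈ = All-lookup h x∈ refl

  Unique-tail : {x : A} {xs : List A} → Unique (x ∷ xs) → Unique xs
  Unique-tail (_ ∷ u) = u

  Unique-filterB : (p : A → Bool) (xs : List A) → Unique xs → Unique (filterB p xs)
  Unique-filterB p [] u = []
  Unique-filterB p (x ∷ xs) u with p x
  ... | true = Unique-∷ (Unique-head u ∘ proj₁ ∘ proj₁ (∈-filterB p xs x)) (Unique-filterB p xs (Unique-tail u))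
  ... | false = Unique-filterB p xs (Unique-tail u)

  Unique-↭ : {xs ys : List A} → xs ↭ ys → Unique xs → Unique ys
  Unique-↭ refl u = u
  Unique-↭ (prep x p) u = Unique-∷ (Unique-head u ∘ ∈-resp-↭ (↭-sym p)) (Unique-↭ p (Unique-tail u))
  Unique-↭ (swap x y p) u =
    Unique-∷ (λ { (here refl) → Unique-head u (here refl) ; (there y∈) → Unique-head (Unique-tail u) (∈-resp-↭ (↭-sym p) y∈) })
      (Unique-∷ (λ x∈ → Unique-head u (there (∈-resp-↭ (↭-sym p) x∈))) (Unique-↭ p (Unique-tail (Unique-tail u))))
  Unique-↭ (↭trans p q) u = Unique-↭ q (Unique-↭ p u)

  unique-⊆-↭-++ : (xs ys : List A) → Unique xs → (∀ x → x ∈ xs → x ∈ ys) → ∃[ zs ] (ys ↭ xs ++ zs)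
  unique-⊆-↭-++ [] ys u h = ys , ↭-refl
  unique-⊆-↭-++ (x ∷ xs) ys u h with ∈-∃++ (h x (here refl))
  ... | as , bs , refl with unique-⊆-↭-++ xs (as ++ bs) (Unique-tail u) sub
    where
    sub : ∀ y → y ∈ xs → y ∈ as ++ bs
    sub y y∈ with ∈-++⁻ as (h y (there y∈))
    ... | inj₁ q = ∈-++⁺ˡ q
    ... | inj₂ (here refl) = ⊥-elim (Unique-head u y∈)
    ... | inj₂ (there q) = ∈-++⁺ʳ as q
  ... | zs , p = zs , ↭-trans (shift x as bs) (↭-prep x p)

  -- Pigeonhole: any surplus of `ys` over `xs` would make it longer. This turns injective words into
  -- permutations and injective self-maps of a finite list into rearrangements of it.
  unique-⊆-length⇒↭ : (xs ys : List A) → Unique xs → (∀ x → x ∈ xs → x ∈ ys) → length xs ≡ length ys → xs ↭ ys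
  unique-⊆-length⇒↭ xs ys u h eq with unique-⊆-↭-++ xs ys u h
  ... | [] , p = ↭-sym (↭-trans p (↭-reflexive (++-identityʳ xs)))
  ... | z ∷ zs , p = ⊥-elim (m≢1+m+n (length xs) (trans eq (trans (↭-length p) (trans (length-++ xs) (+-suc _ _)))))

  unique-set⇒↭ : {xs ys : List A} → Unique xs → Unique ys → (∀ x → x ∈ xs → x ∈ ys) → (∀ x → x ∈ ys → x ∈ xs) → xs ↭ ys
  unique-set⇒↭ ux uy f g = ∼bag⇒↭ (unique∧set⇒bag ux uy (mk⇔ (f _) (g _)))

module _ {A B : Set} where

  Unique-map : (f : A → B) (xs : List A) → Unique xs →
    (∀ x y → x ∈ xs → y ∈ xs → f x ≡ f y → x ≡ y) → Unique (map f xs)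
  Unique-map f [] u inj = []
  Unique-map f (x ∷ xs) u inj = Unique-∷ fx∉ (Unique-map f xs (Unique-tail u) (λ y z p q → inj y z (there p) (there q)))
    where
    fx∉ : f x ∉ map f xs
    fx∉ p with ∈-map⁻ f p
    ... | y , y∈ , eq = Unique-head u (subst (_∈ xs) (sym (inj x y (here refl) (there y∈) eq)) y∈)

  ∈-concatMap : (f : A → List B) (xs : List A) (y : B) → y ∈ concatMap f xs ↔ (∃[ x ] (x ∈ xs × y ∈ f x))
  ∈-concatMap f [] y = (λ ()) , (λ ())
  ∈-concatMap f (x ∷ xs) y = to , from
    where
    to : y ∈ f x ++ concatMap f xs → ∃[ z ] (z ∈ x ∷ xs × y ∈ f z)
    to p with ∈-++⁻ (f x) p
    ... | inj₁ q = x , here refl , q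
    ... | inj₂ q with proj₁ (∈-concatMap f xs y) q
    ... | z , z∈ , r = z , there z∈ , r
    from : ∃[ z ] (z ∈ x ∷ xs × y ∈ f z) → y ∈ f x ++ concatMap f xs
    from (z , here refl , r) = ∈-++⁺ˡ r
    from (z , there z∈ , r) = ∈-++⁺ʳ (f x) (proj₂ (∈-concatMap f xs y) (z , z∈ , r))

  Unique-concatMap : (f : A → List B) (xs : List A) → Unique xs → (∀ x → x ∈ xs → Unique (f x)) →
    (∀ x y z → x ∈ xs → y ∈ xs → z ∈ f x → z ∈ f y → x ≡ y) → Unique (concatMap f xs)
  Unique-concatMap f [] u uf dis = []
  Unique-concatMap f (x ∷ xs) u uf dis =
    ++⁺ (uf x (here refl))
        (Unique-concatMap f xs (Unique-tail u) (λ y y∈ → uf y (there y∈)) (λ y z a p q → dis y z a (there p) (there q)))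
        λ { {a} (p , q) → disj a p (proj₁ (∈-concatMap f xs a) q) }
    where
    disj : ∀ a → a ∈ f x → (∃[ y ] (y ∈ xs × a ∈ f y)) → ⊥
    disj a p (y , y∈ , q) = Unique-head u (subst (_∈ xs) (sym (dis x y a (here refl) (there y∈) p q)) y∈)

memB-true : ∀ x xs → memB x xs ≡ true ↔ x ∈ xs
memB-true x xs =
  (λ p → let y , y∈ , e = proj₁ (anyB-true _ xs) p in subst (_∈ xs) (sym (proj₁ (≡ᵇ-true x y) e)) y∈) ,
  (λ p → proj₂ (anyB-true _ xs) (x , p , proj₂ (≡ᵇ-true x x) refl))

mem? : (x : ℕ) (xs : List ℕ) → x ∈ xs ⊎ x ∉ xs
mem? x xs with bool? (memB x xs)
... | inj₁ p = inj₁ (proj₁ (memB-true x xs) p)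
... | inj₂ p = inj₂ (p ∘ proj₂ (memB-true x xs))

subB-true : ∀ xs ys → subB xs ys ≡ true ↔ (∀ x → x ∈ xs → x ∈ ys)
subB-true xs ys =
  (λ p x x∈ → proj₁ (memB-true x ys) (proj₁ (allB-true _ xs) p x x∈)) ,
  (λ h → proj₂ (allB-true _ xs) (λ x x∈ → proj₂ (memB-true x ys) (h x x∈)))

∈-range : ∀ n i → i ∈ range n ↔ (1 ≤ i × i ≤ n)
∈-range n i = to , from
  where
  to : i ∈ range n → 1 ≤ i × i ≤ n
  to p with ∈-map⁻ suc p
  ... | j , j∈ , refl = s≤s z≤n , ∈-upTo⁻ j∈
  from : 1 ≤ i × i ≤ n → i ∈ range n
  from (s≤s _ , q) = ∈-map⁺ suc (∈-upTo⁺ q)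

length-range : ∀ n → length (range n) ≡ n
length-range n = trans (length-map suc (upTo n)) (length-upTo n)

Unique-range : ∀ n → Unique (range n)
Unique-range n = map⁺ suc-injective (upTo⁺ n)

range-suc : ∀ n → range (suc n) ≡ range n ++ suc n ∷ []
range-suc n = trans (cong (map suc) (sym (upTo-∷ʳ n))) (map-++ suc (upTo n) (n ∷ []))

-- Rational sums

𝟙 : Bool → ℚ
𝟙 b = if b then 1ℚ else 0ℚ

𝟙-∧ : ∀ a b → 𝟙 (a ∧ b) ≡ 𝟙 a Q.* 𝟙 b
𝟙-∧ true b = sym (Qₚ.*-identityˡ (𝟙 b))
𝟙-∧ false b = sym (Qₚ.*-zeroˡ (𝟙 b))

𝟙-guard : ∀ b {p q} → (b ≡ true → p ≡ q) → 𝟙 b Q.* p ≡ 𝟙 b Q.* q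
𝟙-guard true h = cong (1ℚ Q.*_) (h refl)
𝟙-guard false {p} {q} h = trans (Qₚ.*-zeroˡ p) (sym (Qₚ.*-zeroˡ q))

𝟙-true : ∀ {b} → b ≡ true → ∀ p → 𝟙 b Q.* p ≡ p
𝟙-true refl p = Qₚ.*-identityˡ p

𝟙-false : ∀ {b} → b ≢ true → ∀ p → 𝟙 b Q.* p ≡ 0ℚ
𝟙-false {true} h p = ⊥-elim (h refl)
𝟙-false {false} h p = Qₚ.*-zeroˡ p

𝟙-not : ∀ b → 𝟙 (not b) Q.+ 𝟙 b ≡ 1ℚ
𝟙-not true = refl
𝟙-not false = refl

𝟙-split : ∀ b p → p ≡ 𝟙 b Q.* p Q.+ 𝟙 (not b) Q.* p
𝟙-split true p = trans (sym (Qₚ.+-identityʳ p)) (sym (cong₂ Q._+_ (Qₚ.*-identityˡ p) (Qₚ.*-zeroˡ p)))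
𝟙-split false p = trans (sym (Qₚ.+-identityˡ p)) (sym (cong₂ Q._+_ (Qₚ.*-zeroˡ p) (Qₚ.*-identityˡ p)))

*-leftComm : ∀ p q r → p Q.* (q Q.* r) ≡ q Q.* (p Q.* r)
*-leftComm p q r = trans (sym (Qₚ.*-assoc p q r)) (trans (cong (Q._* r) (Qₚ.*-comm p q)) (Qₚ.*-assoc q p r))

neg-involutive : ∀ p → - (- p) ≡ p
neg-involutive = solve 1 (λ p → :- (:- p) := p) refl
  where open +-*-Solver

neg-unique : ∀ p q → p Q.+ q ≡ 0ℚ → q ≡ - p
neg-unique p q h = begin
  q ≡⟨ solve 2 (λ p q → q := :- p :+ (p :+ q)) refl p q ⟩
  - p Q.+ (p Q.+ q) ≡⟨ cong (- p Q.+_) h ⟩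
  - p Q.+ 0ℚ ≡⟨ Qₚ.+-identityʳ (- p) ⟩
  - p ∎
  where
  open ≡-Reasoning
  open +-*-Solver

½-double : ∀ p → p ≡ Q.½ Q.* (p Q.+ p)
½-double = solve 1 (λ p → p := con Q.½ :* (p :+ p)) refl
  where open +-*-Solver

-- Halving in ℚ replaces the pairing of terms under a sign-reversing involution: it is enough that
-- reindexing a sum produces its negative.
self-neg⇒0 : ∀ p → p ≡ - p → p ≡ 0ℚ
self-neg⇒0 p h = begin
  p ≡⟨ ½-double p ⟩
  Q.½ Q.* (p Q.+ p) ≡⟨ cong (λ q → Q.½ Q.* (p Q.+ q)) h ⟩
  Q.½ Q.* (p Q.+ - p) ≡⟨ cong (Q.½ Q.*_) (Qₚ.+-inverseʳ p) ⟩
  Q.½ Q.* 0ℚ ≡⟨ Qₚ.*-zeroʳ Q.½ ⟩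
  0ℚ ∎
  where open ≡-Reasoning

∑ : {A : Set} → List A → (A → ℚ) → ℚ
∑ xs f = sumQ (map f xs)

syntax ∑ xs (λ x → e) = ∑[ x ∈ xs ] e
infix 3 ∑

module _ {A : Set} where

  ∑-cong : (xs : List A) {f g : A → ℚ} → (∀ x → x ∈ xs → f x ≡ g x) → ∑ xs f ≡ ∑ xs g
  ∑-cong [] h = refl
  ∑-cong (x ∷ xs) h = cong₂ Q._+_ (h x (here refl)) (∑-cong xs (λ y y∈ → h y (there y∈)))

  ∑-cong′ : (xs : List A) {f g : A → ℚ} → (∀ x → f x ≡ g x) → ∑ xs f ≡ ∑ xs g
  ∑-cong′ xs h = ∑-cong xs (λ x _ → h x)

  ∑-0 : (xs : List A) {f : A → ℚ} → (∀ x → x ∈ xs → f x ≡ 0ℚ) → ∑ xs f ≡ 0ℚ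
  ∑-0 [] h = refl
  ∑-0 (x ∷ xs) h = trans (cong₂ Q._+_ (h x (here refl)) (∑-0 xs (λ y y∈ → h y (there y∈)))) (Qₚ.+-identityˡ 0ℚ)

  ∑-++ : (xs ys : List A) (f : A → ℚ) → ∑ (xs ++ ys) f ≡ ∑ xs f Q.+ ∑ ys f
  ∑-++ [] ys f = sym (Qₚ.+-identityˡ _)
  ∑-++ (x ∷ xs) ys f = trans (cong (f x Q.+_) (∑-++ xs ys f)) (sym (Qₚ.+-assoc (f x) (∑ xs f) (∑ ys f)))

  ∑-singleton : (x : A) (f : A → ℚ) → ∑ (x ∷ []) f ≡ f x
  ∑-singleton x f = Qₚ.+-identityʳ (f x)

  ∑-+ : (xs : List A) (f g : A → ℚ) → ∑ xs (λ x → f x Q.+ g x) ≡ ∑ xs f Q.+ ∑ xs g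
  ∑-+ [] f g = sym (Qₚ.+-identityˡ 0ℚ)
  ∑-+ (x ∷ xs) f g = trans (cong (f x Q.+ g x Q.+_) (∑-+ xs f g))
    (solve 4 (λ a b c d → a :+ b :+ (c :+ d) := a :+ c :+ (b :+ d)) refl (f x) (g x) (∑ xs f) (∑ xs g))
    where open +-*-Solver

  ∑-*ˡ : (c : ℚ) (xs : List A) (f : A → ℚ) → c Q.* ∑ xs f ≡ ∑ xs (λ x → c Q.* f x)
  ∑-*ˡ c [] f = Qₚ.*-zeroʳ c
  ∑-*ˡ c (x ∷ xs) f = trans (Qₚ.*-distribˡ-+ c (f x) (∑ xs f)) (cong (c Q.* f x Q.+_) (∑-*ˡ c xs f))

  ∑-*ʳ : (c : ℚ) (xs : List A) (f : A → ℚ) → ∑ xs f Q.* c ≡ ∑ xs (λ x → f x Q.* c)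
  ∑-*ʳ c xs f = trans (Qₚ.*-comm (∑ xs f) c) (trans (∑-*ˡ c xs f) (∑-cong′ xs (λ x → Qₚ.*-comm c (f x))))

  ∑-neg : (xs : List A) (f : A → ℚ) → - ∑ xs f ≡ ∑ xs (λ x → - f x)
  ∑-neg [] f = refl
  ∑-neg (x ∷ xs) f = trans (Qₚ.neg-distrib-+ (f x) (∑ xs f)) (cong (- f x Q.+_) (∑-neg xs f))

  ∑-↭ : {xs ys : List A} → xs ↭ ys → (f : A → ℚ) → ∑ xs f ≡ ∑ ys f
  ∑-↭ refl f = refl
  ∑-↭ (prep x p) f = cong (f x Q.+_) (∑-↭ p f)
  ∑-↭ (swap {xs} {ys} x y p) f = trans (cong (λ s → f x Q.+ (f y Q.+ s)) (∑-↭ p f))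
    (solve 3 (λ a b c → a :+ (b :+ c) := b :+ (a :+ c)) refl (f x) (f y) (∑ ys f))
    where open +-*-Solver
  ∑-↭ (↭trans p q) f = trans (∑-↭ p f) (∑-↭ q f)

  ∑-filterB : (p : A → Bool) (xs : List A) (f : A → ℚ) → ∑ (filterB p xs) f ≡ ∑ xs (λ x → 𝟙 (p x) Q.* f x)
  ∑-filterB p [] f = refl
  ∑-filterB p (x ∷ xs) f with p x
  ... | true = cong₂ Q._+_ (sym (Qₚ.*-identityˡ (f x))) (∑-filterB p xs f)
  ... | false = trans (∑-filterB p xs f) (trans (sym (Qₚ.+-identityˡ _)) (cong (Q._+ _) (sym (Qₚ.*-zeroˡ (f x)))))

  ∑-support : (xs : List A) (x : A) (f : A → ℚ) → x ∈ xs → Unique xs →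
    (∀ y → y ∈ xs → y ≢ x → f y ≡ 0ℚ) → ∑ xs f ≡ f x
  ∑-support (x ∷ xs) .x f (here refl) u h =
    trans (cong (f x Q.+_) (∑-0 xs (λ y y∈ → h y (there y∈) λ { refl → Unique-head u y∈ }))) (Qₚ.+-identityʳ (f x))
  ∑-support (y ∷ xs) x f (there x∈) u h =
    trans (cong₂ Q._+_ (h y (here refl) λ { refl → Unique-head u x∈ })
                       (∑-support xs x f x∈ (Unique-tail u) (λ z z∈ → h z (there z∈))))
          (Qₚ.+-identityˡ (f x))

module _ {A B : Set} where

  ∑-map : (h : A → B) (xs : List A) (f : B → ℚ) → ∑ (map h xs) f ≡ ∑ xs (λ x → f (h x))
  ∑-map h xs f = cong sumQ (sym (map-∘ xs))

  ∑-concatMap : (h : A → List B) (xs : List A) (f : B → ℚ) → ∑ (concatMap h xs) f ≡ ∑ xs (λ x → ∑ (h x) f)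
  ∑-concatMap h [] f = refl
  ∑-concatMap h (x ∷ xs) f = trans (∑-++ (h x) (concatMap h xs) f) (cong (∑ (h x) f Q.+_) (∑-concatMap h xs f))

  ∑-swap : (xs : List A) (ys : List B) (f : A → B → ℚ) →
    ∑ xs (λ x → ∑ ys (λ y → f x y)) ≡ ∑ ys (λ y → ∑ xs (λ x → f x y))
  ∑-swap [] ys f = sym (∑-0 ys (λ _ _ → refl))
  ∑-swap (x ∷ xs) ys f = trans (cong (∑ ys (f x) Q.+_) (∑-swap xs ys f)) (sym (∑-+ ys (f x) (λ y → ∑ xs (λ x → f x y))))

∑-δ : (xs : List (List ℕ)) (u : List ℕ) (f : List ℕ → ℚ) → u ∈ xs → Unique xs →
  ∑ xs (λ y → 𝟙 (eqW u y) Q.* f y) ≡ f u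
∑-δ xs u f u∈ un = trans
  (∑-support xs u _ u∈ un (λ y _ y≢ → 𝟙-false (λ e → y≢ (sym (proj₁ (eqW-true u y) e))) (f y)))
  (𝟙-true (eqW-refl u) (f u))

-- `fromℕQ` normalises by a gcd, which does not compute for a variable `k`, so the identity is
-- checked on unnormalised fractions.
fromℕQ-suc : ∀ k → fromℕQ (suc k) ≡ 1ℚ Q.+ fromℕQ k
fromℕQ-suc k = Qₚ.toℚᵘ-injective (begin
  Q.toℚᵘ (fromℕQ (suc k)) ≈⟨ Qₚ.toℚᵘ-fromℚᵘ (Qᵘ.mkℚᵘ (pos (suc k)) 0) ⟩
  Qᵘ.mkℚᵘ (pos (suc k)) 0 ≈⟨ Qᵘ.*≡* (cong (ℤ._* pos 1) (cong (ℤ._+_ (pos 1)) (sym (ℤₚ.*-identityʳ (pos k))))) ⟩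
  Qᵘ.1ℚᵘ Qᵘ.+ Qᵘ.mkℚᵘ (pos k) 0 ≈⟨ Qᵘₚ.+-congʳ Qᵘ.1ℚᵘ (Qᵘₚ.≃-sym (Qₚ.toℚᵘ-fromℚᵘ (Qᵘ.mkℚᵘ (pos k) 0))) ⟩
  Qᵘ.1ℚᵘ Qᵘ.+ Q.toℚᵘ (fromℕQ k) ≈⟨ Qᵘₚ.≃-sym (Qₚ.toℚᵘ-homo-+ 1ℚ (fromℕQ k)) ⟩
  Q.toℚᵘ (1ℚ Q.+ fromℕQ k) ∎)
  where open Qᵘₚ.≃-Reasoning

fromℕQ-countB : {A : Set} (p : A → Bool) (xs : List A) → fromℕQ (countB p xs) ≡ ∑ xs (λ x → 𝟙 (p x))
fromℕQ-countB p [] = refl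
fromℕQ-countB p (x ∷ xs) with p x
... | true = trans (fromℕQ-suc (countB p xs)) (cong (1ℚ Q.+_) (fromℕQ-countB p xs))
... | false = trans (fromℕQ-countB p xs) (sym (Qₚ.+-identityˡ _))

-- Pairing of formal combinations with functionals

⟪_,_⟫ : Elem → (List ℕ → ℚ) → ℚ
⟪ x , g ⟫ = ∑ x (λ t → proj₁ t Q.* g (proj₂ t))

δ : List ℕ → List ℕ → ℚ
δ u w = 𝟙 (eqW w u)

coeff-pairing : ∀ x u → coeff x u ≡ ⟪ x , δ u ⟫
coeff-pairing [] u = refl
coeff-pairing ((a , w) ∷ x) u = cong₂ Q._+_ (lem (eqW w u)) (coeff-pairing x u)
  where
  lem : ∀ b → (if b then a else 0ℚ) ≡ a Q.* 𝟙 b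
  lem true = sym (Qₚ.*-identityʳ a)
  lem false = sym (Qₚ.*-zeroʳ a)

pairing-++ : ∀ x y g → ⟪ x ++ y , g ⟫ ≡ ⟪ x , g ⟫ Q.+ ⟪ y , g ⟫
pairing-++ x y g = ∑-++ x y _

pairing-scale : ∀ c x g → ⟪ scale c x , g ⟫ ≡ c Q.* ⟪ x , g ⟫
pairing-scale c [] g = sym (Qₚ.*-zeroʳ c)
pairing-scale c ((a , w) ∷ x) g =
  trans (cong₂ Q._+_ (Qₚ.*-assoc c a (g w)) (pairing-scale c x g)) (sym (Qₚ.*-distribˡ-+ c _ _))

pairing-concatMap : {A : Set} (f : A → Elem) (xs : List A) (g : List ℕ → ℚ) →
  ⟪ concatMap f xs , g ⟫ ≡ ∑ xs (λ a → ⟪ f a , g ⟫)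
pairing-concatMap f xs g = ∑-concatMap f xs _

pairing-F : ∀ u g → ⟪ F u , g ⟫ ≡ g u
pairing-F u g = trans (∑-singleton (1ℚ , u) (λ t → proj₁ t Q.* g (proj₂ t))) (Qₚ.*-identityˡ (g u))

pairing-lin : ∀ f x g → ⟪ lin f x , g ⟫ ≡ ⟪ x , (λ w → ⟪ f w , g ⟫) ⟫
pairing-lin f [] g = refl
pairing-lin f ((a , w) ∷ x) g =
  trans (pairing-++ (scale a (f w)) (lin f x) g) (cong₂ Q._+_ (pairing-scale a (f w) g) (pairing-lin f x g))

words : Elem → List (List ℕ)
words = map proj₂

pairing-expand : (D : List (List ℕ)) → Unique D → ∀ x → (∀ w → w ∈ words x → w ∈ D) → ∀ g →
  ⟪ x , g ⟫ ≡ ∑ D (λ w → coeff x w Q.* g w)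
pairing-expand D uD x sub g = begin
  ⟪ x , g ⟫
    ≡⟨ ∑-cong x (λ t t∈ → cong (proj₁ t Q.*_) (sym (∑-δ D (proj₂ t) g (sub (proj₂ t) (∈-map⁺ proj₂ t∈)) uD))) ⟩
  ∑ x (λ t → proj₁ t Q.* ∑ D (λ w → 𝟙 (eqW (proj₂ t) w) Q.* g w))
    ≡⟨ ∑-cong′ x (λ t → trans (∑-*ˡ (proj₁ t) D _) (∑-cong′ D (λ w → sym (Qₚ.*-assoc (proj₁ t) _ (g w))))) ⟩
  ∑ x (λ t → ∑ D (λ w → proj₁ t Q.* 𝟙 (eqW (proj₂ t) w) Q.* g w))
    ≡⟨ ∑-swap x D _ ⟩
  ∑ D (λ w → ∑ x (λ t → proj₁ t Q.* 𝟙 (eqW (proj₂ t) w) Q.* g w))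
    ≡⟨ ∑-cong′ D (λ w → trans (sym (∑-*ʳ (g w) x _)) (cong (Q._* g w) (sym (coeff-pairing x w)))) ⟩
  ∑ D (λ w → coeff x w Q.* g w) ∎
  where open ≡-Reasoning

dedup : List (List ℕ) → List (List ℕ)
dedup [] = []
dedup (u ∷ us) = u ∷ filterB (λ w → not (eqW u w)) (dedup us)

∈-dedup : ∀ us w → w ∈ us → w ∈ dedup us
∈-dedup (u ∷ us) w (here refl) = here refl
∈-dedup (u ∷ us) w (there w∈) with eqW? u w
... | inj₁ refl = here refl
... | inj₂ u≢w = there (proj₂ (∈-filterB _ (dedup us) w) (∈-dedup us w w∈ , not-true (u≢w ∘ proj₁ (eqW-true u w))))

Unique-dedup : ∀ us → Unique (dedup us)
Unique-dedup [] = []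
Unique-dedup (u ∷ us) = Unique-∷
  (λ p → not-false (proj₂ (proj₁ (∈-filterB _ (dedup us) u) p)) (eqW-refl u))
  (Unique-filterB _ (dedup us) (Unique-dedup us))

-- `≈` sees collected coefficients only, whereas the pairing runs through the list of terms.
-- Expanding both sides over one duplicate-free list `D` of all occurring words collects like terms.
pairing-cong : ∀ x y → x ≈ y → ∀ g → ⟪ x , g ⟫ ≡ ⟪ y , g ⟫
pairing-cong x y h g = begin
  ⟪ x , g ⟫ ≡⟨ pairing-expand D uD x (λ w w∈ → ∈-dedup _ w (∈-++⁺ˡ w∈)) g ⟩
  ∑ D (λ w → coeff x w Q.* g w) ≡⟨ ∑-cong′ D (λ w → cong (Q._* g w) (h w)) ⟩
  ∑ D (λ w → coeff y w Q.* g w) ≡⟨ sym (pairing-expand D uD y (λ w w∈ → ∈-dedup _ w (∈-++⁺ʳ (words x) w∈)) g) ⟩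
  ⟪ y , g ⟫ ∎
  where
  open ≡-Reasoning
  D = dedup (words x ++ words y)
  uD = Unique-dedup (words x ++ words y)

-- Right multiplication is transposed onto the functional, so the product disappears from the
-- element and only the value of `x` at a new functional remains.
pairing-mul-F : ∀ x v g → ⟪ mul x (F v) , g ⟫ ≡ ⟪ x , (λ u → ⟪ mulF u v , g ⟫) ⟫
pairing-mul-F [] v g = refl
pairing-mul-F ((a , u) ∷ x) v g =
  trans (pairing-++ (scale (a Q.* 1ℚ) (mulF u v) ++ []) (mul x (F v)) g)
    (cong₂ Q._+_
      (trans (pairing-++ (scale (a Q.* 1ℚ) (mulF u v)) [] g)
        (trans (Qₚ.+-identityʳ _) (trans (pairing-scale (a Q.* 1ℚ) (mulF u v) g) (cong (Q._* _) (Qₚ.*-identityʳ a)))))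
      (pairing-mul-F x v g))

-- Words as functions on positions

Idx : ℕ → ℕ → Set
Idx n i = 1 ≤ i × i ≤ n

at-map : ∀ (f : ℕ → ℕ) u i → Idx (length u) i → at (map f u) i ≡ f (at u i)
at-map f [] i (s≤s _ , ())
at-map f (x ∷ u) (suc zero) _ = refl
at-map f (x ∷ u) (suc (suc i)) (_ , s≤s q) = at-map f u (suc i) (s≤s z≤n , q)

at-++ˡ : ∀ u v i → Idx (length u) i → at (u ++ v) i ≡ at u i
at-++ˡ [] v i (s≤s _ , ())
at-++ˡ (x ∷ u) v (suc zero) _ = refl
at-++ˡ (x ∷ u) v (suc (suc i)) (_ , s≤s q) = at-++ˡ u v (suc i) (s≤s z≤n , q)

-- With 1-based positions, `length u + 0` still belongs to `u`; hence the index `suc j`. Positions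
-- beyond a cut `p` have the shape `p + suc j` throughout.
at-++ʳ : ∀ u v j → at (u ++ v) (length u + suc j) ≡ at v (suc j)
at-++ʳ [] v j = refl
at-++ʳ (x ∷ []) v j = refl
at-++ʳ (x ∷ y ∷ u) v j = at-++ʳ (y ∷ u) v j

at-take : ∀ p u i → i ≤ p → at (take p u) i ≡ at u i
at-take p [] i _ = cong (λ w → at w i) (take-[] p)
  where
  take-[] : ∀ p → take p [] ≡ ([] {A = ℕ})
  take-[] zero = refl
  take-[] (suc p) = refl
at-take zero (x ∷ u) zero _ = refl
at-take (suc p) (x ∷ u) zero _ = refl
at-take (suc p) (x ∷ u) (suc zero) _ = refl
at-take (suc p) (x ∷ u) (suc (suc i)) (s≤s q) = at-take p u (suc i) q

at-drop : ∀ p u j → at (drop p u) (suc j) ≡ at u (p + suc j)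
at-drop zero u j = refl
at-drop (suc p) [] j = refl
at-drop (suc zero) (x ∷ u) j = refl
at-drop (suc (suc p)) (x ∷ u) j = at-drop (suc p) u j

at-∈ : ∀ u i → Idx (length u) i → at u i ∈ u
at-∈ [] i (s≤s _ , ())
at-∈ (x ∷ u) (suc zero) _ = here refl
at-∈ (x ∷ u) (suc (suc i)) (_ , s≤s q) = there (at-∈ u (suc i) (s≤s z≤n , q))

∈-at : ∀ u x → x ∈ u → ∃[ i ] (Idx (length u) i × at u i ≡ x)
∈-at (x ∷ u) .x (here refl) = 1 , (s≤s z≤n , s≤s z≤n) , refl
∈-at (y ∷ u) x (there p) with ∈-at u x p
... | suc i , (_ , q) , e = suc (suc i) , (s≤s z≤n , s≤s q) , e

at-ext : ∀ u v → length u ≡ length v → (∀ i → Idx (length u) i → at u i ≡ at v i) → u ≡ v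
at-ext [] [] _ _ = refl
at-ext (x ∷ u) (y ∷ v) e h =
  cong₂ _∷_ (h 1 (s≤s z≤n , s≤s z≤n))
    (at-ext u v (suc-injective e) λ { (suc i) (p , q) → h (suc (suc i)) (s≤s z≤n , s≤s q) ; zero (() , _) })

at-range : ∀ n i → Idx n i → at (range n) i ≡ i
at-range (suc n) i (p , q) with m≤n⇒m<n∨m≡n q
... | inj₁ (s≤s q') = begin
  at (range (suc n)) i ≡⟨ cong (λ w → at w i) (range-suc n) ⟩
  at (range n ++ suc n ∷ []) i ≡⟨ at-++ˡ (range n) _ i (p , subst (i ≤_) (sym (length-range n)) q') ⟩
  at (range n) i ≡⟨ at-range n i (p , q') ⟩
  i ∎
  where open ≡-Reasoning
... | inj₂ refl = begin
  at (range (suc n)) (suc n) ≡⟨ cong (λ w → at w (suc n)) (range-suc n) ⟩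
  at (range n ++ suc n ∷ []) (suc n) ≡⟨ cong (at (range n ++ suc n ∷ [])) (trans (cong suc (sym (+-identityʳ n)))
      (trans (sym (+-suc n 0)) (cong (_+ 1) (sym (length-range n))))) ⟩
  at (range n ++ suc n ∷ []) (length (range n) + 1) ≡⟨ at-++ʳ (range n) (suc n ∷ []) 0 ⟩
  suc n ∎
  where open ≡-Reasoning
at-range zero i (s≤s _ , ())

map-range-length : (f : ℕ → ℕ) → ∀ n → length (map f (range n)) ≡ n
map-range-length f n = trans (length-map f (range n)) (length-range n)

at-map-range : (f : ℕ → ℕ) → ∀ n i → Idx n i → at (map f (range n)) i ≡ f i
at-map-range f n i (p , q) = trans (at-map f (range n) i (p , subst (i ≤_) (sym (length-range n)) q)) (cong f (at-range n i (p , q)))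

map-at-range : ∀ n u → length u ≡ n → map (at u) (range n) ≡ u
map-at-range n u refl = at-ext _ u (map-range-length (at u) n)
  (λ i (p , q) → at-map-range (at u) n i (p , subst (i ≤_) (map-range-length (at u) n) q))

at-injective : ∀ u → Unique u → ∀ i j → Idx (length u) i → Idx (length u) j → at u i ≡ at u j → i ≡ j
at-injective [] _ i j (s≤s _ , ())
at-injective (x ∷ u) un (suc zero) (suc zero) _ _ _ = refl
at-injective (x ∷ u) un (suc zero) (suc (suc j)) _ (_ , s≤s q) e =
  ⊥-elim (Unique-head un (subst (_∈ u) (sym e) (at-∈ u (suc j) (s≤s z≤n , q))))
at-injective (x ∷ u) un (suc (suc i)) (suc zero) (_ , s≤s q) _ e =
  ⊥-elim (Unique-head un (subst (_∈ u) e (at-∈ u (suc i) (s≤s z≤n , q))))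
at-injective (x ∷ u) un (suc (suc i)) (suc (suc j)) (_ , s≤s p) (_ , s≤s q) e =
  cong suc (at-injective u (Unique-tail un) (suc i) (suc j) (s≤s z≤n , p) (s≤s z≤n , q) e)

at-injective⇒Unique : ∀ u → (∀ i j → Idx (length u) i → Idx (length u) j → at u i ≡ at u j → i ≡ j) → Unique u
at-injective⇒Unique [] _ = []
at-injective⇒Unique (x ∷ u) inj = Unique-∷ x∉
  (at-injective⇒Unique u λ { (suc i) (suc j) (_ , p) (_ , q) e →
      suc-injective (inj (suc (suc i)) (suc (suc j)) (s≤s z≤n , s≤s p) (s≤s z≤n , s≤s q) e)
    ; zero _ (() , _) ; (suc _) zero _ (() , _) })
  where
  x∉ : x ∉ u
  x∉ x∈ with ∈-at u x x∈
  ... | suc i , (_ , q) , e with inj 1 (suc (suc i)) (s≤s z≤n , s≤s z≤n) (s≤s z≤n , s≤s q) (sym e)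
  ... | ()

module _ {n : ℕ} {u : List ℕ} (P : IsPerm n u) where

  perm-length : length u ≡ n
  perm-length = trans (↭-length P) (length-range n)

  perm-Unique : Unique u
  perm-Unique = Unique-↭ (↭-sym P) (Unique-range n)

  perm-∈ : ∀ x → x ∈ u ↔ Idx n x
  perm-∈ x = (proj₁ (∈-range n x) ∘ ∈-resp-↭ P) , (∈-resp-↭ (↭-sym P) ∘ proj₂ (∈-range n x))

  perm-pos : ∀ {i} → Idx n i → Idx (length u) i
  perm-pos {i} (p , q) = p , subst (i ≤_) (sym perm-length) q

  perm-Idx : ∀ i → Idx n i → Idx n (at u i)
  perm-Idx i h = proj₁ (perm-∈ (at u i)) (at-∈ u i (perm-pos h))

  perm-inj : ∀ i j → Idx n i → Idx n j → at u i ≡ at u j → i ≡ j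
  perm-inj i j p q = at-injective u perm-Unique i j (perm-pos p) (perm-pos q)

word-ext : ∀ {n u v} → length u ≡ n → length v ≡ n → (∀ i → Idx n i → at u i ≡ at v i) → u ≡ v
word-ext {n} {u} {v} refl e h = at-ext u v (sym e) h

-- The letters are n distinct elements of [n], so they exhaust it.
mkPerm : ∀ {n u} → length u ≡ n → (∀ i → Idx n i → Idx n (at u i)) →
  (∀ i j → Idx n i → Idx n j → at u i ≡ at u j → i ≡ j) → IsPerm n u
mkPerm {n} {u} refl h inj = unique-⊆-length⇒↭ u (range n) (at-injective⇒Unique u inj) sub (sym (length-range n))
  where
  sub : ∀ x → x ∈ u → x ∈ range n
  sub x x∈ with ∈-at u x x∈
  ... | i , I , refl = proj₂ (∈-range n x) (h i I)

range-perm : ∀ n → IsPerm n (range n)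
range-perm n = ↭-refl

comp-length : ∀ u v → length (comp u v) ≡ length v
comp-length u v = length-map (at u) v

at-comp : ∀ {n} u v → length v ≡ n → ∀ i → Idx n i → at (comp u v) i ≡ at u (at v i)
at-comp u v refl i I = at-map (at u) v i I

comp-perm : ∀ {n u v} → IsPerm n u → IsPerm n v → IsPerm n (comp u v)
comp-perm {n} {u} {v} P Q = mkPerm (trans (comp-length u v) ℓ)
  (λ i I → subst (Idx n) (sym (at-comp u v ℓ i I)) (perm-Idx P _ (perm-Idx Q i I)))
  (λ i j I J e → perm-inj Q i j I J (perm-inj P _ _ (perm-Idx Q i I) (perm-Idx Q j J)
    (trans (sym (at-comp u v ℓ i I)) (trans e (at-comp u v ℓ j J)))))
  where ℓ = perm-length Q

indexOf-∈ : ∀ x u → x ∈ u → Idx (length u) (indexOf x u) × at u (indexOf x u) ≡ x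
indexOf-∈ x (y ∷ u) x∈ with bool? (x ≡ᵇ y)
... | inj₁ e rewrite e = (s≤s z≤n , s≤s z≤n) , sym (proj₁ (≡ᵇ-true x y) e)
indexOf-∈ x (y ∷ u) (here refl) | inj₂ ne = ⊥-elim (ne (proj₂ (≡ᵇ-true x x) refl))
indexOf-∈ x (y ∷ u) (there x∈) | inj₂ ne
  rewrite ≢true⇒≡false ne | proj₂ (memB-true x u) x∈ with indexOf x u | indexOf-∈ x u x∈
... | suc i | (_ , q) , e = (s≤s z≤n , s≤s q) , e

module _ {n : ℕ} {u : List ℕ} (P : IsPerm n u) where

  inverse-length : length (inverse u) ≡ n
  inverse-length = trans (map-range-length _ (length u)) (perm-length P)

  at-inverse : ∀ a → Idx n a → at (inverse u) a ≡ indexOf a u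
  at-inverse a A = at-map-range (λ i → indexOf i u) (length u) a (perm-pos P A)

  inverse-Idx : ∀ a → Idx n a → Idx n (at (inverse u) a)
  inverse-Idx a A = subst (Idx n) (sym (at-inverse a A))
    (subst (λ k → Idx k (indexOf a u)) (perm-length P) (proj₁ (indexOf-∈ a u (proj₂ (perm-∈ P a) A))))

  at-inverseʳ : ∀ a → Idx n a → at u (at (inverse u) a) ≡ a
  at-inverseʳ a A = trans (cong (at u) (at-inverse a A)) (proj₂ (indexOf-∈ a u (proj₂ (perm-∈ P a) A)))

  at-inverseˡ : ∀ i → Idx n i → at (inverse u) (at u i) ≡ i
  at-inverseˡ i I = perm-inj P _ i (inverse-Idx _ (perm-Idx P i I)) I (at-inverseʳ _ (perm-Idx P i I))

  inverse-perm : IsPerm n (inverse u)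
  inverse-perm = mkPerm inverse-length inverse-Idx
    (λ i j I J e → trans (sym (at-inverseʳ i I)) (trans (cong (at u) e) (at-inverseʳ j J)))

comp-inverse-cancel : ∀ {n u} v → length v ≡ n → IsPerm n u → comp (comp v (inverse u)) u ≡ v
comp-inverse-cancel {n} {u} v ℓ P = word-ext (trans (comp-length (comp v (inverse u)) u) (perm-length P)) ℓ λ i I →
  trans (at-comp (comp v (inverse u)) u (perm-length P) i I)
    (trans (at-comp v (inverse u) (inverse-length P) _ (perm-Idx P i I)) (cong (at v) (at-inverseˡ P i I)))

comp-cancel-inverse : ∀ {n u} v → length v ≡ n → IsPerm n u → comp (comp v u) (inverse u) ≡ v
comp-cancel-inverse {n} {u} v ℓ P = word-ext (trans (comp-length (comp v u) (inverse u)) (inverse-length P)) ℓ λ i I →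
  trans (at-comp (comp v u) (inverse u) (inverse-length P) i I)
    (trans (at-comp v u (perm-length P) _ (inverse-Idx P i I)) (cong (at v) (at-inverseʳ P i I)))

-- The enumeration of permutations

∈-insertAll⇒↭ : ∀ x u v → v ∈ insertAll x u → v ↭ x ∷ u
∈-insertAll⇒↭ x [] v (here refl) = ↭-refl
∈-insertAll⇒↭ x (y ∷ u) v (here refl) = ↭-refl
∈-insertAll⇒↭ x (y ∷ u) v (there p) with ∈-map⁻ (y ∷_) p
... | w , w∈ , refl = ↭-trans (↭-prep y (∈-insertAll⇒↭ x u w w∈)) (↭-swap y x ↭-refl)

insertAll-∈ : ∀ x as bs → as ++ x ∷ bs ∈ insertAll x (as ++ bs)
insertAll-∈ x [] [] = here refl
insertAll-∈ x [] (b ∷ bs) = here refl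
insertAll-∈ x (a ∷ as) bs = there (∈-map⁺ (a ∷_) (insertAll-∈ x as bs))

∈-perms : ∀ n u → u ∈ perms n ↔ IsPerm n u
∈-perms zero u = (λ { (here refl) → ↭-refl }) , (λ P → empty u (perm-length P))
  where
  empty : ∀ u → length u ≡ 0 → u ∈ perms zero
  empty [] _ = here refl
∈-perms (suc n) u = to , from
  where
  split : range (suc n) ↭ suc n ∷ range n
  split = ↭-trans (↭-reflexive (range-suc n)) (++-comm (range n) (suc n ∷ []))
  to : u ∈ perms (suc n) → IsPerm (suc n) u
  to p with proj₁ (∈-concatMap (insertAll (suc n)) (perms n) u) p
  ... | v , v∈ , q = ↭-trans (∈-insertAll⇒↭ _ _ _ q) (↭-trans (↭-prep _ (proj₁ (∈-perms n v) v∈)) (↭-sym split))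
  from : IsPerm (suc n) u → u ∈ perms (suc n)
  from P with ∈-∃++ (proj₂ (perm-∈ P (suc n)) (s≤s z≤n , ≤-refl))
  ... | as , bs , refl = proj₂ (∈-concatMap (insertAll (suc n)) (perms n) _)
    (as ++ bs , proj₂ (∈-perms n (as ++ bs)) (drop-∷ (↭-trans (↭-sym (shift (suc n) as bs)) (↭-trans P split))) ,
     insertAll-∈ (suc n) as bs)

-- Deleting the inserted letter recovers `u`. Different `u` therefore have disjoint lists of
-- insertions, which is what keeps `perms` free of repetitions.
insertAll-remove : ∀ x u v → x ∉ u → v ∈ insertAll x u → filterB (λ y → not (y ≡ᵇ x)) v ≡ u
insertAll-remove x [] v x∉ (here refl) rewrite proj₂ (≡ᵇ-true x x) refl = refl
insertAll-remove x (y ∷ u) v x∉ (here refl) rewrite proj₂ (≡ᵇ-true x x) refl = keep (y ∷ u) x∉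
  where
  keep : ∀ w → x ∉ w → filterB (λ y → not (y ≡ᵇ x)) w ≡ w
  keep [] _ = refl
  keep (z ∷ w) h rewrite ≢true⇒≡false {z ≡ᵇ x} (λ e → h (here (sym (proj₁ (≡ᵇ-true z x) e)))) = cong (z ∷_) (keep w (h ∘ there))
insertAll-remove x (y ∷ u) v x∉ (there p) with ∈-map⁻ (y ∷_) p
... | w , w∈ , refl rewrite ≢true⇒≡false {y ≡ᵇ x} (λ e → x∉ (here (sym (proj₁ (≡ᵇ-true y x) e)))) =
  cong (y ∷_) (insertAll-remove x u w (x∉ ∘ there) w∈)

Unique-insertAll : ∀ x u → x ∉ u → Unique (insertAll x u)
Unique-insertAll x [] _ = [] ∷ []
Unique-insertAll x (y ∷ u) x∉ = Unique-∷ new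
  (Unique-map (y ∷_) (insertAll x u) (Unique-insertAll x u (x∉ ∘ there)) λ { a .a _ _ refl → refl })
  where
  new : x ∷ y ∷ u ∉ map (y ∷_) (insertAll x u)
  new p with ∈-map⁻ (y ∷_) p
  ... | w , _ , refl = x∉ (here refl)

Unique-perms : ∀ n → Unique (perms n)
Unique-perms zero = [] ∷ []
Unique-perms (suc n) = Unique-concatMap (insertAll (suc n)) (perms n) (Unique-perms n)
  (λ u u∈ → Unique-insertAll (suc n) u (suc∉ u u∈))
  (λ u v w u∈ v∈ p q → trans (sym (insertAll-remove (suc n) u w (suc∉ u u∈) p)) (insertAll-remove (suc n) v w (suc∉ v v∈) q))
  where
  suc∉ : ∀ u → u ∈ perms n → suc n ∉ u
  suc∉ u u∈ p = 1+n≰n (proj₂ (proj₁ (perm-∈ (proj₁ (∈-perms n u) u∈) (suc n)) p))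

∑-perms-δ : ∀ n u (f : List ℕ → ℚ) → IsPerm n u → ∑ (perms n) (λ y → 𝟙 (eqW u y) Q.* f y) ≡ f u
∑-perms-δ n u f P = ∑-δ (perms n) u f (proj₂ (∈-perms n u) P) (Unique-perms n)

-- Counting and inversions

b2n : Bool → ℕ
b2n b = if b then 1 else 0

module _ {A : Set} where

  sumOver : List A → (A → ℕ) → ℕ
  sumOver [] f = 0
  sumOver (x ∷ xs) f = f x + sumOver xs f

  countB-sum : (p : A → Bool) (xs : List A) → countB p xs ≡ sumOver xs (b2n ∘ p)
  countB-sum p [] = refl
  countB-sum p (x ∷ xs) with p x
  ... | true = cong suc (countB-sum p xs)
  ... | false = countB-sum p xs

  sumOver-↭ : {xs ys : List A} → xs ↭ ys → (f : A → ℕ) → sumOver xs f ≡ sumOver ys f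
  sumOver-↭ refl f = refl
  sumOver-↭ (prep x p) f = cong (f x +_) (sumOver-↭ p f)
  sumOver-↭ (swap {xs} {ys} x y p) f =
    trans (cong (λ s → f x + (f y + s)) (sumOver-↭ p f))
      (trans (sym (+-assoc (f x) (f y) _)) (trans (cong (_+ sumOver ys f) (+-comm (f x) (f y))) (+-assoc (f y) (f x) _)))
  sumOver-↭ (↭trans p q) f = trans (sumOver-↭ p f) (sumOver-↭ q f)

  countB-↭ : (p : A → Bool) {xs ys : List A} → xs ↭ ys → countB p xs ≡ countB p ys
  countB-↭ p {xs} {ys} h = trans (countB-sum p xs) (trans (sumOver-↭ h (b2n ∘ p)) (sym (countB-sum p ys)))

  countB-cong : {p q : A → Bool} (xs : List A) → (∀ x → x ∈ xs → p x ≡ q x) → countB p xs ≡ countB q xs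
  countB-cong xs h = cong length (filterB-cong xs h)

  countB-map : {B : Set} (p : A → Bool) (f : B → A) (xs : List B) → countB p (map f xs) ≡ countB (p ∘ f) xs
  countB-map p f [] = refl
  countB-map p f (x ∷ xs) with p (f x)
  ... | true = cong suc (countB-map p f xs)
  ... | false = countB-map p f xs

  countB-++ : (p : A → Bool) (xs ys : List A) → countB p (xs ++ ys) ≡ countB p xs + countB p ys
  countB-++ p [] ys = refl
  countB-++ p (x ∷ xs) ys with p x
  ... | true = cong suc (countB-++ p xs ys)
  ... | false = countB-++ p xs ys

  countB-none : (p : A → Bool) (xs : List A) → (∀ x → x ∈ xs → p x ≡ false) → countB p xs ≡ 0
  countB-none p [] h = refl
  countB-none p (x ∷ xs) h rewrite h x (here refl) = countB-none p xs (λ y y∈ → h y (there y∈))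

  countB-all : (p : A → Bool) (xs : List A) → (∀ x → x ∈ xs → p x ≡ true) → countB p xs ≡ length xs
  countB-all p [] h = refl
  countB-all p (x ∷ xs) h rewrite h x (here refl) = cong suc (countB-all p xs (λ y y∈ → h y (there y∈)))

  countB-≤ : {p q : A → Bool} (xs : List A) → (∀ x → x ∈ xs → p x ≡ true → q x ≡ true) → countB p xs ≤ countB q xs
  countB-≤ [] h = z≤n
  countB-≤ {p} {q} (x ∷ xs) h with p x | q x | h x (here refl)
  ... | true | true | _ = s≤s (countB-≤ xs (λ y y∈ → h y (there y∈)))
  ... | true | false | k with k refl
  ... | ()
  countB-≤ {p} {q} (x ∷ xs) h | false | true | _ = m≤n⇒m≤1+n (countB-≤ xs (λ y y∈ → h y (there y∈)))
  countB-≤ {p} {q} (x ∷ xs) h | false | false | _ = countB-≤ xs (λ y y∈ → h y (there y∈))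

  countB-< : {p q : A → Bool} (xs : List A) → (∀ x → x ∈ xs → p x ≡ true → q x ≡ true) →
    ∀ x → x ∈ xs → p x ≡ false → q x ≡ true → countB p xs < countB q xs
  countB-< (x ∷ xs) h .x (here refl) px qx rewrite px | qx = s≤s (countB-≤ xs (λ y y∈ → h y (there y∈)))
  countB-< {p} {q} (y ∷ xs) h x (there x∈) px qx with p y | q y | h y (here refl)
  ... | true | true | _ = s≤s (countB-< xs (λ z z∈ → h z (there z∈)) x x∈ px qx)
  ... | true | false | k with k refl
  ... | ()
  countB-< {p} {q} (y ∷ xs) h x (there x∈) px qx | false | true | _ = m≤n⇒m≤1+n (countB-< xs (λ z z∈ → h z (there z∈)) x x∈ px qx)
  countB-< {p} {q} (y ∷ xs) h x (there x∈) px qx | false | false | _ = countB-< xs (λ z z∈ → h z (there z∈)) x x∈ px qx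

  sumOver-+ : (xs : List A) (f g : A → ℕ) → sumOver xs (λ x → f x + g x) ≡ sumOver xs f + sumOver xs g
  sumOver-+ [] f g = refl
  sumOver-+ (x ∷ xs) f g = trans (cong (f x + g x +_) (sumOver-+ xs f g))
    (interchange (f x) (g x) (sumOver xs f) (sumOver xs g))

  sumOver-cong : (xs : List A) {f g : A → ℕ} → (∀ x → x ∈ xs → f x ≡ g x) → sumOver xs f ≡ sumOver xs g
  sumOver-cong [] h = refl
  sumOver-cong (x ∷ xs) h = cong₂ _+_ (h x (here refl)) (sumOver-cong xs (λ y y∈ → h y (there y∈)))

pairSum : (ℕ → ℕ → ℕ) → List ℕ → ℕ
pairSum f [] = 0
pairSum f (x ∷ xs) = sumOver xs (f x) + pairSum f xs

pairSum-cong : ∀ {R : ℕ → ℕ → Set} {f g} xs → AllPairs R xs →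
  (∀ a b → a ∈ xs → b ∈ xs → R a b → f a b ≡ g a b) → pairSum f xs ≡ pairSum g xs
pairSum-cong [] _ h = refl
pairSum-cong (x ∷ xs) (r ∷ rs) h = cong₂ _+_
  (sumOver-cong xs (λ y y∈ → h x y (here refl) (there y∈) (All-lookup r y∈)))
  (pairSum-cong xs rs (λ a b a∈ b∈ → h a b (there a∈) (there b∈)))

pairSum-+ : ∀ f g xs → pairSum (λ a b → f a b + g a b) xs ≡ pairSum f xs + pairSum g xs
pairSum-+ f g [] = refl
pairSum-+ f g (x ∷ xs) = trans (cong₂ _+_ (sumOver-+ xs (f x) (g x)) (pairSum-+ f g xs))
  (interchange (sumOver xs (f x)) (sumOver xs (g x)) (pairSum f xs) (pairSum g xs))

-- A symmetric summand forgets the order within a pair, so pairs of values may be enumerated along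
-- any word. `len-comp` needs this to count the inversions of `w` along `u`.
pairSum-↭ : ∀ {f} → (∀ a b → f a b ≡ f b a) → ∀ {xs ys} → xs ↭ ys → pairSum f xs ≡ pairSum f ys
pairSum-↭ s refl = refl
pairSum-↭ {f} s (prep x p) = cong₂ _+_ (sumOver-↭ p (f x)) (pairSum-↭ s p)
pairSum-↭ {f} s (swap {xs} {ys} x y p) = begin
  f x y + sumOver xs (f x) + (sumOver xs (f y) + pairSum f xs)
    ≡⟨ cong₂ _+_ (cong₂ _+_ (s x y) (sumOver-↭ p (f x))) (cong₂ _+_ (sumOver-↭ p (f y)) (pairSum-↭ s p)) ⟩
  f y x + X + (Y + P) ≡⟨ +-assoc (f y x) X (Y + P) ⟩
  f y x + (X + (Y + P)) ≡⟨ cong (f y x +_) (trans (sym (+-assoc X Y P)) (trans (cong (_+ P) (+-comm X Y)) (+-assoc Y X P))) ⟩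
  f y x + (Y + (X + P)) ≡⟨ sym (+-assoc (f y x) Y (X + P)) ⟩
  f y x + Y + (X + P) ∎
  where
  open ≡-Reasoning
  X = sumOver ys (f x)
  Y = sumOver ys (f y)
  P = pairSum f ys
pairSum-↭ s (↭trans p q) = trans (pairSum-↭ s p) (pairSum-↭ s q)

sumOver-0 : ∀ (f : ℕ → ℕ) xs → sumOver xs f ≡ 0 → ∀ x → x ∈ xs → f x ≡ 0
sumOver-0 f (x ∷ xs) e .x (here refl) = m+n≡0⇒m≡0 (f x) e
sumOver-0 f (y ∷ xs) e x (there x∈) = sumOver-0 f xs (m+n≡0⇒n≡0 (f y) e) x x∈

0-sumOver : ∀ (f : ℕ → ℕ) xs → (∀ x → x ∈ xs → f x ≡ 0) → sumOver xs f ≡ 0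
0-sumOver f [] h = refl
0-sumOver f (x ∷ xs) h = cong₂ _+_ (h x (here refl)) (0-sumOver f xs (λ y y∈ → h y (there y∈)))

pairSum-0 : ∀ f xs → pairSum f xs ≡ 0 → ∀ i j → 1 ≤ i → i < j → j ≤ length xs → f (at xs i) (at xs j) ≡ 0
pairSum-0 f (x ∷ xs) e (suc zero) (suc (suc j)) _ _ (s≤s q) =
  sumOver-0 (f x) xs (m+n≡0⇒m≡0 (sumOver xs (f x)) e) _ (at-∈ xs (suc j) (s≤s z≤n , q))
pairSum-0 f (x ∷ xs) e (suc (suc i)) (suc (suc j)) _ (s≤s i<j) (s≤s q) =
  pairSum-0 f xs (m+n≡0⇒n≡0 (sumOver xs (f x)) e) (suc i) (suc j) (s≤s z≤n) i<j q
pairSum-0 f (x ∷ xs) e (suc zero) (suc zero) _ (s≤s ()) _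
pairSum-0 f (x ∷ xs) e (suc (suc i)) (suc zero) _ (s≤s ()) _
pairSum-0 f [] e i j p (s≤s q) ()

0-pairSum : ∀ f xs → (∀ i j → 1 ≤ i → i < j → j ≤ length xs → f (at xs i) (at xs j) ≡ 0) → pairSum f xs ≡ 0
0-pairSum f [] h = refl
0-pairSum f (x ∷ xs) h = cong₂ _+_
  (0-sumOver (f x) xs head0)
  (0-pairSum f xs λ { (suc i) (suc j) _ p q → h (suc (suc i)) (suc (suc j)) (s≤s z≤n) (s≤s p) (s≤s q) })
  where
  head0 : ∀ y → y ∈ xs → f x y ≡ 0
  head0 y y∈ with ∈-at xs y y∈
  ... | suc j , (_ , q) , refl = h 1 (suc (suc j)) ≤-refl (s≤s (s≤s z≤n)) (s≤s q)

inv : ℕ → ℕ → ℕ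
inv x y = b2n (y <ᵇ x)

len-pairSum : ∀ u → len u ≡ pairSum inv u
len-pairSum [] = refl
len-pairSum (x ∷ u) = cong₂ _+_ (countB-sum _ u) (len-pairSum u)

pairSum-map : ∀ f (g : ℕ → ℕ) xs → pairSum f (map g xs) ≡ pairSum (λ a b → f (g a) (g b)) xs
pairSum-map f g [] = refl
pairSum-map f g (x ∷ xs) = cong₂ _+_ (sumOver-map xs) (pairSum-map f g xs)
  where
  sumOver-map : ∀ ys → sumOver (map g ys) (f (g x)) ≡ sumOver ys (λ b → f (g x) (g b))
  sumOver-map [] = refl
  sumOver-map (y ∷ ys) = cong (f (g x) (g y) +_) (sumOver-map ys)

range-AllPairs-< : ∀ n → AllPairs _<_ (range n)
range-AllPairs-< n = AllPairsₚ.map⁺ (AllPairsₚ.applyUpTo⁺₁ id n (λ p _ → s≤s p))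

b2n-false : ∀ {b} → b ≢ true → b2n b ≡ 0
b2n-false h = cong b2n (≢true⇒≡false h)

b2n-0 : ∀ {b} → b2n b ≡ 0 → b ≢ true
b2n-0 {false} _ ()
b2n-0 {true} ()

<⇒ᵇ : ∀ {m n} → m < n → (m <ᵇ n) ≡ true
<⇒ᵇ {m} {n} = proj₂ (<ᵇ-true m n)

≮⇒ᵇ : ∀ {m n} → ¬ (m < n) → (m <ᵇ n) ≡ false
≮⇒ᵇ {m} {n} h = ≢true⇒≡false (h ∘ proj₁ (<ᵇ-true m n))

-- The inversions of w and of u that cancel in w ∘ u are counted twice on the left.
len-comp : ∀ {n w u} → IsPerm n w → IsPerm n u →
  len w + len u ≡ len (comp w u) + 2 * pairSum (λ a b → b2n ((b <ᵇ a) ∧ (at w a <ᵇ at w b))) u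
len-comp {n} {w} {u} W U = begin
  len w + len u ≡⟨ cong₂ _+_ len-w (len-pairSum u) ⟩
  pairSum g u + pairSum inv u ≡⟨ sym (pairSum-+ g inv u) ⟩
  pairSum (λ a b → g a b + inv a b) u ≡⟨ pairSum-cong u (perm-Unique U) pointwise ⟩
  pairSum (λ a b → inv (at w a) (at w b) + (h a b + h a b)) u ≡⟨ pairSum-+ _ _ u ⟩
  pairSum (λ a b → inv (at w a) (at w b)) u + pairSum (λ a b → h a b + h a b) u
    ≡⟨ cong₂ _+_ (trans (sym (pairSum-map inv (at w) u)) (sym (len-pairSum (comp w u)))) (pairSum-+ h h u) ⟩
  len (comp w u) + (pairSum h u + pairSum h u) ≡⟨ cong (λ s → len (comp w u) + (pairSum h u + s)) (sym (+-identityʳ _)) ⟩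
  len (comp w u) + 2 * pairSum h u ∎
  where
  open ≡-Reasoning
  h : ℕ → ℕ → ℕ
  h a b = b2n ((b <ᵇ a) ∧ (at w a <ᵇ at w b))
  -- Indicator that `w` inverts the two values, whichever of them is smaller. For a < b it is the
  -- usual inversion indicator, and being symmetric it may be summed along `u` instead of `range n`.
  g : ℕ → ℕ → ℕ
  g a b = b2n ((a <ᵇ b) ∧ (at w b <ᵇ at w a)) + h a b
  g-sym : ∀ a b → g a b ≡ g b a
  g-sym a b = +-comm (b2n ((a <ᵇ b) ∧ (at w b <ᵇ at w a))) (h a b)
  g-< : ∀ a b → a ∈ range n → b ∈ range n → a < b → inv (at w a) (at w b) ≡ g a b
  g-< a b _ _ a<b rewrite <⇒ᵇ a<b | ≮⇒ᵇ (<⇒≯ a<b) = sym (+-identityʳ _)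
  len-w : len w ≡ pairSum g u
  len-w = begin
    len w ≡⟨ cong len (sym (map-at-range n w (perm-length W))) ⟩
    len (map (at w) (range n)) ≡⟨ len-pairSum (map (at w) (range n)) ⟩
    pairSum inv (map (at w) (range n)) ≡⟨ pairSum-map inv (at w) (range n) ⟩
    pairSum (λ a b → inv (at w a) (at w b)) (range n) ≡⟨ pairSum-cong (range n) (range-AllPairs-< n) g-< ⟩
    pairSum g (range n) ≡⟨ pairSum-↭ g-sym (↭-sym U) ⟩
    pairSum g u ∎
  pointwise : ∀ a b → a ∈ u → b ∈ u → a ≢ b → g a b + inv a b ≡ inv (at w a) (at w b) + (h a b + h a b)
  pointwise a b a∈ b∈ a≢b with <-cmp a b
  ... | tri< a<b _ b≮a rewrite <⇒ᵇ a<b | ≮⇒ᵇ b≮a = cong (_+ 0) (+-identityʳ _)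
  ... | tri≈ _ e _ = ⊥-elim (a≢b e)
  ... | tri> a≮b _ b<a rewrite <⇒ᵇ b<a | ≮⇒ᵇ a≮b with <-cmp (at w a) (at w b)
  ... | tri< p _ q rewrite <⇒ᵇ p | ≮⇒ᵇ q = refl
  ... | tri≈ _ e _ = ⊥-elim (a≢b (perm-inj W a b (proj₁ (perm-∈ U a) a∈) (proj₁ (perm-∈ U b) b∈) e))
  ... | tri> q _ p rewrite <⇒ᵇ p | ≮⇒ᵇ q = refl

-- The weak order as containment of inversion sets

InvSub : ℕ → List ℕ → List ℕ → Set
InvSub n u v = ∀ i j → 1 ≤ i → i < j → j ≤ n → at u j < at u i → at v j < at v i

InvSub-refl : ∀ {n} u → InvSub n u u
InvSub-refl u i j _ _ _ h = h

InvSub-trans : ∀ {n u v w} → InvSub n u v → InvSub n v w → InvSub n u w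
InvSub-trans a b i j p q r h = b i j p q r (a i j p q r h)

Idxˡ : ∀ {n i j} → 1 ≤ i → i < j → j ≤ n → Idx n i
Idxˡ p q r = p , ≤-trans (<⇒≤ q) r

Idxʳ : ∀ {n i j} → 1 ≤ i → i < j → j ≤ n → Idx n j
Idxʳ p q r = ≤-trans p (<⇒≤ q) , r

perm-≮⇒> : ∀ {n u} → IsPerm n u → ∀ i j → Idx n i → Idx n j → i ≢ j → ¬ (at u i < at u j) → at u j < at u i
perm-≮⇒> {u = u} P i j I J i≢j h = ≤∧≢⇒< (≮⇒≥ h) (λ e → i≢j (perm-inj P i j I J (sym e)))

-- By `len-comp`, lengths add in v = wu exactly when `w` undoes no inversion of `u`, that is, when
-- positions inverted in `u` stay inverted in `v`. Conversely `w` must be v u⁻¹.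
weakLe-true : ∀ {n u v} → IsPerm n u → IsPerm n v → weakLe u v ≡ true ↔ InvSub n u v
weakLe-true {n} {u} {v} U V = to , from
  where
  ℓu = perm-length U
  cond : List ℕ → Bool
  cond w = eqW v (comp w u) ∧ (len v ≡ᵇ (len w + len u))
  h : List ℕ → ℕ → ℕ → ℕ
  h w a b = b2n ((b <ᵇ a) ∧ (at w a <ᵇ at w b))
  to : weakLe u v ≡ true → InvSub n u v
  to e i j p q r inv-u with proj₁ (anyB-true cond (perms (length u))) e
  ... | w , w∈ , c = subst₂ _<_ (eq j (Idxʳ p q r)) (eq i (Idxˡ p q r)) wj<wi
    where
    W : IsPerm n w
    W = subst (λ k → IsPerm k w) ℓu (proj₁ (∈-perms (length u) w) w∈)
    v≡ : v ≡ comp w u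
    v≡ = proj₁ (eqW-true v (comp w u)) (proj₁ (∧-elim c))
    eq : ∀ k → Idx n k → at w (at u k) ≡ at v k
    eq k K = trans (sym (at-comp w u ℓu k K)) (cong (λ x → at x k) (sym v≡))
    none : pairSum (h w) u ≡ 0
    none = m+n≡0⇒m≡0 _ (+-cancelˡ-≡ (len v) _ 0 (begin
      len v + 2 * pairSum (h w) u ≡⟨ cong (λ x → len x + 2 * pairSum (h w) u) v≡ ⟩
      len (comp w u) + 2 * pairSum (h w) u ≡⟨ sym (len-comp W U) ⟩
      len w + len u ≡⟨ sym (proj₁ (≡ᵇ-true (len v) _) (proj₂ (∧-elim {eqW v (comp w u)} c))) ⟩
      len v ≡⟨ sym (+-identityʳ (len v)) ⟩
      len v + 0 ∎))
      where open ≡-Reasoning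
    wj<wi : at w (at u j) < at w (at u i)
    wj<wi = perm-≮⇒> W (at u i) (at u j) (perm-Idx U i (Idxˡ p q r)) (perm-Idx U j (Idxʳ p q r))
      (λ e → <⇒≢ inv-u (sym e))
      (λ lt → b2n-0 (pairSum-0 (h w) u none i j p q (subst (j ≤_) (sym ℓu) r)) (∧-intro (<⇒ᵇ inv-u) (<⇒ᵇ lt)))
  from : InvSub n u v → weakLe u v ≡ true
  from sub = proj₂ (anyB-true cond (perms (length u)))
    (w , proj₂ (∈-perms (length u) w) (subst (λ k → IsPerm k w) (sym ℓu) W) ,
     ∧-intro (proj₂ (eqW-true v (comp w u)) (sym v≡)) (proj₂ (≡ᵇ-true (len v) _) (sym lens)))
    where
    w = comp v (inverse u)
    W = comp-perm V (inverse-perm U)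
    v≡ : comp w u ≡ v
    v≡ = comp-inverse-cancel v (perm-length V) U
    eq : ∀ k → Idx n k → at w (at u k) ≡ at v k
    eq k K = trans (sym (at-comp w u ℓu k K)) (cong (λ x → at x k) v≡)
    none : pairSum (h w) u ≡ 0
    none = 0-pairSum (h w) u λ i j p q r' → let r = subst (j ≤_) ℓu r' in
      b2n-false λ c → <-asym (sub i j p q r (proj₁ (<ᵇ-true _ _) (proj₁ (∧-elim c))))
        (subst₂ _<_ (eq i (Idxˡ p q r)) (eq j (Idxʳ p q r)) (proj₁ (<ᵇ-true _ _) (proj₂ (∧-elim {at u j <ᵇ at u i} c))))
    lens : len w + len u ≡ len v
    lens = trans (len-comp W U) (trans (cong₂ _+_ (cong len v≡) (cong (2 *_) none)) (+-identityʳ _))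

-- Standardization

countB-<-range : ∀ n x → Idx n x → suc (countB (λ y → y <ᵇ x) (range n)) ≡ x
countB-<-range n x (p , q) = begin
  suc (countB (λ y → y <ᵇ x) (range n)) ≡⟨ cong suc (upto n x q) ⟩
  suc (x ∸ 1) ≡⟨ m+[n∸m]≡n p ⟩
  x ∎
  where
  open ≡-Reasoning
  all< : ∀ n x → n < x → countB (λ y → y <ᵇ x) (range n) ≡ n
  all< n x h = trans (countB-all _ (range n) (λ y y∈ → <⇒ᵇ (≤-<-trans (proj₂ (proj₁ (∈-range n y) y∈)) h))) (length-range n)
  upto : ∀ n x → x ≤ n → countB (λ y → y <ᵇ x) (range n) ≡ x ∸ 1
  upto zero zero _ = refl
  upto (suc n) x h with m≤n⇒m<n∨m≡n h
  ... | inj₁ (s≤s h') = begin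
    countB (λ y → y <ᵇ x) (range (suc n)) ≡⟨ cong (countB (λ y → y <ᵇ x)) (range-suc n) ⟩
    countB (λ y → y <ᵇ x) (range n ++ suc n ∷ []) ≡⟨ countB-++ _ (range n) _ ⟩
    countB (λ y → y <ᵇ x) (range n) + countB (λ y → y <ᵇ x) (suc n ∷ [])
      ≡⟨ cong₂ _+_ (upto n x h') (countB-none (λ y → y <ᵇ x) (suc n ∷ []) λ { y (here refl) → ≮⇒ᵇ (≤⇒≯ (m≤n⇒m≤1+n h')) }) ⟩
    x ∸ 1 + 0 ≡⟨ +-identityʳ _ ⟩
    x ∸ 1 ∎
  ... | inj₂ refl = begin
    countB (λ y → y <ᵇ suc n) (range (suc n)) ≡⟨ cong (countB (λ y → y <ᵇ suc n)) (range-suc n) ⟩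
    countB (λ y → y <ᵇ suc n) (range n ++ suc n ∷ []) ≡⟨ countB-++ _ (range n) _ ⟩
    countB (λ y → y <ᵇ suc n) (range n) + countB (λ y → y <ᵇ suc n) (suc n ∷ [])
      ≡⟨ cong₂ _+_ (all< n (suc n) ≤-refl) (countB-none (λ y → y <ᵇ suc n) (suc n ∷ []) λ { y (here refl) → ≮⇒ᵇ {suc n} (n≮n (suc n)) }) ⟩
    n + 0 ≡⟨ +-identityʳ n ⟩
    n ∎

st-length : ∀ a → length (st a) ≡ length a
st-length a = length-map _ a

at-st : ∀ a i → Idx (length a) i → at (st a) i ≡ suc (countB (λ y → y <ᵇ at a i) a)
at-st a i I = at-map _ a i I

st-< : ∀ a i j → Idx (length a) i → Idx (length a) j → at a i < at a j → at (st a) i < at (st a) j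
st-< a i j I J h = subst₂ _<_ (sym (at-st a i I)) (sym (at-st a j J))
  (s≤s (countB-< a (λ y _ p → <⇒ᵇ (<-trans (proj₁ (<ᵇ-true _ _) p) h)) (at a i) (at-∈ a i I) (≮⇒ᵇ (n≮n (at a i))) (<⇒ᵇ h)))

st-order : ∀ a i j → Idx (length a) i → Idx (length a) j → at (st a) i < at (st a) j ↔ at a i < at a j
st-order a i j I J = to , st-< a i j I J
  where
  to : at (st a) i < at (st a) j → at a i < at a j
  to h with <-cmp (at a i) (at a j)
  ... | tri< p _ _ = p
  ... | tri≈ _ e _ = ⊥-elim (<⇒≢ h (trans (at-st a i I) (trans (cong (λ x → suc (countB (λ y → y <ᵇ x) a)) e) (sym (at-st a j J)))))
  ... | tri> _ _ p = ⊥-elim (<-asym h (st-< a j i J I p))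

st-perm : ∀ {n} a → length a ≡ n → Unique a → IsPerm n (st a)
st-perm a refl u = mkPerm (st-length a)
  (λ i I → subst (Idx (length a)) (sym (at-st a i I)) (s≤s z≤n ,
    subst (countB (λ y → y <ᵇ at a i) a <_) (countB-all (λ _ → true) a (λ _ _ → refl))
      (countB-< a (λ _ _ _ → refl) (at a i) (at-∈ a i I) (≮⇒ᵇ (n≮n (at a i))) refl)))
  λ i j I J e → inj i j I J e (<-cmp (at a i) (at a j))
  where
  inj : ∀ i j → Idx (length a) i → Idx (length a) j → at (st a) i ≡ at (st a) j → _ → i ≡ j
  inj i j I J e (tri< p _ _) = ⊥-elim (<⇒≢ (st-< a i j I J p) e)
  inj i j I J e (tri≈ _ q _) = at-injective a u i j I J q
  inj i j I J e (tri> _ _ p) = ⊥-elim (<⇒≢ (st-< a j i J I p) (sym e))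

st-idem : ∀ {n u} → IsPerm n u → st u ≡ u
st-idem {n} {u} P = word-ext (trans (st-length u) ℓ) ℓ λ i I → begin
  at (st u) i ≡⟨ at-st u i (perm-pos P I) ⟩
  suc (countB (λ y → y <ᵇ at u i) u) ≡⟨ cong suc (countB-↭ _ P) ⟩
  suc (countB (λ y → y <ᵇ at u i) (range n)) ≡⟨ countB-<-range n (at u i) (perm-Idx P i I) ⟩
  at u i ∎
  where
  open ≡-Reasoning
  ℓ = perm-length P

-- Ranks count smaller letters; counting the positions of these letters instead shows that only the
-- relative order of positions enters.
st-cong : ∀ {n} a b → length a ≡ n → length b ≡ n →
  (∀ i j → Idx n i → Idx n j → at a i < at a j ↔ at b i < at b j) → st a ≡ st b
st-cong {n} a b ℓa ℓb h = word-ext (trans (st-length a) ℓa) (trans (st-length b) ℓb) λ i I → begin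
  at (st a) i ≡⟨ at-st a i (subst (λ k → Idx k i) (sym ℓa) I) ⟩
  suc (countB (λ y → y <ᵇ at a i) a) ≡⟨ cong suc (viaRange a ℓa i) ⟩
  suc (countB (λ j → at a j <ᵇ at a i) (range n))
    ≡⟨ cong suc (countB-cong (range n) λ j j∈ → bool-ext
         (let f , g = h j i (proj₁ (∈-range n j) j∈) I in
          (<⇒ᵇ ∘ f ∘ proj₁ (<ᵇ-true _ _)) , (<⇒ᵇ ∘ g ∘ proj₁ (<ᵇ-true _ _)))) ⟩
  suc (countB (λ j → at b j <ᵇ at b i) (range n)) ≡⟨ cong suc (sym (viaRange b ℓb i)) ⟩
  suc (countB (λ y → y <ᵇ at b i) b) ≡⟨ sym (at-st b i (subst (λ k → Idx k i) (sym ℓb) I)) ⟩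
  at (st b) i ∎
  where
  open ≡-Reasoning
  viaRange : ∀ c → length c ≡ n → ∀ i → countB (λ y → y <ᵇ at c i) c ≡ countB (λ j → at c j <ᵇ at c i) (range n)
  viaRange c ℓ i = trans (cong (countB (λ y → y <ᵇ at c i)) (sym (map-at-range n c ℓ))) (countB-map _ (at c) (range n))

-- A permutation is its own standardization, so it is determined by the relative order of its
-- positions, and that order can be read off from the inversions. Most equalities of permutations
-- below are proved in this way.
perm-ext : ∀ {n u v} → IsPerm n u → IsPerm n v → InvSub n u v → InvSub n v u → u ≡ v
perm-ext {n} {u} {v} U V uv vu = trans (sym (st-idem U)) (trans
  (st-cong u v (perm-length U) (perm-length V) λ i j I J → mono U V uv vu i j I J , mono V U vu uv i j I J) (st-idem V))
  where
  mono : ∀ {u v} → IsPerm n u → IsPerm n v → InvSub n u v → InvSub n v u →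
    ∀ i j → Idx n i → Idx n j → at u i < at u j → at v i < at v j
  mono {u} {v} U V uv vu i j I J h with <-cmp i j
  ... | tri< p _ _ = perm-≮⇒> V j i J I (λ e → <⇒≢ p (sym e)) (λ lt → <-asym h (vu i j (proj₁ I) p (proj₂ J) lt))
  ... | tri≈ _ refl _ = ⊥-elim (n≮n _ h)
  ... | tri> _ _ p = uv j i (proj₁ J) p (proj₂ I) h

at-range-< : ∀ n i j → Idx n i → Idx n j → i < j → at (range n) i < at (range n) j
at-range-< n i j I J p = subst₂ _<_ (sym (at-range n i I)) (sym (at-range n j J)) p

len-0⇒range : ∀ {n w} → IsPerm n w → len w ≡ 0 → w ≡ range n
len-0⇒range {n} {w} W e = perm-ext W (range-perm n)
  (λ i j p q r lt → ⊥-elim (b2n-0 (pairSum-0 inv w (trans (sym (len-pairSum w)) e) i j p q (subst (j ≤_) (sym (perm-length W)) r))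
      (<⇒ᵇ lt)))
  (λ i j p q r lt → ⊥-elim (<-asym lt (at-range-< n i j (Idxˡ p q r) (Idxʳ p q r) q)))

-- The factor `w` with v = wu either has positive length, which adds to the length of `u`, or has
-- length 0 and is the identity. Length is thereby the measure for every induction along the weak
-- order.
weakLe⇒≡⊎len< : ∀ {n u v} → IsPerm n u → IsPerm n v → weakLe u v ≡ true → u ≡ v ⊎ len u < len v
weakLe⇒≡⊎len< {n} {u} {v} U V e with proj₁ (anyB-true _ (perms (length u))) e
... | w , w∈ , c with len w in ℓw
... | suc k = inj₂ (subst (len u <_) (sym (proj₁ (≡ᵇ-true (len v) _) (proj₂ (∧-elim {eqW v (comp w u)} c)))) (s≤s (m≤n+m (len u) k)))
... | zero = inj₁ (trans (sym comp-range) (sym (proj₁ (eqW-true v _) (proj₁ (∧-elim c)))))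
  where
  comp-range : comp w u ≡ u
  comp-range rewrite len-0⇒range (subst (λ k → IsPerm k w) (perm-length U) (proj₁ (∈-perms (length u) w) w∈)) ℓw =
    word-ext (trans (comp-length (range n) u) (perm-length U)) (perm-length U)
      λ i I → trans (at-comp (range n) u (perm-length U) i I) (at-range n _ (perm-Idx U i I))

module _ {n : ℕ} where

  weakLe-refl : ∀ {u} → IsPerm n u → weakLe u u ≡ true
  weakLe-refl {u} U = proj₂ (weakLe-true U U) (InvSub-refl u)

  weakLe-trans : ∀ {u v w} → IsPerm n u → IsPerm n v → IsPerm n w →
    weakLe u v ≡ true → weakLe v w ≡ true → weakLe u w ≡ true
  weakLe-trans {u} {v} {w} U V W p q = proj₂ (weakLe-true U W)
    (InvSub-trans {n} {u} {v} {w} (proj₁ (weakLe-true U V) p) (proj₁ (weakLe-true V W) q))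

  weakLe-antisym : ∀ {u v} → IsPerm n u → IsPerm n v → weakLe u v ≡ true → weakLe v u ≡ true → u ≡ v
  weakLe-antisym U V p q = perm-ext U V (proj₁ (weakLe-true U V) p) (proj₁ (weakLe-true V U) q)

-- Möbius inversion over the weak order

muF-stable : ∀ {n u} → IsPerm n u → ∀ k z → IsPerm n z → len z ≤ k → muF k u z ≡ mu u z
muF-stable {n} {u} U k z Z h = go k (len z) z Z h ≤-refl
  where
  below : List ℕ → List ℕ → Bool
  below z y = weakLe u y ∧ weakLe y z ∧ not (eqW y z)
  go : ∀ k l z → IsPerm n z → len z ≤ k → len z ≤ l → muF k u z ≡ muF l u z
  go-sum : ∀ k l z → IsPerm n z → len z ≤ suc k → len z ≤ suc l → ∀ y → y ∈ filterB (below z) (perms (length u)) → muF k u y ≡ muF l u y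
  0<len : ∀ z → IsPerm n z → eqW u z ≡ false → weakLe u z ≡ true → ¬ (len z ≤ 0)
  0<len z Z ne le r with weakLe⇒≡⊎len< U Z le
  ... | inj₁ refl with trans (sym ne) (eqW-refl u)
  ... | ()
  0<len z Z ne le r | inj₂ lt = n≮0 (<-≤-trans lt r)
  go k l z Z p q with eqW u z in eq
  go zero zero z Z p q | true = refl
  go zero (suc l) z Z p q | true = refl
  go (suc k) zero z Z p q | true = refl
  go (suc k) (suc l) z Z p q | true = refl
  go k l z Z p q | false with weakLe u z in le
  go zero zero z Z p q | false | _ = refl
  go zero (suc l) z Z p q | false | false rewrite le = refl
  go (suc k) zero z Z p q | false | false rewrite le = refl
  go (suc k) (suc l) z Z p q | false | false rewrite le = refl
  go zero (suc l) z Z p q | false | true = ⊥-elim (0<len z Z eq le p)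
  go (suc k) zero z Z p q | false | true = ⊥-elim (0<len z Z eq le q)
  go (suc k) (suc l) z Z p q | false | true rewrite le =
    cong -_ (∑-cong (filterB (below z) (perms (length u))) (go-sum k l z Z p q))
  go-sum k l z Z p q y y∈ with proj₁ (∈-filterB (below z) (perms (length u)) y) y∈
  ... | y∈′ , c with proj₁ (∈-perms (length u) y) y∈′ | ∧-elim {weakLe u y} c
  ... | Y′ | u≤y , c′ with weakLe⇒≡⊎len< (subst (λ m → IsPerm m y) (perm-length U) Y′) Z (proj₁ (∧-elim {weakLe y z} c′))
  ... | inj₁ refl = ⊥-elim (not-false (proj₂ (∧-elim {weakLe y z} c′)) (eqW-refl y))
  ... | inj₂ lt = go k l y (subst (λ m → IsPerm m y) (perm-length U) Y′) (≤-pred (≤-trans lt p)) (≤-pred (≤-trans lt q))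

mu-refl : ∀ u → mu u u ≡ 1ℚ
mu-refl u with len u
... | zero rewrite eqW-refl u = refl
... | suc k rewrite eqW-refl u = refl

mu-step : ∀ {n u v} → IsPerm n u → IsPerm n v → weakLe u v ≡ true → u ≢ v →
  mu u v ≡ - ∑ (filterB (λ z → weakLe u z ∧ weakLe z v ∧ not (eqW z v)) (perms n)) (mu u)
mu-step {n} {u} {v} U V le u≢v with weakLe⇒≡⊎len< U V le
... | inj₁ e = ⊥-elim (u≢v e)
... | inj₂ lt with <⇒∃suc lt
  where
  <⇒∃suc : ∀ {a b} → a < b → ∃[ k ] (b ≡ suc k)
  <⇒∃suc (s≤s {n = k} _) = k , refl
... | k , ℓv = trans (cong (λ l → muF l u v) ℓv) (trans unfold (trans
  (cong (λ m → - ∑ (filterB below (perms m)) (muF k u)) (perm-length U))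
  (cong -_ (∑-cong (filterB below (perms n)) stable))))
  where
  below : List ℕ → Bool
  below z = weakLe u z ∧ weakLe z v ∧ not (eqW z v)
  unfold : muF (suc k) u v ≡ - ∑ (filterB below (perms (length u))) (muF k u)
  unfold rewrite eqW-false u≢v | le = refl
  stable : ∀ y → y ∈ filterB below (perms n) → muF k u y ≡ mu u y
  stable y y∈ with proj₁ (∈-filterB below (perms n) y) y∈
  ... | y∈′ , c with weakLe⇒≡⊎len< (proj₁ (∈-perms n y) y∈′) V (proj₁ (∧-elim (proj₂ (∧-elim {weakLe u y} c))))
  ... | inj₁ refl = ⊥-elim (not-false (proj₂ (∧-elim {weakLe y v} (proj₂ (∧-elim {weakLe u y} c)))) (eqW-refl y))
  ... | inj₂ lt′ = muF-stable U k y (proj₁ (∈-perms n y) y∈′) (≤-pred (≤-trans lt′ (≤-reflexive ℓv)))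

-- For u < w the term z = w is, by the recursion, minus the sum of all other terms. For u = w only z
-- = u satisfies both inequalities, and for u not below w no z does, by transitivity.
mu-sum : ∀ {n u w} → IsPerm n u → IsPerm n w →
  ∑ (perms n) (λ z → 𝟙 (weakLe u z) Q.* (𝟙 (weakLe z w) Q.* mu u z)) ≡ 𝟙 (eqW u w)
mu-sum {n} {u} {w} U W with eqW? u w
... | inj₁ refl = trans (∑-support (perms n) u _ (proj₂ (∈-perms n u) U) (Unique-perms n) other)
    (trans (𝟙-true (weakLe-refl U) _) (trans (𝟙-true (weakLe-refl U) _) (trans (mu-refl u) (sym (cong 𝟙 (eqW-refl u))))))
  where
  other : ∀ z → z ∈ perms n → z ≢ u → 𝟙 (weakLe u z) Q.* (𝟙 (weakLe z u) Q.* mu u z) ≡ 0ℚ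
  other z z∈ z≢u = trans
    (𝟙-guard (weakLe u z) {q = 0ℚ} λ p → 𝟙-false (λ q → z≢u (weakLe-antisym (proj₁ (∈-perms n z) z∈) U q p)) (mu u z))
    (Qₚ.*-zeroʳ (𝟙 (weakLe u z)))
... | inj₂ u≢w with bool? (weakLe u w)
... | inj₂ u≰w = trans (∑-0 (perms n) other) (sym (cong 𝟙 (eqW-false u≢w)))
  where
  other : ∀ z → z ∈ perms n → 𝟙 (weakLe u z) Q.* (𝟙 (weakLe z w) Q.* mu u z) ≡ 0ℚ
  other z z∈ = trans
    (𝟙-guard (weakLe u z) {q = 0ℚ} λ p → 𝟙-false (λ q → u≰w (weakLe-trans U (proj₁ (∈-perms n z) z∈) W p q)) (mu u z))
    (Qₚ.*-zeroʳ (𝟙 (weakLe u z)))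
... | inj₁ u≤w = begin
  ∑ (perms n) (λ z → 𝟙 (weakLe u z) Q.* (𝟙 (weakLe z w) Q.* mu u z))
    ≡⟨ ∑-cong′ (perms n) split ⟩
  ∑ (perms n) (λ z → 𝟙 (eqW w z) Q.* f z Q.+ 𝟙 (below z) Q.* mu u z)
    ≡⟨ ∑-+ (perms n) _ _ ⟩
  ∑ (perms n) (λ z → 𝟙 (eqW w z) Q.* f z) Q.+ ∑ (perms n) (λ z → 𝟙 (below z) Q.* mu u z)
    ≡⟨ cong₂ Q._+_ (∑-perms-δ n w f W) (sym (∑-filterB below (perms n) (mu u))) ⟩
  f w Q.+ s ≡⟨ cong (Q._+ s) (trans (𝟙-true u≤w _) (trans (𝟙-true (weakLe-refl W) _) (mu-step U W u≤w u≢w))) ⟩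
  - s Q.+ s ≡⟨ Qₚ.+-inverseˡ s ⟩
  0ℚ ≡⟨ sym (cong 𝟙 (eqW-false u≢w)) ⟩
  𝟙 (eqW u w) ∎
  where
  open ≡-Reasoning
  below : List ℕ → Bool
  below z = weakLe u z ∧ weakLe z w ∧ not (eqW z w)
  f : List ℕ → ℚ
  f z = 𝟙 (weakLe u z) Q.* (𝟙 (weakLe z w) Q.* mu u z)
  s = ∑ (filterB below (perms n)) (mu u)
  split : ∀ z → f z ≡ 𝟙 (eqW w z) Q.* f z Q.+ 𝟙 (below z) Q.* mu u z
  split z = trans (𝟙-split (eqW z w) (f z)) (cong₂ Q._+_ (cong (λ b → 𝟙 b Q.* f z) (eqW-sym z w))
    (trans (solve 4 (λ e a b p → e :* (a :* (b :* p)) := a :* (b :* e) :* p) refl (𝟙 (not (eqW z w))) (𝟙 (weakLe u z))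
        (𝟙 (weakLe z w)) (mu u z))
      (cong (Q._* mu u z) (sym (trans (𝟙-∧ (weakLe u z) _) (cong (𝟙 (weakLe u z) Q.*_) (𝟙-∧ (weakLe z w) _)))))))
    where open +-*-Solver

-- The coefficient of M w in x is the sum of the F-coefficients of x below w, because F u is the sum of the M w with u ≤ w.
Mcoeff : ℕ → List ℕ → (List ℕ → ℚ) → ℚ
Mcoeff n w c = ∑ (perms n) (λ u → 𝟙 (weakLe u w) Q.* c u)

-- The system is unitriangular: the sum at `w` is `c w` plus values at strictly smaller
-- permutations, which agree by induction on length.
Mcoeff-injective : ∀ n (c d : List ℕ → ℚ) → (∀ w → IsPerm n w → Mcoeff n w c ≡ Mcoeff n w d) →
  ∀ w → IsPerm n w → c w ≡ d w
Mcoeff-injective n c d h w W = go (len w) w W ≤-refl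
  where
  go : ∀ k w → IsPerm n w → len w ≤ k → c w ≡ d w
  strictly : List ℕ → (List ℕ → ℚ) → List ℕ → ℚ
  strictly w e u = 𝟙 (not (eqW w u)) Q.* (𝟙 (weakLe u w) Q.* e u)
  rest : ∀ w → IsPerm n w → (e : List ℕ → ℚ) → Mcoeff n w e ≡ e w Q.+ ∑ (perms n) (strictly w e)
  rest w W e = begin
    Mcoeff n w e ≡⟨ ∑-cong′ (perms n) (λ u → 𝟙-split (eqW w u) (𝟙 (weakLe u w) Q.* e u)) ⟩
    ∑ (perms n) (λ u → 𝟙 (eqW w u) Q.* (𝟙 (weakLe u w) Q.* e u) Q.+ strictly w e u)
      ≡⟨ ∑-+ (perms n) _ _ ⟩
    ∑ (perms n) (λ u → 𝟙 (eqW w u) Q.* (𝟙 (weakLe u w) Q.* e u)) Q.+ ∑ (perms n) (strictly w e)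
      ≡⟨ cong (Q._+ ∑ (perms n) (strictly w e)) (trans (∑-perms-δ n w (λ u → 𝟙 (weakLe u w) Q.* e u) W) (𝟙-true (weakLe-refl W) (e w))) ⟩
    e w Q.+ ∑ (perms n) (strictly w e) ∎
    where
    open ≡-Reasoning
  go k w W ℓ = +-cancelʳ′ (∑ (perms n) (strictly w c)) (c w) (d w)
    (trans (sym (rest w W c)) (trans (h w W) (trans (rest w W d) (cong (d w Q.+_) (sym (∑-cong (perms n) (lower k ℓ)))))))
    where
    +-cancelʳ′ : ∀ r p q → p Q.+ r ≡ q Q.+ r → p ≡ q
    +-cancelʳ′ r p q e = trans (lem p r) (trans (cong (Q._+ - r) e) (sym (lem q r)))
      where
      open +-*-Solver
      lem : ∀ p r → p ≡ p Q.+ r Q.+ - r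
      lem = solve 2 (λ p r → p := p :+ r :+ :- r) refl
    lower : ∀ k → len w ≤ k → ∀ u → u ∈ perms n → strictly w c u ≡ strictly w d u
    lower k ℓ u u∈ = 𝟙-guard (not (eqW w u)) λ q → 𝟙-guard (weakLe u w) λ p → below k ℓ (p , q)
      where
      U = proj₁ (∈-perms n u) u∈
      below : ∀ k → len w ≤ k → weakLe u w ≡ true × not (eqW w u) ≡ true → c u ≡ d u
      below k ℓ (p , q) with weakLe⇒≡⊎len< U W p
      ... | inj₁ refl = ⊥-elim (not-false q (eqW-refl u))
      below zero ℓ (p , q) | inj₂ lt = ⊥-elim (n≮0 (<-≤-trans lt ℓ))
      below (suc k) ℓ (p , q) | inj₂ lt = go k u U (≤-pred (≤-trans lt ℓ))

-- Descents and blocks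

-- The index `i` counts from 0, so the descent is at position `suc i` of `u`. The recorded label is
-- `i + k`, where `k` is the label that `desAux` gives to the first position.
DescentAt : ℕ → List ℕ → ℕ → ℕ → Set
DescentAt k u a i = suc i < length u × at u (suc (suc i)) < at u (suc i) × a ≡ i + k

∈-desAux : ∀ k u a → a ∈ desAux k u ↔ ∃[ i ] DescentAt k u a i
∈-desAux k [] a = (λ ()) , (λ { (_ , () , _) })
∈-desAux k (x ∷ []) a = (λ ()) , (λ { (_ , s≤s () , _) })
∈-desAux k (x ∷ y ∷ u) a = go (∈-desAux (suc k) (y ∷ u) a)
  where
  later : ∃[ i ] DescentAt (suc k) (y ∷ u) a i → ∃[ i ] DescentAt k (x ∷ y ∷ u) a i
  later (i , q , lt , e) = suc i , s≤s q , lt , trans e (+-suc i k)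
  go : a ∈ desAux (suc k) (y ∷ u) ↔ ∃[ i ] DescentAt (suc k) (y ∷ u) a i →
    a ∈ desAux k (x ∷ y ∷ u) ↔ ∃[ i ] DescentAt k (x ∷ y ∷ u) a i
  go ih with bool? (y <ᵇ x)
  ... | inj₁ d rewrite d = (λ { (here e) → 0 , s≤s (s≤s z≤n) , proj₁ (<ᵇ-true y x) d , e ; (there p) → later (proj₁ ih p) }) ,
      λ { (zero , _ , _ , e) → here e ; (suc i , s≤s q , lt , e) → there (proj₂ ih (i , q , lt , trans e (sym (+-suc i k)))) }
  ... | inj₂ d rewrite ≢true⇒≡false d = later ∘ proj₁ ih ,
      λ { (zero , _ , lt , _) → ⊥-elim (d (<⇒ᵇ lt)) ; (suc i , s≤s q , lt , e) → proj₂ ih (i , q , lt , trans e (sym (+-suc i k))) }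

DesSub : ℕ → List ℕ → List ℕ → Set
DesSub n ζ S = ∀ i → 1 ≤ i → i < n → at ζ (suc i) < at ζ i → i ∈ S

subB-Des : ∀ {n} ζ → length ζ ≡ n → ∀ S → subB (Des ζ) S ≡ true ↔ DesSub n ζ S
subB-Des ζ refl S = to , from
  where
  to : subB (Des ζ) S ≡ true → DesSub (length ζ) ζ S
  to e (suc i) p q lt = proj₁ (subB-true (Des ζ) S) e (suc i) (proj₂ (∈-desAux 1 ζ (suc i)) (i , q , lt , +-comm 1 i))
  from : DesSub (length ζ) ζ S → subB (Des ζ) S ≡ true
  from h = proj₂ (subB-true (Des ζ) S) λ a a∈ → sub a (proj₁ (∈-desAux 1 ζ a) a∈)
    where
    sub : ∀ a → ∃[ i ] DescentAt 1 ζ a i → a ∈ S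
    sub a (i , q , lt , refl) = subst (_∈ S) (+-comm 1 i) (h (suc i) (s≤s z≤n) q lt)

increasing : ∀ {n ζ} → IsPerm n ζ → ∀ S → DesSub n ζ S → ∀ i j → 1 ≤ i → i < j → j ≤ n →
  (∀ s → i ≤ s → s < j → s ∉ S) → at ζ i < at ζ j
increasing {n} {ζ} P S D i (suc j) 1≤i i<j j≤n out = [ (λ i<j → <-trans (increasing P S D i j 1≤i i<j (≤-trans (n≤1+n j) j≤n)
    (λ s p q → out s p (<-trans q ≤-refl))) step) , (λ { refl → step }) ]′ (m≤n⇒m<n∨m≡n (≤-pred i<j))
  where
  step : at ζ j < at ζ (suc j)
  step = perm-≮⇒> P (suc j) j (s≤s z≤n , j≤n) (≤-trans 1≤i (≤-pred i<j) , ≤-trans (n≤1+n j) j≤n) 1+n≢n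
    (λ lt → out j (≤-pred i<j) ≤-refl (D j (≤-trans 1≤i (≤-pred i<j)) j≤n lt))

-- A cut s falls between the positions s and s + 1, hence i ≤ s < j.
Sep : List ℕ → ℕ → ℕ → Set
Sep S i j = ∃[ s ] (s ∈ S × i ≤ s × s < j)

sep? : ∀ S i j → Sep S i j ⊎ ¬ Sep S i j
sep? S i j with bool? (anyB (λ s → not (s <ᵇ i) ∧ (s <ᵇ j)) S)
... | inj₁ e = let s , s∈ , c = proj₁ (anyB-true _ S) e in
  inj₁ (s , s∈ , ≮⇒≥ (not-false (proj₁ (∧-elim c)) ∘ proj₂ (<ᵇ-true s i)) , proj₁ (<ᵇ-true s j) (proj₂ (∧-elim {not (s <ᵇ i)} c)))
... | inj₂ h = inj₂ λ (s , s∈ , p , q) → h (proj₂ (anyB-true _ S)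
  (s , s∈ , ∧-intro (not-true (λ e → <⇒≱ (proj₁ (<ᵇ-true s i) e) p)) (proj₂ (<ᵇ-true s j) q)))

-- The number of elements of S below a position: the index of its block.
blk : List ℕ → ℕ → ℕ
blk S zero = 0
blk S (suc i) = if memB i S then suc (blk S i) else blk S i

blk-suc-∈ : ∀ S i → i ∈ S → blk S (suc i) ≡ suc (blk S i)
blk-suc-∈ S i i∈ rewrite proj₂ (memB-true i S) i∈ = refl

blk-suc-∉ : ∀ S i → i ∉ S → blk S (suc i) ≡ blk S i
blk-suc-∉ S i i∉ rewrite ≢true⇒≡false {memB i S} (i∉ ∘ proj₁ (memB-true i S)) = refl

blk-suc-≤ : ∀ S i → blk S i ≤ blk S (suc i)
blk-suc-≤ S i with memB i S
... | true = n≤1+n _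
... | false = ≤-refl

blk-mono : ∀ S i j → i ≤ j → blk S i ≤ blk S j
blk-mono S i zero z≤n = ≤-refl
blk-mono S i (suc j) p with m≤n⇒m<n∨m≡n p
... | inj₁ (s≤s q) = ≤-trans (blk-mono S i j q) (blk-suc-≤ S j)
... | inj₂ refl = ≤-refl

blk-sep : ∀ S i j → Sep S i j → blk S i < blk S j
blk-sep S i j (s , s∈ , p , q) =
  ≤-trans (s≤s (blk-mono S i s p)) (≤-trans (≤-reflexive (sym (blk-suc-∈ S s s∈))) (blk-mono S (suc s) j q))

blk-unsep : ∀ S i j → i ≤ j → ¬ Sep S i j → blk S i ≡ blk S j
blk-unsep S i zero z≤n _ = refl
blk-unsep S i (suc j) p h with m≤n⇒m<n∨m≡n p
... | inj₂ refl = refl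
... | inj₁ (s≤s q) = trans (blk-unsep S i j q (λ (s , s∈ , a , b) → h (s , s∈ , a , <-trans b ≤-refl)))
  (sym (blk-suc-∉ S j (λ j∈ → h (j , j∈ , q , ≤-refl))))

-- Ordering positions by a key, with ties broken by a permutation

lex : ∀ {B a b} p q → a < B → b < B → a + p * B < b + q * B ↔ (p < q ⊎ (p ≡ q × a < b))
lex {B} {a} {b} p q a<B b<B = to , from
  where
  below : ∀ {a b p q} → a < B → p < q → a + p * B < b + q * B
  below {a} {b} {p} {q} a<B p<q = ≤-trans (+-monoˡ-< (p * B) a<B) (≤-trans (*-monoˡ-≤ B p<q) (m≤n+m (q * B) b))
  to : a + p * B < b + q * B → p < q ⊎ (p ≡ q × a < b)
  to h with <-cmp p q
  ... | tri< r _ _ = inj₁ r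
  ... | tri≈ _ refl _ = inj₂ (refl , +-cancelʳ-< (p * B) a b h)
  ... | tri> _ _ r = ⊥-elim (<-asym h (below b<B r))
  from : p < q ⊎ (p ≡ q × a < b) → a + p * B < b + q * B
  from (inj₁ r) = below a<B r
  from (inj₂ (refl , r)) = +-monoˡ-< (p * B) r

-- The pair (f i, x_i) written as a two-digit number in base `suc n`, which exceeds every letter of
-- `x`. Both v_S and m_S are standardizations of such words: the key is the block number for v_S and
-- its reversal for m_S.
keyed : (ℕ → ℕ) → ℕ → List ℕ → List ℕ
keyed f n x = map (λ i → at x i + f i * suc n) (range n)

module _ {n : ℕ} {x : List ℕ} (X : IsPerm n x) (f : ℕ → ℕ) where

  keyed-length : length (keyed f n x) ≡ n
  keyed-length = map-range-length _ n

  keyed-pos : ∀ {i} → Idx n i → Idx (length (keyed f n x)) i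
  keyed-pos {i} = subst (λ k → Idx k i) (sym keyed-length)

  at-keyed : ∀ i → Idx n i → at (keyed f n x) i ≡ at x i + f i * suc n
  at-keyed i I = at-map-range _ n i I

  keyed-< : ∀ i j → Idx n i → Idx n j → at (keyed f n x) i < at (keyed f n x) j ↔ (f i < f j ⊎ (f i ≡ f j × at x i < at x j))
  keyed-< i j I J = (λ h → proj₁ L (subst₂ _<_ (at-keyed i I) (at-keyed j J) h)) , (λ h → subst₂ _<_ (sym (at-keyed i I))
      (sym (at-keyed j J)) (proj₂ L h))
    where
    L = lex (f i) (f j) (s≤s (proj₂ (perm-Idx X i I))) (s≤s (proj₂ (perm-Idx X j J)))

  keyed-Unique : Unique (keyed f n x)
  keyed-Unique = at-injective⇒Unique _ λ i j I′ J′ e → inj i j (subst (λ k → Idx k i) keyed-length I′)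
      (subst (λ k → Idx k j) keyed-length J′) e
    where
    inj : ∀ i j → Idx n i → Idx n j → at (keyed f n x) i ≡ at (keyed f n x) j → i ≡ j
    inj i j I J e with <-cmp (f i) (f j)
    ... | tri< p _ _ = ⊥-elim (<⇒≢ (proj₂ (keyed-< i j I J) (inj₁ p)) e)
    ... | tri> _ _ p = ⊥-elim (<⇒≢ (proj₂ (keyed-< j i J I) (inj₁ p)) (sym e))
    ... | tri≈ _ q _ with <-cmp (at x i) (at x j)
    ... | tri< p _ _ = ⊥-elim (<⇒≢ (proj₂ (keyed-< i j I J) (inj₂ (q , p))) e)
    ... | tri> _ _ p = ⊥-elim (<⇒≢ (proj₂ (keyed-< j i J I) (inj₂ (sym q , p))) (sym e))
    ... | tri≈ _ r _ = perm-inj X i j I J r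

  st-keyed-perm : IsPerm n (st (keyed f n x))
  st-keyed-perm = st-perm (keyed f n x) keyed-length keyed-Unique

  st-keyed-< : ∀ i j → Idx n i → Idx n j → at (st (keyed f n x)) i < at (st (keyed f n x)) j ↔ (f i < f j ⊎ (f i ≡ f j × at x i < at x j))
  st-keyed-< i j I J = (proj₁ (keyed-< i j I J) ∘ proj₁ O) , (proj₂ O ∘ proj₂ (keyed-< i j I J))
    where
    O = st-order (keyed f n x) i j (keyed-pos I) (keyed-pos J)

-- The word restrictS S v

map-∈-cong : {A B : Set} {f g : A → B} (xs : List A) → (∀ x → x ∈ xs → f x ≡ g x) → map f xs ≡ map g xs
map-∈-cong [] h = refl
map-∈-cong (x ∷ xs) h = cong₂ _∷_ (h x (here refl)) (map-∈-cong xs (λ y y∈ → h y (there y∈)))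

-- Appending larger letters leaves the ranks in `as` unchanged, and each rank in `cs` grows by the
-- length of `as`.
st-++ : ∀ as cs → (∀ a c → a ∈ as → c ∈ cs → a < c) → st (as ++ cs) ≡ cross (st as) (st cs)
st-++ as cs h = trans (map-++ g as cs) (cong₂ _++_ (map-∈-cong as left) (trans (map-∈-cong cs right) (map-∘ cs)))
  where
  g : ℕ → ℕ
  g x = suc (countB (λ y → y <ᵇ x) (as ++ cs))
  left : ∀ x → x ∈ as → g x ≡ suc (countB (λ y → y <ᵇ x) as)
  left x x∈ = cong suc (trans (countB-++ _ as cs) (trans
    (cong (countB (λ y → y <ᵇ x) as +_) (countB-none _ cs (λ c c∈ → ≮⇒ᵇ (<⇒≯ (h x c x∈ c∈))))) (+-identityʳ _)))
  right : ∀ x → x ∈ cs → g x ≡ suc (countB (λ y → y <ᵇ x) cs) + length (st as)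
  right x x∈ = cong suc (trans (countB-++ _ as cs) (trans
    (cong (_+ countB (λ y → y <ᵇ x) cs) (trans (countB-all _ as (λ a a∈ → <⇒ᵇ (h a x a∈ x∈))) (sym (st-length as))))
    (+-comm (length (st as)) _)))

st-shift : ∀ c as → st (map (_+ c) as) ≡ st as
st-shift c as = trans (sym (map-∘ as)) (map-∈-cong as λ x _ → cong suc (trans (countB-map _ (_+ c) as)
  (countB-cong as λ y _ → bool-ext ((<⇒ᵇ ∘ +-cancelʳ-< c y x ∘ proj₁ (<ᵇ-true _ _)) , (<⇒ᵇ ∘ +-monoˡ-< c ∘ proj₁ (<ᵇ-true y x))))))

keyBlocks : ℕ → ℕ → List (List ℕ) → List ℕ
keyBlocks B k [] = []
keyBlocks B k (b ∷ bs) = map (_+ k * B) b ++ keyBlocks B (suc k) bs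

keyBlocks-≥ : ∀ B k bs x → x ∈ keyBlocks B k bs → k * B ≤ x
keyBlocks-≥ B k (b ∷ bs) x p with ∈-++⁻ (map (_+ k * B) b) p
... | inj₁ q with ∈-map⁻ (_+ k * B) q
... | y , _ , refl = m≤n+m (k * B) y
keyBlocks-≥ B k (b ∷ bs) x p | inj₂ q = ≤-trans (m≤n+m (k * B) B) (keyBlocks-≥ B (suc k) bs x q)

-- Raising the k-th block by `k * B`, with `B` above all letters, puts each block entirely below the
-- next without disturbing the order inside it. One standardization then does the work of all the
-- crossings.
foldr-cross-st : ∀ B k bs → All (All (_< B)) bs → foldr cross [] (map st bs) ≡ st (keyBlocks B k bs)
foldr-cross-st B k [] _ = refl
foldr-cross-st B k (b ∷ bs) (hb ∷ hbs) = begin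
  cross (st b) (foldr cross [] (map st bs)) ≡⟨ cong₂ cross (sym (st-shift (k * B) b)) (foldr-cross-st B (suc k) bs hbs) ⟩
  cross (st (map (_+ k * B) b)) (st (keyBlocks B (suc k) bs)) ≡⟨ sym (st-++ _ _ sep) ⟩
  st (map (_+ k * B) b ++ keyBlocks B (suc k) bs) ∎
  where
  open ≡-Reasoning
  sep : ∀ a c → a ∈ map (_+ k * B) b → c ∈ keyBlocks B (suc k) bs → a < c
  sep a c a∈ c∈ with ∈-map⁻ (_+ k * B) a∈
  ... | y , y∈ , refl = ≤-trans (+-monoˡ-< (k * B) (All-lookup hb y∈)) (keyBlocks-≥ B (suc k) bs c c∈)

keyWord : ℕ → ℕ → List ℕ → List ℕ → List ℕ
keyWord B i S [] = []
keyWord B i S (x ∷ v) = x + blk S i * B ∷ keyWord B (suc i) S v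

keyBlocks-segs : ∀ B i S v → keyBlocks B (blk S i) (segs i S v) ≡ keyWord B i S v
keyBlocks-segs B i S [] = refl
keyBlocks-segs B i S (x ∷ v) with memB i S | segs (suc i) S v | keyBlocks-segs B (suc i) S v
... | true | rest | ih = cong (x + blk S i * B ∷_) ih
... | false | [] | ih = cong (x + blk S i * B ∷_) ih
... | false | b ∷ bs | ih = cong (x + blk S i * B ∷_) ih

All-segs : ∀ {P : ℕ → Set} i S v → All P v → All (All P) (segs i S v)
All-segs i S [] _ = [] ∷ []
All-segs i S (x ∷ v) (p ∷ ps) with segs (suc i) S v | All-segs (suc i) S v ps | memB i S
... | rest | ih | true = (p ∷ []) ∷ ih
... | [] | ih | false = (p ∷ []) ∷ []
... | b ∷ bs | q ∷ qs | false = (p ∷ q) ∷ qs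

keyWord-length : ∀ B i S v → length (keyWord B i S v) ≡ length v
keyWord-length B i S [] = refl
keyWord-length B i S (x ∷ v) = cong suc (keyWord-length B (suc i) S v)

at-keyWord : ∀ B i S v j → j < length v → at (keyWord B i S v) (suc j) ≡ at v (suc j) + blk S (i + j) * B
at-keyWord B i S (x ∷ v) zero _ = cong (λ k → x + blk S k * B) (sym (+-identityʳ i))
at-keyWord B i S (x ∷ v) (suc j) (s≤s q) = trans (at-keyWord B (suc i) S v j q) (cong (λ k → at v (suc j) + blk S k * B)
    (sym (+-suc i j)))

-- In v_S the letters of later blocks exceed those of earlier ones, so positions are compared by
-- block number first and by `v` second. From this form the inversions of v_S are read off.
restrictS-keyed : ∀ {n v} → IsPerm n v → ∀ S → restrictS S v ≡ st (keyed (blk S) n v)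
restrictS-keyed {n} {v} V S = begin
  foldr cross [] (map st (segs 1 S v)) ≡⟨ foldr-cross-st (suc n) (blk S 1) (segs 1 S v)
      (All-segs 1 S v (All-tabulate λ x∈ → s≤s (proj₂ (proj₁ (perm-∈ V _) x∈)))) ⟩
  st (keyBlocks (suc n) (blk S 1) (segs 1 S v)) ≡⟨ cong st (keyBlocks-segs (suc n) 1 S v) ⟩
  st (keyWord (suc n) 1 S v) ≡⟨ cong st (word-ext (trans (keyWord-length (suc n) 1 S v) (perm-length V)) (keyed-length V (blk S)) same) ⟩
  st (keyed (blk S) n v) ∎
  where
  open ≡-Reasoning
  same : ∀ i → Idx n i → at (keyWord (suc n) 1 S v) i ≡ at (keyed (blk S) n v) i
  same (suc j) I = trans (at-keyWord (suc n) 1 S v j (proj₂ (perm-pos V I))) (sym (at-keyed V (blk S) (suc j) I))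

module _ {n : ℕ} {v : List ℕ} (V : IsPerm n v) (S : List ℕ) where

  restrictS-perm : IsPerm n (restrictS S v)
  restrictS-perm = subst (IsPerm n) (sym (restrictS-keyed V S)) (st-keyed-perm V (blk S))

  restrictS-inv : ∀ i j → 1 ≤ i → i < j → j ≤ n →
    at (restrictS S v) j < at (restrictS S v) i ↔ (¬ Sep S i j × at v j < at v i)
  restrictS-inv i j p q r rewrite restrictS-keyed V S = to , from
    where
    L = st-keyed-< V (blk S) j i (Idxʳ p q r) (Idxˡ p q r)
    to : at (st (keyed (blk S) n v)) j < at (st (keyed (blk S) n v)) i → ¬ Sep S i j × at v j < at v i
    to h with proj₁ L h
    ... | inj₁ lt = ⊥-elim (<⇒≱ lt (blk-mono S i j (<⇒≤ q)))
    ... | inj₂ (e , lt) = (λ s → <⇒≢ (blk-sep S i j s) (sym e)) , lt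
    from : ¬ Sep S i j × at v j < at v i → at (st (keyed (blk S) n v)) j < at (st (keyed (blk S) n v)) i
    from (h , lt) = proj₂ L (inj₂ (sym (blk-unsep S i j (<⇒≤ q) h) , lt))

-- The largest v with restrictS S v ≤ x: the blocks of x in decreasing order.
top : ℕ → List ℕ → List ℕ → List ℕ
top n S x = st (keyed (λ i → blk S n ∸ blk S i) n x)

module _ {n : ℕ} {x : List ℕ} (X : IsPerm n x) (S : List ℕ) where

  top-perm : IsPerm n (top n S x)
  top-perm = st-keyed-perm X (λ i → blk S n ∸ blk S i)

  top-inv : ∀ i j → 1 ≤ i → i < j → j ≤ n → at (top n S x) j < at (top n S x) i ↔ (Sep S i j ⊎ at x j < at x i)
  top-inv i j p q r = to , from
    where
    L = st-keyed-< X (λ i → blk S n ∸ blk S i) j i (Idxʳ p q r) (Idxˡ p q r)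
    to : at (top n S x) j < at (top n S x) i → Sep S i j ⊎ at x j < at x i
    to h with proj₁ L h
    ... | inj₂ (_ , lt) = inj₂ lt
    ... | inj₁ lt with sep? S i j
    ... | inj₁ s = inj₁ s
    ... | inj₂ ns = ⊥-elim (<⇒≢ lt (cong (blk S n ∸_) (sym (blk-unsep S i j (<⇒≤ q) ns))))
    from : Sep S i j ⊎ at x j < at x i → at (top n S x) j < at (top n S x) i
    from (inj₁ s) = proj₂ L (inj₁ (∸-monoʳ-< (blk-sep S i j s) (blk-mono S j n r)))
    from (inj₂ lt) with sep? S i j
    ... | inj₁ s = from (inj₁ s)
    ... | inj₂ ns = proj₂ L (inj₂ (cong (blk S n ∸_) (sym (blk-unsep S i j (<⇒≤ q) ns)) , lt))

-- Multiplying a block product by one more block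

split-pos : ∀ p i → i ≤ p ⊎ ∃[ j ] (i ≡ p + suc j)
split-pos p i with i ≤? p
... | yes h = inj₁ h
... | no h = inj₂ (i ∸ suc p , sym (trans (+-suc p (i ∸ suc p)) (m+[n∸m]≡n (≰⇒> h))))

+-Idx : ∀ {p q} j → suc j ≤ q → Idx (p + q) (p + suc j)
+-Idx {p} {q} j h = ≤-trans (s≤s z≤n) (m≤n+m (suc j) p) , +-monoʳ-≤ p h

Idx-+ : ∀ {p q j} → p + suc j ≤ p + q → Idx q (suc j)
Idx-+ {p} h = s≤s z≤n , +-cancelˡ-≤ p _ _ h

widen : ∀ {p} q {i} → Idx p i → Idx (p + q) i
widen {p} q (a , b) = a , ≤-trans b (m≤m+n p q)

module _ {p : ℕ} (u : List ℕ) (ℓ : length u ≡ p) (w : List ℕ) where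

  cross-length : ∀ {q} → length w ≡ q → length (cross u w) ≡ p + q
  cross-length e = trans (length-++ u) (cong₂ _+_ ℓ (trans (length-map _ w) e))

  at-crossˡ : ∀ i → Idx p i → at (cross u w) i ≡ at u i
  at-crossˡ i I = at-++ˡ u _ i (subst (λ k → Idx k i) (sym ℓ) I)

  at-crossʳ : ∀ j → j < length w → at (cross u w) (p + suc j) ≡ at w (suc j) + p
  at-crossʳ j h = begin
    at (cross u w) (p + suc j) ≡⟨ cong (λ k → at (cross u w) (k + suc j)) (sym ℓ) ⟩
    at (cross u w) (length u + suc j) ≡⟨ at-++ʳ u _ j ⟩
    at (map (λ x → x + length u) w) (suc j) ≡⟨ at-map _ w (suc j) (s≤s z≤n , h) ⟩
    at w (suc j) + length u ≡⟨ cong (at w (suc j) +_) ℓ ⟩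
    at w (suc j) + p ∎
    where open ≡-Reasoning

cross-perm : ∀ {p q u w} → IsPerm p u → IsPerm q w → IsPerm (p + q) (cross u w)
cross-perm {p} {q} {u} {w} U W = mkPerm (cross-length u ℓu w ℓw) idx inj
  where
  ℓu = perm-length U
  ℓw = perm-length W
  low : ∀ i → Idx p i → at (cross u w) i ≡ at u i
  low = at-crossˡ u ℓu w
  high : ∀ j → j < q → at (cross u w) (p + suc j) ≡ at w (suc j) + p
  high j h = at-crossʳ u ℓu w j (subst (j <_) (sym ℓw) h)
  idx : ∀ i → Idx (p + q) i → Idx (p + q) (at (cross u w) i)
  idx i (a , b) with split-pos p i
  ... | inj₁ h = subst (Idx (p + q)) (sym (low i (a , h))) (widen q (perm-Idx U i (a , h)))
  ... | inj₂ (j , refl) = subst (Idx (p + q)) (sym (trans (high j (proj₂ J)) (+-comm _ p)))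
      (≤-trans (proj₁ W′) (m≤n+m _ p) , +-monoʳ-≤ p (proj₂ W′))
    where
    J = Idx-+ {p} b
    W′ = perm-Idx W (suc j) J
  low<high : ∀ i j → Idx p i → j < q → at (cross u w) i < at (cross u w) (p + suc j)
  low<high i j I h = subst₂ _<_ (sym (low i I)) (sym (high j h))
    (≤-<-trans (proj₂ (perm-Idx U i I)) (m<n+m p (proj₁ (perm-Idx W (suc j) (s≤s z≤n , h)))))
  inj : ∀ i j → Idx (p + q) i → Idx (p + q) j → at (cross u w) i ≡ at (cross u w) j → i ≡ j
  inj i j (a , b) (c , d) e with split-pos p i | split-pos p j
  ... | inj₁ h | inj₁ k = perm-inj U i j (a , h) (c , k) (trans (sym (low i (a , h))) (trans e (low j (c , k))))
  ... | inj₁ h | inj₂ (j′ , refl) = ⊥-elim (<⇒≢ (low<high i j′ (a , h) (proj₂ (Idx-+ {p} d))) e)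
  ... | inj₂ (i′ , refl) | inj₁ k = ⊥-elim (<⇒≢ (low<high j i′ (c , k) (proj₂ (Idx-+ {p} b))) (sym e))
  ... | inj₂ (i′ , refl) | inj₂ (j′ , refl) = cong (p +_) (perm-inj W _ _ (Idx-+ {p} b) (Idx-+ {p} d)
    (+-cancelʳ-≡ p _ _ (trans (sym (high i′ (proj₂ (Idx-+ {p} b)))) (trans e (high j′ (proj₂ (Idx-+ {p} d)))))))

comp-assoc : ∀ {n a b c} → length b ≡ n → length c ≡ n → (∀ i → Idx n i → Idx n (at c i)) → comp a (comp b c) ≡ comp (comp a b) c
comp-assoc {n} {a} {b} {c} ℓb ℓc h = word-ext (trans (comp-length a (comp b c)) (trans (comp-length b c) ℓc))
    (trans (comp-length (comp a b) c) ℓc)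
  λ i I → begin
    at (comp a (comp b c)) i ≡⟨ at-comp a (comp b c) (trans (comp-length b c) ℓc) i I ⟩
    at a (at (comp b c) i) ≡⟨ cong (at a) (at-comp b c ℓc i I) ⟩
    at a (at b (at c i)) ≡⟨ sym (at-comp a b ℓb (at c i) (h i I)) ⟩
    at (comp a b) (at c i) ≡⟨ sym (at-comp (comp a b) c ℓc i I) ⟩
    at (comp (comp a b) c) i ∎
  where open ≡-Reasoning

Sep-∷ʳ : ∀ R p i j → Sep (R ++ p ∷ []) i j ↔ (Sep R i j ⊎ (i ≤ p × p < j))
Sep-∷ʳ R p i j = to , from
  where
  to : Sep (R ++ p ∷ []) i j → Sep R i j ⊎ (i ≤ p × p < j)
  to (s , s∈ , a , b) with ∈-++⁻ R s∈
  ... | inj₁ h = inj₁ (s , h , a , b)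
  ... | inj₂ (here refl) = inj₂ (a , b)
  from : Sep R i j ⊎ (i ≤ p × p < j) → Sep (R ++ p ∷ []) i j
  from (inj₁ (s , s∈ , a , b)) = s , ∈-++⁺ˡ s∈ , a , b
  from (inj₂ (a , b)) = p , ∈-++⁺ʳ R (here refl) , a , b

module _ {p q : ℕ} {v : List ℕ} (V : IsPerm (p + q) v) where

  take-length : length (take p v) ≡ p
  take-length = trans (length-take p v) (m≤n⇒m⊓n≡m (≤-trans (m≤m+n p q) (≤-reflexive (sym (perm-length V)))))

  drop-length : length (drop p v) ≡ q
  drop-length = trans (length-drop p v) (trans (cong (_∸ p) (perm-length V)) (m+n∸m≡n p q))

  st-take-perm : IsPerm p (st (take p v))
  st-take-perm = st-perm _ take-length (at-injective⇒Unique _ λ i j I J e →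
    perm-inj V i j (widen q (lenIdx I)) (widen q (lenIdx J))
      (trans (sym (at-take p v i (proj₂ (lenIdx I)))) (trans e (at-take p v j (proj₂ (lenIdx J))))))
    where
    lenIdx : ∀ {i} → Idx (length (take p v)) i → Idx p i
    lenIdx {i} = subst (λ k → Idx k i) take-length

  st-drop-perm : IsPerm q (st (drop p v))
  st-drop-perm = st-perm _ drop-length (at-injective⇒Unique _ inj)
    where
    inj : ∀ i j → Idx (length (drop p v)) i → Idx (length (drop p v)) j → at (drop p v) i ≡ at (drop p v) j → i ≡ j
    inj zero _ (() , _)
    inj (suc _) zero _ (() , _)
    inj (suc i) (suc j) (_ , a) (_ , b) e = +-cancelˡ-≡ p _ _ (perm-inj V _ _
      (+-Idx {p} i (subst (suc i ≤_) drop-length a)) (+-Idx {p} j (subst (suc j ≤_) drop-length b))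
      (trans (sym (at-drop p v i)) (trans e (at-drop p v j))))

  st-take-< : ∀ i j → Idx p i → Idx p j → at (st (take p v)) i < at (st (take p v)) j ↔ at v i < at v j
  st-take-< i j I J = subst₂ (λ a b → at (st (take p v)) i < at (st (take p v)) j ↔ a < b)
    (at-take p v i (proj₂ I)) (at-take p v j (proj₂ J)) (st-order (take p v) i j (wide I) (wide J))
    where
    wide : ∀ {i} → Idx p i → Idx (length (take p v)) i
    wide {i} = subst (λ k → Idx k i) (sym take-length)

  st-drop-< : ∀ i j → i < q → j < q → at (st (drop p v)) (suc i) < at (st (drop p v)) (suc j) ↔ at v (p + suc i) < at v (p + suc j)
  st-drop-< i j I J = subst₂ (λ a b → at (st (drop p v)) (suc i) < at (st (drop p v)) (suc j) ↔ a < b)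
    (at-drop p v i) (at-drop p v j) (st-order (drop p v) (suc i) (suc j) (s≤s z≤n , wide I) (s≤s z≤n , wide J))
    where
    wide : ∀ {i} → i < q → i < length (drop p v)
    wide {i} = subst (i <_) (sym drop-length)

  -- As `p` lies beyond every cut in `R`, the last block is `drop p v` and the other cuts act on
  -- `take p v` only. Both sides have the same inversions: those of `v` that no cut separates.
  restrictS-∷ʳ : ∀ R → (∀ a → a ∈ R → a < p) →
    restrictS (R ++ p ∷ []) v ≡ cross (restrictS R (st (take p v))) (st (drop p v))
  restrictS-∷ʳ R R<p = perm-ext (restrictS-perm V S) (cross-perm A B)
    (λ i j a b c h → from i j a b c (proj₁ (restrictS-inv V S i j a b c) h))
    (λ i j a b c h → proj₂ (restrictS-inv V S i j a b c) (to i j a b c h))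
    where
    S = R ++ p ∷ []
    A = restrictS-perm st-take-perm R
    B = st-drop-perm
    W = cross (restrictS R (st (take p v))) (st (drop p v))
    low : ∀ i → Idx p i → at W i ≡ at (restrictS R (st (take p v))) i
    low = at-crossˡ (restrictS R (st (take p v))) (perm-length A) (st (drop p v))
    high : ∀ j → j < q → at W (p + suc j) ≡ at (st (drop p v)) (suc j) + p
    high j h = at-crossʳ (restrictS R (st (take p v))) (perm-length A) (st (drop p v)) j (subst (j <_) (sym (perm-length B)) h)
    low<high : ∀ i j → Idx p i → j < q → at W i < at W (p + suc j)
    low<high i j I h = subst₂ _<_ (sym (low i I)) (sym (high j h))
      (≤-<-trans (proj₂ (perm-Idx A i I)) (m<n+m p (proj₁ (perm-Idx B (suc j) (s≤s z≤n , h)))))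
    to : ∀ i j → 1 ≤ i → i < j → j ≤ p + q → at W j < at W i → ¬ Sep S i j × at v j < at v i
    to i j a b c h with split-pos p i | split-pos p j
    ... | _ | inj₁ j≤p = ns , proj₁ (st-take-< j i J I) (proj₂ L)
      where
      J = ≤-trans a (<⇒≤ b) , j≤p
      I = a , ≤-trans (<⇒≤ b) j≤p
      L = proj₁ (restrictS-inv st-take-perm R i j a b j≤p) (subst₂ _<_ (low j J) (low i I) h)
      ns : ¬ Sep S i j
      ns s with proj₁ (Sep-∷ʳ R p i j) s
      ... | inj₁ r = proj₁ L r
      ... | inj₂ (_ , k) = <⇒≱ k j≤p
    ... | inj₁ i≤p | inj₂ (j′ , refl) = ⊥-elim (<-asym h (low<high i j′ (a , i≤p) (proj₂ (Idx-+ {p} c))))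
    ... | inj₂ (i′ , refl) | inj₂ (j′ , refl) = ns ,
        proj₁ (st-drop-< j′ i′ j′<q i′<q) (+-cancelʳ-< p _ _ (subst₂ _<_ (high j′ j′<q) (high i′ i′<q) h))
      where
      j′<q = proj₂ (Idx-+ {p} c)
      i′<q = proj₂ (Idx-+ {p} (≤-trans (<⇒≤ b) c))
      ns : ¬ Sep S (p + suc i′) (p + suc j′)
      ns (s , s∈ , k , _) with ∈-++⁻ R s∈
      ... | inj₁ r = <⇒≱ (R<p s r) (≤-trans (m≤m+n p _) k)
      ... | inj₂ (here refl) = m+1+n≰m p k
    from : ∀ i j → 1 ≤ i → i < j → j ≤ p + q → ¬ Sep S i j × at v j < at v i → at W j < at W i
    from i j a b c (ns , h) with split-pos p i | split-pos p j
    ... | _ | inj₁ j≤p = subst₂ _<_ (sym (low j J)) (sym (low i I))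
        (proj₂ (restrictS-inv st-take-perm R i j a b j≤p) ((λ r → ns (proj₂ (Sep-∷ʳ R p i j) (inj₁ r))) , proj₂ (st-take-< j i J I) h))
      where
      J = ≤-trans a (<⇒≤ b) , j≤p
      I = a , ≤-trans (<⇒≤ b) j≤p
    ... | inj₁ i≤p | inj₂ (j′ , refl) = ⊥-elim (ns (proj₂ (Sep-∷ʳ R p i _) (inj₂ (i≤p , m<m+n p (s≤s z≤n)))))
    ... | inj₂ (i′ , refl) | inj₂ (j′ , refl) = subst₂ _<_ (sym (high j′ j′<q)) (sym (high i′ i′<q))
        (+-monoˡ-< p (proj₂ (st-drop-< j′ i′ j′<q i′<q) h))
      where
      j′<q = proj₂ (Idx-+ {p} c)
      i′<q = proj₂ (Idx-+ {p} (≤-trans (<⇒≤ b) c))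

-- Factoring permutations with prescribed descents

withDes : ℕ → List ℕ → List (List ℕ)
withDes n S = filterB (λ ζ → subB (Des ζ) S) (perms n)

∈-withDes : ∀ n S ζ → ζ ∈ withDes n S ↔ (IsPerm n ζ × DesSub n ζ S)
∈-withDes n S ζ = to , from
  where
  to : ζ ∈ withDes n S → IsPerm n ζ × DesSub n ζ S
  to h = let h₁ , h₂ = proj₁ (∈-filterB (λ ζ → subB (Des ζ) S) (perms n) ζ) h ; P = proj₁ (∈-perms n ζ) h₁ in
    P , proj₁ (subB-Des ζ (perm-length P) S) h₂
  from : IsPerm n ζ × DesSub n ζ S → ζ ∈ withDes n S
  from (P , D) = proj₂ (∈-filterB (λ ζ → subB (Des ζ) S) (perms n) ζ) (proj₂ (∈-perms n ζ) P , proj₂ (subB-Des ζ (perm-length P) S) D)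

Unique-withDes : ∀ n S → Unique (withDes n S)
Unique-withDes n S = Unique-filterB (λ ζ → subB (Des ζ) S) (perms n) (Unique-perms n)

-- Every η with descents in R ∪ {p} factors uniquely as θ ∘ (ζ × 1) with ζ ∈ 𝔖_p having descents in R and θ a (p,q)-shuffle.
module Factor (p q : ℕ) (R : List ℕ) (R<p : ∀ a → a ∈ R → a < p) where

  n : ℕ
  n = p + q

  ext : List ℕ → List ℕ
  ext ζ = cross ζ (range q)

  ext-perm : ∀ {ζ} → IsPerm p ζ → IsPerm n (ext ζ)
  ext-perm Z = cross-perm Z (range-perm q)

  glue : List ℕ → List ℕ → List ℕ
  glue ζ θ = comp θ (ext ζ)

  module _ {ζ θ : List ℕ} (Z : IsPerm p ζ) (T : IsPerm n θ) where

    glue-perm : IsPerm n (glue ζ θ)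
    glue-perm = comp-perm T (ext-perm Z)

    at-glueˡ : ∀ i → Idx p i → at (glue ζ θ) i ≡ at θ (at ζ i)
    at-glueˡ i I = trans (at-comp θ (ext ζ) (perm-length (ext-perm Z)) i (widen q I))
        (cong (at θ) (at-crossˡ ζ (perm-length Z) (range q) i I))

    at-glueʳ : ∀ j → suc j ≤ q → at (glue ζ θ) (p + suc j) ≡ at θ (p + suc j)
    at-glueʳ j h = trans (at-comp θ (ext ζ) (perm-length (ext-perm Z)) (p + suc j) (+-Idx {p} j h))
      (cong (at θ) (trans (at-crossʳ ζ (perm-length Z) (range q) j (subst (j <_) (sym (length-range q)) h))
        (trans (cong (_+ p) (at-range q (suc j) (s≤s z≤n , h))) (+-comm (suc j) p))))

    module _ (D : DesSub n θ (p ∷ [])) where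

      θ-increasing : ∀ i j → 1 ≤ i → i < j → j ≤ p → at θ i < at θ j
      θ-increasing i j a b c = increasing T (p ∷ []) D i j a b (≤-trans c (m≤m+n p q))
        λ { s _ s<j (here refl) → <⇒≱ s<j c }

      glue-< : ∀ i j → Idx p i → Idx p j → at ζ i < at ζ j ↔ at (glue ζ θ) i < at (glue ζ θ) j
      glue-< i j I J = fwd i j I J , bwd
        where
        fwd : ∀ i j → Idx p i → Idx p j → at ζ i < at ζ j → at (glue ζ θ) i < at (glue ζ θ) j
        fwd i j I J h = subst₂ _<_ (sym (at-glueˡ i I)) (sym (at-glueˡ j J))
          (θ-increasing _ _ (proj₁ (perm-Idx Z i I)) h (proj₂ (perm-Idx Z j J)))
        bwd : at (glue ζ θ) i < at (glue ζ θ) j → at ζ i < at ζ j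
        bwd h with <-cmp (at ζ i) (at ζ j)
        ... | tri< r _ _ = r
        ... | tri≈ _ e _ = ⊥-elim (<⇒≢ h (cong (at (glue ζ θ)) (perm-inj Z i j I J e)))
        ... | tri> _ _ r = ⊥-elim (<-asym h (fwd j i J I r))

      glue-Des : DesSub p ζ R → DesSub n (glue ζ θ) (R ++ p ∷ [])
      glue-Des DZ i a b h with <-cmp i p
      ... | tri< i<p _ _ = ∈-++⁺ˡ (DZ i a i<p (proj₂ (glue-< (suc i) i (s≤s z≤n , i<p) (a , <⇒≤ i<p)) h))
      ... | tri≈ _ refl _ = ∈-++⁺ʳ R (here refl)
      ... | tri> _ _ p<i with split-pos p i
      ... | inj₁ i≤p = ⊥-elim (<⇒≱ p<i i≤p)
      ... | inj₂ (j , refl) with D (p + suc j) a b (subst₂ _<_ eq (at-glueʳ j (≤-trans (n≤1+n _) j<q)) h)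
        where
        j<q : suc (suc j) ≤ q
        j<q = +-cancelˡ-≤ p _ _ (subst (_≤ n) (sym (+-suc p (suc j))) b)
        eq : at (glue ζ θ) (suc (p + suc j)) ≡ at θ (suc (p + suc j))
        eq = subst (λ k → at (glue ζ θ) k ≡ at θ k) (+-suc p (suc j)) (at-glueʳ (suc j) j<q)
      ... | here e = ⊥-elim (m+1+n≢m p e)

  glue-injʳ : ∀ {ζ θ θ′} → IsPerm p ζ → IsPerm n θ → IsPerm n θ′ → glue ζ θ ≡ glue ζ θ′ → θ ≡ θ′
  glue-injʳ {ζ} {θ} {θ′} Z T T′ e = trans (sym (comp-cancel-inverse θ (perm-length T) (ext-perm Z)))
    (trans (cong (λ w → comp w (inverse (ext ζ))) e) (comp-cancel-inverse θ′ (perm-length T′) (ext-perm Z)))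

  -- Since `θ` is increasing on [p], the first p letters of the product have the relative order of
  -- `ζ`, so the product determines `ζ`.
  glue-injˡ : ∀ {ζ ζ′ θ θ′} → IsPerm p ζ → IsPerm p ζ′ → IsPerm n θ → IsPerm n θ′ →
    DesSub n θ (p ∷ []) → DesSub n θ′ (p ∷ []) → glue ζ θ ≡ glue ζ′ θ′ → ζ ≡ ζ′
  glue-injˡ {ζ} {ζ′} {θ} {θ′} Z Z′ T T′ D D′ e = perm-ext Z Z′
    (λ i j a b c h → proj₂ (glue-< Z′ T′ D′ j i (Idxʳ a b c) (Idxˡ a b c))
      (subst (λ w → at w j < at w i) e (proj₁ (glue-< Z T D j i (Idxʳ a b c) (Idxˡ a b c)) h)))
    (λ i j a b c h → proj₂ (glue-< Z T D j i (Idxʳ a b c) (Idxˡ a b c))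
      (subst (λ w → at w j < at w i) (sym e) (proj₁ (glue-< Z′ T′ D′ j i (Idxʳ a b c) (Idxˡ a b c)) h)))

  glue-surj : ∀ {η} → IsPerm n η → DesSub n η (R ++ p ∷ []) → ∃[ ζ ] ∃[ θ ]
    (IsPerm p ζ × DesSub p ζ R × IsPerm n θ × DesSub n θ (p ∷ []) × glue ζ θ ≡ η)
  glue-surj {η} H D = ζ , θ , Z , DZ , T , DT , e
    where
    -- `ζ` is the pattern of the first p letters of `η`; dividing it out on the right sorts these
    -- letters.
    ζ = st (take p η)
    Z : IsPerm p ζ
    Z = st-take-perm {p} {q} H
    θ = comp η (inverse (ext ζ))
    T : IsPerm n θ
    T = comp-perm H (inverse-perm (ext-perm Z))
    e : glue ζ θ ≡ η
    e = comp-inverse-cancel η (perm-length H) (ext-perm Z)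
    ζ-< : ∀ i j → Idx p i → Idx p j → at ζ i < at ζ j ↔ at η i < at η j
    ζ-< = st-take-< {p} {q} H
    DZ : DesSub p ζ R
    DZ i a b h with ∈-++⁻ R (D i a (≤-trans b (m≤m+n p q)) (proj₁ (ζ-< (suc i) i (s≤s z≤n , b) (a , <⇒≤ b)) h))
    ... | inj₁ r = r
    ... | inj₂ (here refl) = ⊥-elim (n≮n _ b)
    θ-low : ∀ i → Idx p i → at θ (at ζ i) ≡ at η i
    θ-low i I = trans (sym (at-glueˡ Z T i I)) (cong (λ w → at w i) e)
    θ-high : ∀ j → suc j ≤ q → at θ (p + suc j) ≡ at η (p + suc j)
    θ-high j h = trans (sym (at-glueʳ Z T j h)) (cong (λ w → at w (p + suc j)) e)
    inv-low : ∀ i j → Idx p i → Idx p j → i < j → ¬ (at θ j < at θ i)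
    inv-low i j I J i<j h = <-asym
      (subst₂ _<_ (at-θ j J) (at-θ i I) h)
      (proj₁ (ζ-< (ζ⁻¹ i) (ζ⁻¹ j) (inverse-Idx Z i I) (inverse-Idx Z j J)) (subst₂ _<_ (sym (at-inverseʳ Z i I))
          (sym (at-inverseʳ Z j J)) i<j))
      where
      ζ⁻¹ : ℕ → ℕ
      ζ⁻¹ = at (inverse ζ)
      at-θ : ∀ i → Idx p i → at θ i ≡ at η (ζ⁻¹ i)
      at-θ i I = trans (cong (at θ) (sym (at-inverseʳ Z i I))) (θ-low (ζ⁻¹ i) (inverse-Idx Z i I))
    -- On [p], `θ` lists the first p letters of `η` in increasing order. Beyond p it agrees with
    -- `η`, which has no descents there because all elements of `R ++ p ∷ []` are at most p.
    DT : DesSub n θ (p ∷ [])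
    DT i a b h with <-cmp i p
    ... | tri≈ _ refl _ = here refl
    ... | tri< i<p _ _ = ⊥-elim (inv-low i (suc i) (a , <⇒≤ i<p) (s≤s z≤n , i<p) ≤-refl h)
    DT i a b h | tri> _ _ p<i with split-pos p i
    ... | inj₁ i≤p = ⊥-elim (<⇒≱ p<i i≤p)
    ... | inj₂ (j , refl) = ⊥-elim (high j a b h)
      where
      high : ∀ j → 1 ≤ p + suc j → p + suc j < n → ¬ (at θ (suc (p + suc j)) < at θ (p + suc j))
      high j a b h = [ (λ r → <⇒≱ (R<p _ r) (m≤m+n p _)) , (λ { (here k) → m+1+n≢m p k }) ]′
        (∈-++⁻ R (D (p + suc j) a b (subst₂ _<_ eq (θ-high j (≤-trans (n≤1+n _) j<q)) h)))
        where
        j<q : suc (suc j) ≤ q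
        j<q = +-cancelˡ-≤ p _ _ (subst (_≤ n) (sym (+-suc p (suc j))) b)
        eq : at θ (suc (p + suc j)) ≡ at η (suc (p + suc j))
        eq = subst (λ k → at θ k ≡ at η k) (+-suc p (suc j)) (θ-high (suc j) j<q)

  factorsᶻ : List (List ℕ)
  factorsᶻ = withDes p R

  factorsᵗ : List (List ℕ)
  factorsᵗ = withDes n (p ∷ [])

  products : List (List ℕ)
  products = withDes n (R ++ p ∷ [])

  glued : List ℕ → List (List ℕ)
  glued ζ = map (glue ζ) factorsᵗ

  glued-disjoint : ∀ ζ ζ′ η → ζ ∈ factorsᶻ → ζ′ ∈ factorsᶻ → η ∈ glued ζ → η ∈ glued ζ′ → ζ ≡ ζ′
  glued-disjoint ζ ζ′ η h h′ k k′ with ∈-map⁻ (glue ζ) k | ∈-map⁻ (glue ζ′) k′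
  ... | θ , t , e | θ′ , t′ , e′ = glue-injˡ {ζ} {ζ′} {θ} {θ′} (proj₁ z) (proj₁ z′) (proj₁ t₁) (proj₁ t₂) (proj₂ t₁) (proj₂ t₂)
      (trans (sym e) e′)
    where
    z = proj₁ (∈-withDes p R ζ) h
    z′ = proj₁ (∈-withDes p R ζ′) h′
    t₁ = proj₁ (∈-withDes n (p ∷ []) θ) t
    t₂ = proj₁ (∈-withDes n (p ∷ []) θ′) t′

  glued-Unique : ∀ ζ → ζ ∈ factorsᶻ → Unique (glued ζ)
  glued-Unique ζ h = Unique-map (glue ζ) factorsᵗ (Unique-withDes n (p ∷ [])) λ θ θ′ t t′ e →
    glue-injʳ {ζ} {θ} {θ′} (proj₁ (proj₁ (∈-withDes p R ζ) h)) (proj₁ (proj₁ (∈-withDes n (p ∷ []) θ) t))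
        (proj₁ (proj₁ (∈-withDes n (p ∷ []) θ′) t′)) e

  glued⊆products : ∀ η → η ∈ concatMap glued factorsᶻ → η ∈ products
  glued⊆products η h with proj₁ (∈-concatMap glued factorsᶻ η) h
  ... | ζ , z , k with ∈-map⁻ (glue ζ) k
  ... | θ , t , e = subst (_∈ products) (sym e) (proj₂ (∈-withDes n (R ++ p ∷ []) (glue ζ θ))
      (glue-perm {ζ} {θ} (proj₁ z′) (proj₁ t′) , glue-Des {ζ} {θ} (proj₁ z′) (proj₁ t′) (proj₂ t′) (proj₂ z′)))
    where
    z′ = proj₁ (∈-withDes p R ζ) z
    t′ = proj₁ (∈-withDes n (p ∷ []) θ) t

  products⊆glued : ∀ η → η ∈ products → η ∈ concatMap glued factorsᶻ
  products⊆glued η h = fromFactors (glue-surj {η} (proj₁ h′) (proj₂ h′))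
    where
    h′ = proj₁ (∈-withDes n (R ++ p ∷ []) η) h
    fromFactors : ∃[ ζ ] ∃[ θ ] (IsPerm p ζ × DesSub p ζ R × IsPerm n θ × DesSub n θ (p ∷ []) × glue ζ θ ≡ η) →
      η ∈ concatMap glued factorsᶻ
    fromFactors (ζ , θ , Z , DZ , T , DT , e) = proj₂ (∈-concatMap glued factorsᶻ η)
      (ζ , proj₂ (∈-withDes p R ζ) (Z , DZ) ,
       subst (_∈ glued ζ) e (∈-map⁺ (glue ζ) (proj₂ (∈-withDes n (p ∷ []) θ) (T , DT))))

  products-↭ : concatMap glued factorsᶻ ↭ products
  products-↭ = unique-set⇒↭ (Unique-concatMap glued factorsᶻ (Unique-withDes p R) glued-Unique glued-disjoint)
    (Unique-withDes n (R ++ p ∷ [])) glued⊆products products⊆glued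

  -- Multiply both sides on the right by θ(ζ × 1): on the left `θ` cancels first, and then (Yζ⁻¹ ×
  -- b)(ζ × 1) = Y × b.
  comp-cross-glue : ∀ {Y b ζ θ} → length Y ≡ p → length b ≡ q → IsPerm p ζ → IsPerm n θ →
    comp (cross (comp Y (inverse ζ)) b) (inverse θ) ≡ comp (cross Y b) (inverse (glue ζ θ))
  comp-cross-glue {Y} {b} {ζ} {θ} ℓY ℓb Z T =
    trans (sym (comp-cancel-inverse X ℓX (glue-perm Z T))) (cong (λ w → comp w (inverse (glue ζ θ))) X∘glue)
    where
    open ≡-Reasoning
    Y′ = comp Y (inverse ζ)
    ℓY′ : length Y′ ≡ p
    ℓY′ = trans (comp-length Y (inverse ζ)) (inverse-length Z)
    X = comp (cross Y′ b) (inverse θ)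
    ℓX : length X ≡ n
    ℓX = trans (comp-length (cross Y′ b) (inverse θ)) (inverse-length T)
    ℓc : length (cross Y′ b) ≡ n
    ℓc = cross-length Y′ ℓY′ b ℓb
    E = ext-perm Z
    cross-ext : ∀ i → Idx n i → at (comp (cross Y′ b) (ext ζ)) i ≡ at (cross Y b) i
    cross-ext i (a , c) with split-pos p i
    ... | inj₁ h = begin
      at (comp (cross Y′ b) (ext ζ)) i ≡⟨ at-comp (cross Y′ b) (ext ζ) (perm-length E) i (a , c) ⟩
      at (cross Y′ b) (at (ext ζ) i) ≡⟨ cong (at (cross Y′ b)) (at-crossˡ ζ (perm-length Z) (range q) i (a , h)) ⟩
      at (cross Y′ b) (at ζ i) ≡⟨ at-crossˡ Y′ ℓY′ b (at ζ i) (perm-Idx Z i (a , h)) ⟩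
      at Y′ (at ζ i) ≡⟨ sym (at-comp Y′ ζ (perm-length Z) i (a , h)) ⟩
      at (comp Y′ ζ) i ≡⟨ cong (λ w → at w i) (comp-inverse-cancel Y ℓY Z) ⟩
      at Y i ≡⟨ sym (at-crossˡ Y ℓY b i (a , h)) ⟩
      at (cross Y b) i ∎
    ... | inj₂ (j , refl) = begin
      at (comp (cross Y′ b) (ext ζ)) (p + suc j) ≡⟨ at-comp (cross Y′ b) (ext ζ) (perm-length E) (p + suc j) (a , c) ⟩
      at (cross Y′ b) (at (ext ζ) (p + suc j)) ≡⟨ cong (at (cross Y′ b))
          (trans (at-crossʳ ζ (perm-length Z) (range q) j (subst (j <_) (sym (length-range q)) j<q))
        (trans (cong (_+ p) (at-range q (suc j) (s≤s z≤n , j<q))) (+-comm (suc j) p))) ⟩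
      at (cross Y′ b) (p + suc j) ≡⟨ at-crossʳ Y′ ℓY′ b j (subst (j <_) (sym ℓb) j<q) ⟩
      at b (suc j) + p ≡⟨ sym (at-crossʳ Y ℓY b j (subst (j <_) (sym ℓb) j<q)) ⟩
      at (cross Y b) (p + suc j) ∎
      where
      j<q = proj₂ (Idx-+ {p} c)
    X∘glue : comp X (glue ζ θ) ≡ cross Y b
    X∘glue = begin
      comp X (comp θ (ext ζ)) ≡⟨ comp-assoc {n} {X} {θ} {ext ζ} (perm-length T) (perm-length E) (perm-Idx E) ⟩
      comp (comp X θ) (ext ζ) ≡⟨ cong (λ w → comp w (ext ζ)) (comp-inverse-cancel (cross Y′ b) ℓc T) ⟩
      comp (cross Y′ b) (ext ζ) ≡⟨ word-ext (trans (comp-length (cross Y′ b) (ext ζ)) (perm-length E))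
          (cross-length Y ℓY b ℓb) cross-ext ⟩
      cross Y b ∎

-- Takeuchi's formula for the antipode on the basis F

∈-sublists-⊆ : ∀ xs R → R ∈ sublists xs → ∀ a → a ∈ R → a ∈ xs
∈-sublists-⊆ [] R (here refl) a ()
∈-sublists-⊆ (x ∷ xs) R h a a∈ with ∈-++⁻ (map (x ∷_) (sublists xs)) h
... | inj₂ k = there (∈-sublists-⊆ xs R k a a∈)
... | inj₁ k with ∈-map⁻ (x ∷_) k
∈-sublists-⊆ (x ∷ xs) R h a (here refl) | inj₁ k | R′ , _ , refl = here refl
∈-sublists-⊆ (x ∷ xs) R h a (there a∈) | inj₁ k | R′ , R′∈ , refl = there (∈-sublists-⊆ xs R′ R′∈ a a∈)

∑-sublists-∷ʳ : ∀ xs y (f : List ℕ → ℚ) →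
  ∑ (sublists (xs ++ y ∷ [])) f ≡ ∑ (sublists xs) f Q.+ ∑ (sublists xs) (λ R → f (R ++ y ∷ []))
∑-sublists-∷ʳ [] y f = solve 2 (λ a b → a :+ (b :+ con 0ℚ) := (b :+ con 0ℚ) :+ (a :+ con 0ℚ)) refl (f (y ∷ [])) (f [])
  where open +-*-Solver
∑-sublists-∷ʳ (x ∷ xs) y f = begin
  ∑ (map (x ∷_) (sublists (xs ++ y ∷ [])) ++ sublists (xs ++ y ∷ [])) f
    ≡⟨ trans (∑-++ (map (x ∷_) (sublists (xs ++ y ∷ []))) _ f) (cong (Q._+ ∑ (sublists (xs ++ y ∷ [])) f)
        (∑-map (x ∷_) (sublists (xs ++ y ∷ [])) f)) ⟩
  ∑ (sublists (xs ++ y ∷ [])) (f ∘ (x ∷_)) Q.+ ∑ (sublists (xs ++ y ∷ [])) f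
    ≡⟨ cong₂ Q._+_ (∑-sublists-∷ʳ xs y (f ∘ (x ∷_))) (∑-sublists-∷ʳ xs y f) ⟩
  (A Q.+ B) Q.+ (C Q.+ D)
    ≡⟨ solve 4 (λ a b c d → a :+ b :+ (c :+ d) := a :+ c :+ (b :+ d)) refl A B C D ⟩
  (A Q.+ C) Q.+ (B Q.+ D) ≡⟨ sym (cong₂ Q._+_ (split f) (split (λ R → f (R ++ y ∷ [])))) ⟩
  ∑ (sublists (x ∷ xs)) f Q.+ ∑ (sublists (x ∷ xs)) (λ R → f (R ++ y ∷ [])) ∎
  where
  open ≡-Reasoning
  open +-*-Solver
  A = ∑ (sublists xs) (f ∘ (x ∷_))
  B = ∑ (sublists xs) (λ R → f (x ∷ R ++ y ∷ []))
  C = ∑ (sublists xs) f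
  D = ∑ (sublists xs) (λ R → f (R ++ y ∷ []))
  split : ∀ g → ∑ (sublists (x ∷ xs)) g ≡ ∑ (sublists xs) (g ∘ (x ∷_)) Q.+ ∑ (sublists xs) g
  split g = trans (∑-++ (map (x ∷_) (sublists xs)) _ g) (cong (Q._+ ∑ (sublists xs) g) (∑-map (x ∷_) (sublists xs) g))

-- Nonempty subsets are sorted by their largest element p. This matches the recursion for the
-- antipode, where p is the place at which the coproduct splits the word.
∑-sublists-range : ∀ m (f : List ℕ → ℚ) →
  ∑ (sublists (range m)) f ≡ f [] Q.+ ∑ (range m) (λ p → ∑ (sublists (range (p ∸ 1))) (λ R → f (R ++ p ∷ [])))
∑-sublists-range zero f = refl
∑-sublists-range (suc m) f = begin
  ∑ (sublists (range (suc m))) f ≡⟨ cong (λ xs → ∑ (sublists xs) f) (range-suc m) ⟩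
  ∑ (sublists (range m ++ suc m ∷ [])) f ≡⟨ ∑-sublists-∷ʳ (range m) (suc m) f ⟩
  ∑ (sublists (range m)) f Q.+ h (suc m) ≡⟨ cong (Q._+ h (suc m)) (∑-sublists-range m f) ⟩
  f [] Q.+ ∑ (range m) h Q.+ h (suc m) ≡⟨ Qₚ.+-assoc (f []) (∑ (range m) h) (h (suc m)) ⟩
  f [] Q.+ (∑ (range m) h Q.+ h (suc m)) ≡⟨ cong (λ s → f [] Q.+ (∑ (range m) h Q.+ s)) (sym (∑-singleton (suc m) h)) ⟩
  f [] Q.+ (∑ (range m) h Q.+ ∑ (suc m ∷ []) h) ≡⟨ cong (f [] Q.+_) (sym (∑-++ (range m) (suc m ∷ []) h)) ⟩
  f [] Q.+ ∑ (range m ++ suc m ∷ []) h ≡⟨ cong (λ xs → f [] Q.+ ∑ xs h) (sym (range-suc m)) ⟩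
  f [] Q.+ ∑ (range (suc m)) h ∎
  where
  open ≡-Reasoning
  h : ℕ → ℚ
  h p = ∑ (sublists (range (p ∸ 1))) (λ R → f (R ++ p ∷ []))

-- For a permutation v of [n] and S ⊆ [n-1], this is the value of `g` at the product of the basis
-- elements F indexed by the standardized blocks of `v`.
blockSum : ℕ → List ℕ → List ℕ → (List ℕ → ℚ) → ℚ
blockSum n S v g = ∑ (perms n) (λ ζ → 𝟙 (subB (Des ζ) S) Q.* g (comp (restrictS S v) (inverse ζ)))

takeuchi : ℕ → List ℕ → (List ℕ → ℚ) → ℚ
takeuchi n v g = ∑ (sublists (range (n ∸ 1))) (λ S → signQ (suc (length S)) Q.* blockSum n S v g)

pairing-mulF : ∀ {p q u w} → length u ≡ p → length w ≡ q → ∀ g →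
  ⟪ mulF u w , g ⟫ ≡ ∑ (perms (p + q)) (λ θ → 𝟙 (subB (Des θ) (p ∷ [])) Q.* g (comp (cross u w) (inverse θ)))
pairing-mulF {u = u} {w} refl refl g = begin
  ⟪ mulF u w , g ⟫ ≡⟨ ∑-map (λ ζ → (1ℚ , comp (cross u w) (inverse ζ))) (shuffles (length u) (length w)) (λ t → proj₁ t Q.* g (proj₂ t)) ⟩
  ∑ (shuffles (length u) (length w)) (λ θ → 1ℚ Q.* g (comp (cross u w) (inverse θ)))
    ≡⟨ ∑-cong′ (shuffles (length u) (length w)) (λ θ → Qₚ.*-identityˡ _) ⟩
  ∑ (shuffles (length u) (length w)) (λ θ → g (comp (cross u w) (inverse θ)))
    ≡⟨ ∑-filterB (λ ζ → subB (Des ζ) (length u ∷ [])) (perms (length u + length w)) (λ θ → g (comp (cross u w) (inverse θ))) ⟩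
  _ ∎
  where open ≡-Reasoning

no-descents⇒range : ∀ {n ζ} → IsPerm n ζ → (∀ i → 1 ≤ i → i < n → ¬ (at ζ (suc i) < at ζ i)) → ζ ≡ range n
no-descents⇒range {n} {ζ} Z h = perm-ext Z (range-perm n)
  (λ i j a b c lt → ⊥-elim (<-asym lt (increasing Z [] (λ k p q r → ⊥-elim (h k p q r)) i j a b c (λ _ _ _ ()))))
  (λ i j a b c lt → ⊥-elim (<-asym lt (at-range-< n i j (Idxˡ a b c) (Idxʳ a b c) b)))

-- The only descent allowed is at k, the last position of a word of length k, where none can occur;
-- so the identity is the only shuffle.
pairing-mulF-[] : ∀ u g → ⟪ mulF u [] , g ⟫ ≡ g u
pairing-mulF-[] u g = begin
  ⟪ mulF u [] , g ⟫ ≡⟨ pairing-mulF {k} {0} {u} {[]} refl refl g ⟩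
  ∑ (perms (k + 0)) (λ θ → 𝟙 (subB (Des θ) (k ∷ [])) Q.* g (comp (cross u []) (inverse θ)))
    ≡⟨ cong₂ (λ m w → ∑ (perms m) (λ θ → 𝟙 (subB (Des θ) (k ∷ [])) Q.* g (comp w (inverse θ)))) (+-identityʳ k) (++-identityʳ u) ⟩
  ∑ (perms k) (λ θ → 𝟙 (subB (Des θ) (k ∷ [])) Q.* g (comp u (inverse θ)))
    ≡⟨ ∑-support (perms k) (range k) _ (proj₂ (∈-perms k (range k)) (range-perm k)) (Unique-perms k) other ⟩
  𝟙 (subB (Des (range k)) (k ∷ [])) Q.* g (comp u (inverse (range k)))
    ≡⟨ 𝟙-true (proj₂ (subB-Des (range k) (length-range k) (k ∷ []))
         λ i a b lt → ⊥-elim (<-asym lt (at-range-< k i (suc i) (a , <⇒≤ b) (s≤s z≤n , b) ≤-refl))) _ ⟩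
  g (comp u (inverse (range k))) ≡⟨ cong g (trans (cong (λ w → comp w (inverse (range k))) (sym (map-at-range k u refl)))
       (comp-cancel-inverse {k} {range k} u refl (range-perm k))) ⟩
  g u ∎
  where
  open ≡-Reasoning
  k = length u
  other : ∀ θ → θ ∈ perms k → θ ≢ range k → 𝟙 (subB (Des θ) (k ∷ [])) Q.* g (comp u (inverse θ)) ≡ 0ℚ
  other θ θ∈ ne = 𝟙-false (λ e → ne (no-descents⇒range T λ i a b lt → last i b
      (proj₁ (subB-Des θ (perm-length T) (k ∷ [])) e i a b lt))) _
    where
    T = proj₁ (∈-perms k θ) θ∈
    last : ∀ i → i < k → i ∉ (k ∷ [])
    last i b (here refl) = n≮n _ b

-- Expanding the extra product gives a sum over pairs: `ζ` for the cuts in `R` and a shuffle `θ` for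
-- the cut `p`. The factorization in `Factor` merges each pair into the single permutation
-- `glue ζ θ`.
blockSum-∷ʳ : ∀ {p q v R} → IsPerm (p + q) v → (∀ a → a ∈ R → a < p) → ∀ g →
  blockSum p R (st (take p v)) (λ u → ⟪ mulF u (st (drop p v)) , g ⟫) ≡ blockSum (p + q) (R ++ p ∷ []) v g
blockSum-∷ʳ {p} {q} {v} {R} V R<p g = begin
  blockSum p R a (λ u → ⟪ mulF u b , g ⟫) ≡⟨ sym (∑-filterB (λ ζ → subB (Des ζ) R) (perms p) _) ⟩
  ∑ factorsᶻ (λ ζ → ⟪ mulF (comp A (inverse ζ)) b , g ⟫) ≡⟨ ∑-cong factorsᶻ inner ⟩
  ∑ factorsᶻ (λ ζ → ∑ (glued ζ) G) ≡⟨ sym (∑-concatMap glued factorsᶻ G) ⟩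
  ∑ (concatMap glued factorsᶻ) G ≡⟨ ∑-↭ products-↭ G ⟩
  ∑ products G ≡⟨ ∑-filterB (λ η → subB (Des η) (R ++ p ∷ [])) (perms n) G ⟩
  blockSum n (R ++ p ∷ []) v g ∎
  where
  open ≡-Reasoning
  open Factor p q R R<p
  a = st (take p v)
  b = st (drop p v)
  A = restrictS R a
  ℓA : length A ≡ p
  ℓA = perm-length (restrictS-perm (st-take-perm {p} {q} V) R)
  ℓb : length b ≡ q
  ℓb = perm-length (st-drop-perm {p} {q} V)
  G : List ℕ → ℚ
  G η = g (comp (restrictS (R ++ p ∷ []) v) (inverse η))
  inner : ∀ ζ → ζ ∈ factorsᶻ → ⟪ mulF (comp A (inverse ζ)) b , g ⟫ ≡ ∑ (glued ζ) G
  inner ζ ζ∈ = begin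
    ⟪ mulF (comp A (inverse ζ)) b , g ⟫
      ≡⟨ pairing-mulF {p} {q} {comp A (inverse ζ)} {b} (trans (comp-length A (inverse ζ)) (inverse-length Z)) ℓb g ⟩
    ∑ (perms n) (λ θ → 𝟙 (subB (Des θ) (p ∷ [])) Q.* g (comp (cross (comp A (inverse ζ)) b) (inverse θ)))
      ≡⟨ sym (∑-filterB (λ θ → subB (Des θ) (p ∷ [])) (perms n) _) ⟩
    ∑ factorsᵗ (λ θ → g (comp (cross (comp A (inverse ζ)) b) (inverse θ)))
      ≡⟨ ∑-cong factorsᵗ (λ θ θ∈ → cong g (trans
           (comp-cross-glue {A} {b} {ζ} {θ} ℓA ℓb Z (proj₁ (proj₁ (∈-withDes n (p ∷ []) θ) θ∈)))
           (cong (λ w → comp w (inverse (glue ζ θ))) (sym (restrictS-∷ʳ V R R<p))))) ⟩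
    ∑ factorsᵗ (λ θ → G (glue ζ θ)) ≡⟨ sym (∑-map (glue ζ) factorsᵗ G) ⟩
    ∑ (glued ζ) G ∎
    where
    Z = proj₁ (proj₁ (∈-withDes p R ζ) ζ∈)

restrictS-[] : ∀ {n v} → IsPerm n v → restrictS [] v ≡ v
restrictS-[] V = perm-ext (restrictS-perm V []) V
  (λ i j a b c h → proj₂ (proj₁ (restrictS-inv V [] i j a b c) h))
  (λ i j a b c h → proj₂ (restrictS-inv V [] i j a b c) ((λ ()) , h))

cross-[] : ∀ v → cross [] v ≡ v
cross-[] v = trans (map-cong +-identityʳ v) (map-id v)

module _ (S : List ℕ → Elem) (antipode : IsAntipode S) where

  antipode-[] : ∀ g → ⟪ S [] , g ⟫ ≡ g []
  antipode-[] g = begin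
    ⟪ S [] , g ⟫ ≡⟨ ∑-cong′ (S []) (λ t → cong (proj₁ t Q.*_) (sym (pairing-mulF-[] (proj₂ t) g))) ⟩
    ⟪ S [] , (λ u → ⟪ mulF u [] , g ⟫) ⟫ ≡⟨ sym (pairing-mul-F (S []) [] g) ⟩
    ⟪ mul (S []) (F []) , g ⟫ ≡⟨ sym (trans (pairing-++ (mul (S []) (F [])) [] g) (Qₚ.+-identityʳ _)) ⟩
    ⟪ mul (S []) (F []) ++ [] , g ⟫ ≡⟨ pairing-cong (mul (S []) (F []) ++ []) (F []) (proj₁ (antipode 0 [] ↭-refl)) g ⟩
    ⟪ F [] , g ⟫ ≡⟨ pairing-F [] g ⟩
    g [] ∎
    where open ≡-Reasoning

  -- In the axiom at `v` the term p = n has the empty word as right factor and equals `S v`; the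
  -- equation is solved for it. The term p = 0 is kept apart because there `S []` can be evaluated
  -- outright.
  antipode-recursion : ∀ {m v} → IsPerm (suc m) v → ∀ g → ⟪ S v , g ⟫ ≡
    - (⟪ mulF [] v , g ⟫ Q.+ ∑ (range m) (λ p → ⟪ S (st (take p v)) , (λ u → ⟪ mulF u (st (drop p v)) , g ⟫) ⟫))
  antipode-recursion {m} {v} V g = neg-unique (T0 Q.+ ∑ (range m) T) ⟪ S v , g ⟫ (begin
    (T0 Q.+ ∑ (range m) T) Q.+ ⟪ S v , g ⟫ ≡⟨ Qₚ.+-assoc T0 (∑ (range m) T) ⟪ S v , g ⟫ ⟩
    T0 Q.+ (∑ (range m) T Q.+ ⟪ S v , g ⟫) ≡⟨ cong₂ (λ a b → a Q.+ (∑ (range m) T Q.+ b)) (sym first)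
        (sym (trans (∑-singleton (suc m) T) last)) ⟩
    T 0 Q.+ (∑ (range m) T Q.+ ∑ (suc m ∷ []) T) ≡⟨ cong (T 0 Q.+_) (sym (∑-++ (range m) (suc m ∷ []) T)) ⟩
    T 0 Q.+ ∑ (range m ++ suc m ∷ []) T ≡⟨ cong (λ xs → T 0 Q.+ ∑ xs T) (sym (range-suc m)) ⟩
    ∑ (0 ∷ range (suc m)) T ≡⟨ ∑-cong′ (0 ∷ range (suc m)) (λ p → sym (pairing-mul-F (S (st (take p v))) (st (drop p v)) g)) ⟩
    ∑ (0 ∷ range (suc m)) (λ p → ⟪ mul (S (st (take p v))) (F (st (drop p v))) , g ⟫)
      ≡⟨ sym (pairing-concatMap (λ p → mul (S (st (take p v))) (F (st (drop p v)))) (0 ∷ range (suc m)) g) ⟩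
    ⟪ concatMap (λ p → mul (S (st (take p v))) (F (st (drop p v)))) (0 ∷ range (suc m)) , g ⟫
      ≡⟨ pairing-cong (concatMap (λ p → mul (S (st (take p v))) (F (st (drop p v)))) (0 ∷ range (suc m))) (etaEps v)
          (proj₁ (antipode (suc m) v V)) g ⟩
    ⟪ etaEps v , g ⟫ ≡⟨ cong (λ x → ⟪ x , g ⟫) (etaEps-∷ v (perm-length V)) ⟩
    0ℚ ∎)
    where
    open ≡-Reasoning
    T0 = ⟪ mulF [] v , g ⟫
    T : ℕ → ℚ
    T p = ⟪ S (st (take p v)) , (λ u → ⟪ mulF u (st (drop p v)) , g ⟫) ⟫
    etaEps-∷ : ∀ v → length v ≡ suc m → etaEps v ≡ []
    etaEps-∷ (_ ∷ _) _ = refl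
    first : T 0 ≡ T0
    first = trans (antipode-[] _) (cong (λ w → ⟪ mulF [] w , g ⟫) (st-idem V))
    takeAll : ∀ k (w : List ℕ) → length w ≡ k → take k w ≡ w × drop k w ≡ []
    takeAll zero [] _ = refl , refl
    takeAll (suc k) (x ∷ w) e = cong (x ∷_) (proj₁ (takeAll k w (suc-injective e))) , proj₂ (takeAll k w (suc-injective e))
    last : T (suc m) ≡ ⟪ S v , g ⟫
    last = begin
      ⟪ S (st (take (suc m) v)) , (λ u → ⟪ mulF u (st (drop (suc m) v)) , g ⟫) ⟫
        ≡⟨ cong₂ (λ a b → ⟪ S (st a) , (λ u → ⟪ mulF u (st b) , g ⟫) ⟫) (proj₁ (takeAll (suc m) v (perm-length V)))
            (proj₂ (takeAll (suc m) v (perm-length V))) ⟩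
      ⟪ S (st v) , (λ u → ⟪ mulF u [] , g ⟫) ⟫ ≡⟨ cong (λ w → ⟪ S w , (λ u → ⟪ mulF u [] , g ⟫) ⟫) (st-idem V) ⟩
      ⟪ S v , (λ u → ⟪ mulF u [] , g ⟫) ⟫ ≡⟨ ∑-cong′ (S v) (λ t → cong (proj₁ t Q.*_) (pairing-mulF-[] (proj₂ t) g)) ⟩
      ⟪ S v , g ⟫ ∎

  -- The split point p becomes the last cut of a nonempty subset, and the prefix is covered by
  -- induction at the functional `g′`; hence `g` stays general. The empty subset comes from p = 0.
  -- The bound `k` makes the recursion structural.
  antipode-takeuchi : ∀ k n v → n ≤ k → 1 ≤ n → IsPerm n v → ∀ g → ⟪ S v , g ⟫ ≡ takeuchi n v g
  antipode-takeuchi (suc k) (suc m) v (s≤s m≤k) _ V g = begin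
    ⟪ S v , g ⟫ ≡⟨ antipode-recursion V g ⟩
    - (⟪ mulF [] v , g ⟫ Q.+ ∑ (range m) (λ p → ⟪ S (st (take p v)) , (λ u → ⟪ mulF u (st (drop p v)) , g ⟫) ⟫))
      ≡⟨ Qₚ.neg-distrib-+ ⟪ mulF [] v , g ⟫ _ ⟩
    - ⟪ mulF [] v , g ⟫ Q.+ - ∑ (range m) (λ p → ⟪ S (st (take p v)) , (λ u → ⟪ mulF u (st (drop p v)) , g ⟫) ⟫)
      ≡⟨ cong₂ Q._+_ empty (trans (∑-neg (range m) _) (∑-cong (range m) step)) ⟩
    f [] Q.+ ∑ (range m) (λ p → ∑ (sublists (range (p ∸ 1))) (λ R → f (R ++ p ∷ [])))
      ≡⟨ sym (∑-sublists-range m f) ⟩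
    takeuchi (suc m) v g ∎
    where
    open ≡-Reasoning
    f : List ℕ → ℚ
    f R = signQ (suc (length R)) Q.* blockSum (suc m) R v g
    neg-one : ∀ x → - x ≡ (- 1ℚ) Q.* x
    neg-one x = trans (cong -_ (sym (Qₚ.*-identityˡ x))) (Qₚ.neg-distribˡ-* 1ℚ x)
    empty : - ⟪ mulF [] v , g ⟫ ≡ f []
    empty = trans (neg-one _) (cong ((- 1ℚ) Q.*_) (trans (pairing-mulF {0} {suc m} {[]} {v} refl (perm-length V) g)
      (∑-cong (perms (suc m)) λ θ θ∈ → cong₂ (λ b w → 𝟙 b Q.* g (comp w (inverse θ))) (subB-0 θ (proj₁ (∈-perms (suc m) θ) θ∈))
        (trans (cross-[] v) (sym (restrictS-[] V))))))
      where
      -- Shuffles of the empty word with `v` may descend only at 0, which is no position of a word,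
      -- so this is the same as having no descents.
      subB-0 : ∀ θ → IsPerm (suc m) θ → subB (Des θ) (0 ∷ []) ≡ subB (Des θ) []
      subB-0 θ T = bool-ext
        ((λ e → proj₂ (subB-Des θ (perm-length T) []) λ i a b lt → ⊥-elim
            (≢0 a (proj₁ (subB-Des θ (perm-length T) (0 ∷ [])) e i a b lt))) ,
         (λ e → proj₂ (subB-Des θ (perm-length T) (0 ∷ [])) λ i a b lt → there (proj₁ (subB-Des θ (perm-length T) []) e i a b lt)))
        where
        ≢0 : ∀ {i} → 1 ≤ i → i ∉ (0 ∷ [])
        ≢0 () (here refl)
    step : ∀ p → p ∈ range m → - ⟪ S (st (take p v)) , (λ u → ⟪ mulF u (st (drop p v)) , g ⟫) ⟫
      ≡ ∑ (sublists (range (p ∸ 1))) (λ R → f (R ++ p ∷ []))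
    step p p∈ = begin
      - ⟪ S (st (take p v)) , g′ ⟫
        ≡⟨ cong -_ (antipode-takeuchi k p _ (≤-trans p≤m m≤k) 1≤p (st-take-perm {p} {q} V′) g′) ⟩
      - ∑ (sublists (range (p ∸ 1))) (λ R → signQ (suc (length R)) Q.* blockSum p R (st (take p v)) g′)
        ≡⟨ ∑-neg (sublists (range (p ∸ 1))) _ ⟩
      ∑ (sublists (range (p ∸ 1))) (λ R → - (signQ (suc (length R)) Q.* blockSum p R (st (take p v)) g′))
        ≡⟨ ∑-cong (sublists (range (p ∸ 1))) (λ R R∈ → trans (Qₚ.neg-distribˡ-* (signQ (suc (length R))) _)
             (cong₂ Q._*_ (cong signQ (cong suc (sym (length-∷ʳ R)))) (trans (blockSum-∷ʳ {p} {q} V′ (R<p R R∈) g)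
                 (cong (λ n → blockSum n (R ++ p ∷ []) v g) p+q)))) ⟩
      ∑ (sublists (range (p ∸ 1))) (λ R → f (R ++ p ∷ [])) ∎
      where
      1≤p = proj₁ (proj₁ (∈-range m p) p∈)
      p≤m = proj₂ (proj₁ (∈-range m p) p∈)
      q = suc m ∸ p
      p+q : p + q ≡ suc m
      p+q = m+[n∸m]≡n (≤-trans p≤m (n≤1+n m))
      V′ : IsPerm (p + q) v
      V′ = subst (λ n → IsPerm n v) (sym p+q) V
      g′ : List ℕ → ℚ
      g′ u = ⟪ mulF u (st (drop p v)) , g ⟫
      length-∷ʳ : ∀ R → length (R ++ p ∷ []) ≡ suc (length R)
      length-∷ʳ R = trans (length-++ R) (+-comm (length R) 1)
      R<p : ∀ R → R ∈ sublists (range (p ∸ 1)) → ∀ a → a ∈ R → a < p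
      R<p R R∈ a a∈ = ≤-trans (s≤s (proj₂ (proj₁ (∈-range (p ∸ 1) a) (∈-sublists-⊆ _ R R∈ a a∈)))) (≤-reflexive (m+[n∸m]≡n 1≤p))

-- Subsets of [n-1] as sublists

filterB∈sublists : ∀ (χ : ℕ → Bool) xs → filterB χ xs ∈ sublists xs
filterB∈sublists χ [] = here refl
filterB∈sublists χ (x ∷ xs) with χ x
... | true = ∈-++⁺ˡ (∈-map⁺ (x ∷_) (filterB∈sublists χ xs))
... | false = ∈-++⁺ʳ (map (x ∷_) (sublists xs)) (filterB∈sublists χ xs)

filterB∈sublists-filterB : ∀ (χ χ′ : ℕ → Bool) xs → (∀ x → x ∈ xs → χ′ x ≡ true → χ x ≡ true) → filterB χ′ xs ∈ sublists (filterB χ xs)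
filterB∈sublists-filterB χ χ′ [] h = here refl
filterB∈sublists-filterB χ χ′ (x ∷ xs) h with χ x | χ′ x | h x (here refl)
... | true | true | _ = ∈-++⁺ˡ (∈-map⁺ (x ∷_) (filterB∈sublists-filterB χ χ′ xs (λ y y∈ → h y (there y∈))))
... | true | false | _ = ∈-++⁺ʳ (map (x ∷_) (sublists (filterB χ xs))) (filterB∈sublists-filterB χ χ′ xs (λ y y∈ → h y (there y∈)))
... | false | false | _ = filterB∈sublists-filterB χ χ′ xs (λ y y∈ → h y (there y∈))
... | false | true | k with k refl
... | ()

-- A canonical form: the sublist is recovered from its membership test. Subsets with the same
-- members are therefore equal as lists, and `toggle` can be defined by a test.
sublist-filterB : ∀ xs → Unique xs → ∀ S → S ∈ sublists xs → S ≡ filterB (λ i → memB i S) xs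
sublist-filterB [] u S (here refl) = refl
sublist-filterB (x ∷ xs) u S h with ∈-++⁻ (map (x ∷_) (sublists xs)) h
... | inj₁ k with ∈-map⁻ (x ∷_) k
... | S′ , S′∈ , refl rewrite proj₂ (≡ᵇ-true x x) refl = cong (x ∷_)
  (trans (sublist-filterB xs (Unique-tail u) S′ S′∈) (filterB-cong xs λ y y∈ → sym (memB-∷ y (λ { refl → Unique-head u y∈ }))))
  where
  memB-∷ : ∀ y → y ≢ x → memB y (x ∷ S′) ≡ memB y S′
  memB-∷ y ne rewrite ≢true⇒≡false {y ≡ᵇ x} (ne ∘ proj₁ (≡ᵇ-true y x)) = refl
sublist-filterB (x ∷ xs) u S h | inj₂ k
  rewrite ≢true⇒≡false {memB x S} (λ e → Unique-head u (∈-sublists-⊆ xs S k x (proj₁ (memB-true x S) e))) =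
  sublist-filterB xs (Unique-tail u) S k

sublist-ext : ∀ xs → Unique xs → ∀ S S′ → S ∈ sublists xs → S′ ∈ sublists xs →
  (∀ i → i ∈ xs → i ∈ S ↔ i ∈ S′) → S ≡ S′
sublist-ext xs u S S′ h h′ e = trans (sublist-filterB xs u S h) (trans
  (filterB-cong xs λ i i∈ → bool-ext
    ((proj₂ (memB-true i S′) ∘ proj₁ (e i i∈) ∘ proj₁ (memB-true i S)) , (proj₂ (memB-true i S) ∘ proj₂ (e i i∈) ∘ proj₁
        (memB-true i S′))))
  (sym (sublist-filterB xs u S′ h′)))

Unique-sublists : ∀ xs → Unique xs → Unique (sublists xs)
Unique-sublists [] u = [] ∷ []
Unique-sublists (x ∷ xs) u = ++⁺
  (Unique-map (x ∷_) (sublists xs) (Unique-sublists xs (Unique-tail u)) λ { a .a _ _ refl → refl })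
  (Unique-sublists xs (Unique-tail u))
  λ { (p , q) → disjoint p q }
  where
  disjoint : ∀ {S} → S ∈ map (x ∷_) (sublists xs) → S ∈ sublists xs → ⊥
  disjoint {S} p q with ∈-map⁻ (x ∷_) p
  ... | S′ , _ , refl = Unique-head u (∈-sublists-⊆ xs (x ∷ S′) q x (here refl))

sublist-⊇⇒≡ : ∀ S → Unique S → ∀ R → R ∈ sublists S → (∀ i → i ∈ S → i ∈ R) → R ≡ S
sublist-⊇⇒≡ S u R h sup = trans (sublist-filterB S u R h) (all-filterB S λ i i∈ → proj₂ (memB-true i R) (sup i i∈))
  where
  all-filterB : ∀ {χ : ℕ → Bool} xs → (∀ i → i ∈ xs → χ i ≡ true) → filterB χ xs ≡ xs
  all-filterB [] _ = refl
  all-filterB (x ∷ xs) h rewrite h x (here refl) = cong (x ∷_) (all-filterB xs (λ i i∈ → h i (there i∈)))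

signQ-flip : ∀ (χ χ′ : ℕ → Bool) p xs → p ∈ xs → Unique xs → χ′ p ≡ not (χ p) →
  (∀ i → i ∈ xs → i ≢ p → χ′ i ≡ χ i) → signQ (length (filterB χ′ xs)) ≡ - signQ (length (filterB χ xs))
signQ-flip χ χ′ p (.p ∷ xs) (here refl) u e h
  rewrite e | filterB-cong {p = χ′} {q = χ} xs (λ i i∈ → h i (there i∈) (λ { refl → Unique-head u i∈ })) with χ p
... | true = sym (neg-involutive _)
... | false = refl
signQ-flip χ χ′ p (x ∷ xs) (there p∈) u e h
  rewrite h x (here refl) (λ { refl → Unique-head u p∈ }) with χ x
... | true = cong -_ (signQ-flip χ χ′ p xs p∈ (Unique-tail u) e (λ i i∈ → h i (there i∈)))
... | false = signQ-flip χ χ′ p xs p∈ (Unique-tail u) e (λ i i∈ → h i (there i∈))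

-- Toggling one position of a subset

toggled : ℕ → List ℕ → ℕ → Bool
toggled p S i = if i ≡ᵇ p then not (memB i S) else memB i S

toggled-≢ : ∀ p S i → i ≢ p → toggled p S i ≡ memB i S
toggled-≢ p S i ne rewrite ≢true⇒≡false {i ≡ᵇ p} (ne ∘ proj₁ (≡ᵇ-true i p)) = refl

toggled-≡ : ∀ p S → toggled p S p ≡ not (memB p S)
toggled-≡ p S rewrite proj₂ (≡ᵇ-true p p) refl = refl

module Toggle (k : ℕ) where

  N : List ℕ
  N = range k

  Sub : List ℕ → Set
  Sub S = S ∈ sublists N

  toggle : ℕ → List ℕ → List ℕ
  toggle p S = filterB (toggled p S) N

  toggle-Sub : ∀ p S → Sub (toggle p S)
  toggle-Sub p S = filterB∈sublists (toggled p S) N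

  Sub⇒∈N : ∀ {S} → Sub S → ∀ i → i ∈ S → i ∈ N
  Sub⇒∈N {S} h = ∈-sublists-⊆ N S h

  toggle-≢ : ∀ p S → Sub S → ∀ i → i ≢ p → i ∈ toggle p S ↔ i ∈ S
  toggle-≢ p S h i ne =
    (λ q → proj₁ (memB-true i S) (trans (sym (toggled-≢ p S i ne)) (proj₂ (proj₁ (∈-filterB (toggled p S) N i) q)))) ,
    (λ q → proj₂ (∈-filterB (toggled p S) N i) (Sub⇒∈N h i q , trans (toggled-≢ p S i ne) (proj₂ (memB-true i S) q)))

  toggle-∉ : ∀ p S → p ∈ toggle p S → p ∉ S
  toggle-∉ p S q p∈ = not-false (trans (sym (toggled-≡ p S)) (proj₂ (proj₁ (∈-filterB (toggled p S) N p) q))) (proj₂ (memB-true p S) p∈)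

  toggle-∈ : ∀ p S → p ∈ N → p ∉ S → p ∈ toggle p S
  toggle-∈ p S pN p∉ = proj₂ (∈-filterB (toggled p S) N p) (pN , trans (toggled-≡ p S) (not-true (p∉ ∘ proj₁ (memB-true p S))))

  Sub-ext : ∀ {S S′} → Sub S → Sub S′ → (∀ i → i ∈ N → i ∈ S ↔ i ∈ S′) → S ≡ S′
  Sub-ext {S} {S′} = sublist-ext N (Unique-range k) S S′

  toggle-involutive : ∀ p S → Sub S → toggle p (toggle p S) ≡ S
  toggle-involutive p S h = Sub-ext (toggle-Sub p (toggle p S)) h same
    where
    same : ∀ i → i ∈ N → i ∈ toggle p (toggle p S) ↔ i ∈ S
    same i iN with i ≟ p
    ... | no ne = (proj₁ (toggle-≢ p S h i ne) ∘ proj₁ (toggle-≢ p _ (toggle-Sub p S) i ne)) ,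
                  (proj₂ (toggle-≢ p _ (toggle-Sub p S) i ne) ∘ proj₂ (toggle-≢ p S h i ne))
    ... | yes refl = to , (λ i∈ → toggle-∈ p _ iN (λ q → toggle-∉ p S q i∈))
      where
      to : i ∈ toggle p (toggle p S) → i ∈ S
      to q with mem? p S
      ... | inj₁ r = r
      ... | inj₂ r = ⊥-elim (toggle-∉ p (toggle p S) q (toggle-∈ p S iN r))

  toggle-comm : ∀ p q S → Sub S → p ≢ q → toggle p (toggle q S) ≡ toggle q (toggle p S)
  toggle-comm p q S h p≢q = Sub-ext (toggle-Sub p (toggle q S)) (toggle-Sub q (toggle p S)) λ i iN →
    both p q p≢q i iN , both q p (p≢q ∘ sym) i iN
    where
    both : ∀ p q → p ≢ q → ∀ i → i ∈ N → i ∈ toggle p (toggle q S) → i ∈ toggle q (toggle p S)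
    both p q p≢q i iN r with i ≟ p | i ≟ q
    ... | yes refl | yes refl = ⊥-elim (p≢q refl)
    ... | yes refl | no ne = proj₂ (toggle-≢ q _ (toggle-Sub p S) i ne)
      (toggle-∈ p S iN (toggle-∉ p _ r ∘ proj₂ (toggle-≢ q S h i ne)))
    ... | no ne | yes refl = toggle-∈ q _ iN
      (toggle-∉ q S (proj₁ (toggle-≢ p _ (toggle-Sub q S) i ne) r) ∘ proj₁ (toggle-≢ p S h i ne))
    ... | no ne | no ne′ = proj₂ (toggle-≢ q _ (toggle-Sub p S) i ne′) (proj₂ (toggle-≢ p S h i ne)
      (proj₁ (toggle-≢ q S h i ne′) (proj₁ (toggle-≢ p _ (toggle-Sub q S) i ne) r)))

  signQ-toggle : ∀ p S → Sub S → p ∈ N → signQ (length (toggle p S)) ≡ - signQ (length S)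
  signQ-toggle p S h pN = trans (signQ-flip (λ i → memB i S) (toggled p S) p N pN (Unique-range k) (toggled-≡ p S)
      (λ i _ → toggled-≢ p S i))
    (cong (λ R → - signQ (length R)) (sym (sublist-filterB N (Unique-range k) S h)))

-- Global descents

GDesCond : List ℕ → ℕ → Bool
GDesCond u p = allB (λ a → allB (λ b → b <ᵇ a) (drop p u)) (take p u)

GDes-Sub : ∀ {n v} → IsPerm n v → GDes v ∈ sublists (range (n ∸ 1))
GDes-Sub {n} {v} V = subst (λ ℓ → GDes v ∈ sublists (range (ℓ ∸ 1))) (perm-length V) (filterB∈sublists (GDesCond v)
    (range (length v ∸ 1)))

∈-GDes : ∀ {n v} → IsPerm n v → ∀ p → p ∈ range (n ∸ 1) →
  p ∈ GDes v ↔ (∀ i j → 1 ≤ i → i ≤ p → p < j → j ≤ n → at v j < at v i)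
∈-GDes {n} {v} V p pN = to , from
  where
  p<n : p ≤ n
  p<n = ≤-trans (proj₂ (proj₁ (∈-range (n ∸ 1) p) pN)) (m∸n≤m n 1)
  ℓv = perm-length V
  ℓt : length (take p v) ≡ p
  ℓt = trans (length-take p v) (m≤n⇒m⊓n≡m (subst (p ≤_) (sym ℓv) p<n))
  ℓd : length (drop p v) ≡ n ∸ p
  ℓd = trans (length-drop p v) (cong (_∸ p) ℓv)
  to : p ∈ GDes v → ∀ i j → 1 ≤ i → i ≤ p → p < j → j ≤ n → at v j < at v i
  to h i j a b c d with split-pos p j
  ... | inj₁ j≤p = ⊥-elim (<⇒≱ c j≤p)
  ... | inj₂ (j′ , refl) = subst₂ _<_ (at-drop p v j′) (at-take p v i b)
    (proj₁ (<ᵇ-true _ _) (proj₁ (allB-true _ (drop p v))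
      (proj₁ (allB-true _ (take p v)) (proj₂ (proj₁ (∈-filterB (GDesCond v) (range (length v ∸ 1)) p) h))
        (at (take p v) i) (at-∈ (take p v) i (a , subst (i ≤_) (sym ℓt) b)))
      (at (drop p v) (suc j′)) (at-∈ (drop p v) (suc j′) (s≤s z≤n , subst (suc j′ ≤_) (sym ℓd) (m+n≤o⇒n≤o∸m p d)))))
    where
    m+n≤o⇒n≤o∸m : ∀ m {n o} → m + n ≤ o → n ≤ o ∸ m
    m+n≤o⇒n≤o∸m m {n} h = subst (_≤ _) (m+n∸m≡n m n) (∸-monoˡ-≤ m h)
  from : (∀ i j → 1 ≤ i → i ≤ p → p < j → j ≤ n → at v j < at v i) → p ∈ GDes v
  from h = proj₂ (∈-filterB (GDesCond v) (range (length v ∸ 1)) p)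
    (subst (λ ℓ → p ∈ range (ℓ ∸ 1)) (sym ℓv) pN ,
     proj₂ (allB-true _ (take p v)) λ a a∈ → proj₂ (allB-true _ (drop p v)) λ b b∈ → <⇒ᵇ (cmp a b (∈-at (take p v) a a∈)
         (∈-at (drop p v) b b∈)))
    where
    cmp : ∀ a b → ∃[ i ] (Idx (length (take p v)) i × at (take p v) i ≡ a) → ∃[ j ] (Idx (length (drop p v)) j × at (drop p v) j
        ≡ b) → b < a
    cmp a b (i , (1≤i , i≤) , refl) (suc j , (_ , j≤) , refl) = subst₂ _<_ (sym (at-drop p v j)) (sym (at-take p v i i≤p))
      (h i (p + suc j) 1≤i i≤p (m<m+n p (s≤s z≤n))
        (≤-trans (+-monoʳ-≤ p (subst (suc j ≤_) ℓd j≤)) (≤-reflexive (m+[n∸m]≡n p<n))))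
      where
      i≤p = subst (i ≤_) ℓt i≤
    cmp a b _ (zero , (() , _) , _)

-- Free positions of a subset

-- The default 0 lies outside `range k`, so toggling at it leaves a subset unchanged; `flip-none`
-- depends on this.
findB : (ℕ → Bool) → List ℕ → ℕ
findB f [] = 0
findB f (x ∷ xs) = if f x then x else findB f xs

findB-cong : ∀ {f g} xs → (∀ x → x ∈ xs → f x ≡ g x) → findB f xs ≡ findB g xs
findB-cong [] h = refl
findB-cong {f} {g} (x ∷ xs) h rewrite h x (here refl) | findB-cong {f} {g} xs (λ y y∈ → h y (there y∈)) = refl

findB-found : ∀ f xs → anyB f xs ≡ true → findB f xs ∈ xs × f (findB f xs) ≡ true
findB-found f (x ∷ xs) h with f x in eq
... | true = here refl , eq
... | false = let a , b = findB-found f xs h in there a , b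

findB-none : ∀ f xs → anyB f xs ≢ true → findB f xs ≡ 0
findB-none f [] h = refl
findB-none f (x ∷ xs) h with f x
... | true = ⊥-elim (h refl)
... | false = findB-none f xs h

anyB-cong : ∀ {f g : ℕ → Bool} xs → (∀ x → x ∈ xs → f x ≡ g x) → anyB f xs ≡ anyB g xs
anyB-cong [] h = refl
anyB-cong (x ∷ xs) h = cong₂ _∨_ (h x (here refl)) (anyB-cong xs (λ y y∈ → h y (there y∈)))

module Free {n : ℕ} {x : List ℕ} (X : IsPerm n x) (T : List ℕ) where

  open Toggle (n ∸ 1) public

  m : List ℕ → List ℕ
  m S = top n S x

  -- A descent of `x` is an inversion of `m S` whatever `S` is, so only at the ascents of `x` does
  -- `m S` reveal which pairs are separated.
  top-sep : ∀ {S S′} → m S ≡ m S′ → ∀ i j → 1 ≤ i → i < j → j ≤ n → at x i < at x j → Sep S i j → Sep S′ i j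
  top-sep {S} {S′} e i j a b c lt s with proj₁ (top-inv X S′ i j a b c) (subst (λ w → at w j < at w i) e
      (proj₂ (top-inv X S i j a b c) (inj₁ s)))
  ... | inj₁ r = r
  ... | inj₂ r = ⊥-elim (<-asym lt r)

  top-ext : ∀ S S′ → (∀ i j → 1 ≤ i → i < j → j ≤ n → at x i < at x j → Sep S i j ↔ Sep S′ i j) → m S ≡ m S′
  top-ext S S′ h = perm-ext (top-perm X S) (top-perm X S′)
    (λ i j a b c → proj₂ (top-inv X S′ i j a b c) ∘ move S S′ i j a b c (proj₁ ∘ h i j a b c) ∘ proj₁ (top-inv X S i j a b c))
    (λ i j a b c → proj₂ (top-inv X S i j a b c) ∘ move S′ S i j a b c (proj₂ ∘ h i j a b c) ∘ proj₁ (top-inv X S′ i j a b c))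
    where
    move : ∀ S S′ i j → 1 ≤ i → i < j → j ≤ n → (at x i < at x j → Sep S i j → Sep S′ i j) →
      Sep S i j ⊎ at x j < at x i → Sep S′ i j ⊎ at x j < at x i
    move S S′ i j a b c f (inj₂ r) = inj₂ r
    move S S′ i j a b c f (inj₁ s) with <-cmp (at x i) (at x j)
    ... | tri< r _ _ = inj₁ (f r s)
    ... | tri≈ _ e _ = ⊥-elim (<⇒≢ b (perm-inj X i j (Idxˡ a b c) (Idxʳ a b c) e))
    ... | tri> _ _ r = inj₂ r

  -- One of `S` and `toggle p S` lacks `p`, yet it has to separate the same ascents of `x`, so it
  -- contains another cut between i and j. Away from `p` the two sets agree.
  another-separator : ∀ {S p} → Sub S → p ∈ N → m (toggle p S) ≡ m S → ∀ i j → 1 ≤ i → i ≤ p → p < j → j ≤ n →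
    at x i < at x j → ∃[ s ] (s ∈ S × s ≢ p × i ≤ s × s < j)
  another-separator {S} {p} h pN e i j a b c d lt with mem? p S
  ... | inj₁ p∈ = other (top-sep (sym e) i j a (≤-<-trans b c) d lt (p , p∈ , b , c))
    where
    other : Sep (toggle p S) i j → ∃[ s ] (s ∈ S × s ≢ p × i ≤ s × s < j)
    other (s , s∈ , r) = s , proj₁ (toggle-≢ p S h s s≢p) s∈ , s≢p , r
      where
      s≢p : s ≢ p
      s≢p refl = toggle-∉ p S s∈ p∈
  ... | inj₂ p∉ = other (top-sep e i j a (≤-<-trans b c) d lt (p , toggle-∈ p S pN p∉ , b , c))
    where
    other : Sep S i j → ∃[ s ] (s ∈ S × s ≢ p × i ≤ s × s < j)
    other (s , s∈ , r) = s , s∈ , (λ { refl → p∉ s∈ }) , r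

  -- An ascent i < j of x straddling p < q has an ascent straddling only one of them: compare both ends with position q.
  third-separator : ∀ {S p q} → Sub S → p ∈ N → q ∈ N → m (toggle p S) ≡ m S → m (toggle q S) ≡ m S → p < q →
    ∀ i j → 1 ≤ i → i ≤ p → q < j → j ≤ n → at x i < at x j → ∃[ s ] (s ∈ S × s ≢ p × s ≢ q × i ≤ s × s < j)
  third-separator {S} {p} {q} h pN qN ep eq p<q i j a b c d lt with at x q <? at x j
  ... | yes r with another-separator h qN eq q j (≤-trans a (≤-trans b (<⇒≤ p<q))) ≤-refl c d r
  ... | s , s∈ , s≢q , q≤s , s<j = s , s∈ , (λ { refl → <⇒≱ p<q q≤s }) , s≢q , ≤-trans b (≤-trans (<⇒≤ p<q) q≤s) , s<j
  -- Here x_i < x_j ≤ x_q, so i < q is an ascent crossing the cut p but not the cut q. The separator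
  -- found for it lies below q and so differs from both.
  third-separator {S} {p} {q} h pN qN ep eq p<q i j a b c d lt | no r
    with another-separator h pN ep i q a b p<q (≤-trans (<⇒≤ c) d) (<-≤-trans lt (≮⇒≥ r))
  ... | s , s∈ , s≢p , i≤s , s<q = s , s∈ , s≢p , (λ { refl → n≮n _ s<q }) , i≤s , <-trans s<q c

  -- An ascent of `x` that crosses at most one of the two cuts is unaffected by toggling the other,
  -- so freeness of the crossed cut is enough. An ascent crossing both keeps a third separator,
  -- which survives both toggles.
  top-toggle-toggle : ∀ {S p q} → Sub S → p ∈ N → q ∈ N → p ≢ q → m (toggle p S) ≡ m S → m (toggle q S) ≡ m S →
    m (toggle q (toggle p S)) ≡ m S
  top-toggle-toggle {S} {p} {q} h pN qN p≢q ep eq = top-ext D S same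
    where
    D = toggle q (toggle p S)
    outside : ∀ p R i j → Sub R → ¬ (i ≤ p × p < j) → Sep (toggle p R) i j ↔ Sep R i j
    outside p R i j hR out =
      (λ (s , s∈ , r) → s , proj₁ (toggle-≢ p R hR s (λ { refl → out r })) s∈ , r) ,
      (λ (s , s∈ , r) → s , proj₂ (toggle-≢ p R hR s (λ { refl → out r })) s∈ , r)
    drop-outer : ∀ p q → m (toggle q S) ≡ m S → ∀ i j → 1 ≤ i → i < j → j ≤ n → at x i < at x j →
      ¬ (i ≤ p × p < j) → Sep (toggle p (toggle q S)) i j ↔ Sep S i j
    drop-outer p q eq i j a b c lt out =
      (top-sep eq i j a b c lt ∘ proj₁ O) , (proj₂ O ∘ top-sep (sym eq) i j a b c lt)
      where
      O = outside p (toggle q S) i j (toggle-Sub q S) out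
    drop-p : ∀ i j → 1 ≤ i → i < j → j ≤ n → at x i < at x j → ¬ (i ≤ p × p < j) → Sep D i j ↔ Sep S i j
    drop-p i j a b c lt out = subst (λ E → Sep E i j ↔ Sep S i j) (toggle-comm p q S h p≢q) (drop-outer p q eq i j a b c lt out)
    same : ∀ i j → 1 ≤ i → i < j → j ≤ n → at x i < at x j → Sep D i j ↔ Sep S i j
    same i j a b c lt with i ≤? p | p <? j
    ... | no np | _ = drop-p i j a b c lt (np ∘ proj₁)
    ... | yes _ | no np = drop-p i j a b c lt (np ∘ proj₂)
    ... | yes i≤p | yes p<j with i ≤? q | q <? j
    ... | no nq | _ = drop-outer q p ep i j a b c lt (nq ∘ proj₁)
    ... | yes _ | no nq = drop-outer q p ep i j a b c lt (nq ∘ proj₂)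
    ... | yes i≤q | yes q<j = (λ _ → s , s∈ , r) , (λ _ → s ,
        proj₂ (toggle-≢ q _ (toggle-Sub p S) s s≢q) (proj₂ (toggle-≢ p S h s s≢p) s∈) , r)
      where
      third : ∃[ s ] (s ∈ S × s ≢ p × s ≢ q × i ≤ s × s < j)
      third with <-cmp p q
      ... | tri< p<q _ _ = third-separator h pN qN ep eq p<q i j a i≤p q<j c lt
      ... | tri≈ _ e _ = ⊥-elim (p≢q e)
      ... | tri> _ _ q<p with third-separator h qN pN eq ep q<p i j a i≤q p<j c lt
      ... | s , s∈ , s≢q , s≢p , r = s , s∈ , s≢p , s≢q , r
      s = proj₁ third
      s∈ = proj₁ (proj₂ third)
      s≢p = proj₁ (proj₂ (proj₂ third))
      s≢q = proj₁ (proj₂ (proj₂ (proj₂ third)))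
      r = proj₂ (proj₂ (proj₂ (proj₂ third)))

  free : List ℕ → ℕ → Bool
  free S p = not (memB p T) ∧ eqW (m (toggle p S)) (m S)

  free-true : ∀ S p → free S p ≡ true ↔ (p ∉ T × m (toggle p S) ≡ m S)
  free-true S p =
    (λ e → (λ p∈ → not-false (proj₁ (∧-elim e)) (proj₂ (memB-true p T) p∈)) , proj₁ (eqW-true (m (toggle p S)) (m S))
        (proj₂ (∧-elim {not (memB p T)} e))) ,
    (λ (p∉ , e) → ∧-intro (not-true (p∉ ∘ proj₁ (memB-true p T))) (proj₂ (eqW-true (m (toggle p S)) (m S)) e))

  anyFree : List ℕ → Bool
  anyFree S = anyB (free S) N

  -- That free positions stay free is `top-toggle-toggle`. Applied again to the toggled set, where
  -- `p` is still free, it gives the converse, because toggling twice is the identity.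
  free-toggle : ∀ {S p} → Sub S → p ∈ N → free S p ≡ true → ∀ q → q ∈ N → free (toggle p S) q ≡ free S q
  free-toggle {S} {p} h pN fp q qN = bool-ext (backward , forward h fp q qN)
    where
    forward : ∀ {S} → Sub S → free S p ≡ true → ∀ q → q ∈ N → free S q ≡ true → free (toggle p S) q ≡ true
    forward {S} h fp q qN fq with q ≟ p
    ... | yes refl = proj₂ (free-true (toggle q S) q)
      (proj₁ (proj₁ (free-true S q) fq) , trans (cong m (toggle-involutive q S h)) (sym (proj₂ (proj₁ (free-true S q) fq))))
    ... | no q≢p = proj₂ (free-true (toggle p S) q)
      (proj₁ (proj₁ (free-true S q) fq) ,
       trans (top-toggle-toggle h pN qN (q≢p ∘ sym) (proj₂ (proj₁ (free-true S p) fp)) (proj₂ (proj₁ (free-true S q) fq)))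
         (sym (proj₂ (proj₁ (free-true S p) fp))))
    backward : free (toggle p S) q ≡ true → free S q ≡ true
    backward fq = subst (λ R → free R q ≡ true) (toggle-involutive p S h)
      (forward (toggle-Sub p S) (forward h fp p pN fp) q qN fq)

  first : List ℕ → ℕ
  first S = findB (free S) N

  -- Toggles the least free position. That choice depends only on the set of free positions, which
  -- the toggle preserves, so `flip` undoes itself.
  flip : List ℕ → List ℕ
  flip S = toggle (first S) S

  flip-none : ∀ S → Sub S → anyFree S ≢ true → flip S ≡ S
  flip-none S h ne = Sub-ext (toggle-Sub (first S) S) h λ i iN → toggle-≢ (first S) S h i
    λ { refl → n≮0 (subst (1 ≤_) (findB-none (free S) N ne) (proj₁ (proj₁ (∈-range (n ∸ 1) _) iN))) }

  flip-first : ∀ S → Sub S → first (flip S) ≡ first S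
  flip-first S h with bool? (anyFree S)
  ... | inj₁ e = findB-cong N (free-toggle h (proj₁ found) (proj₂ found))
    where
    found = findB-found (free S) N e
  ... | inj₂ e = cong first (flip-none S h e)

  flip-involutive : ∀ S → Sub S → flip (flip S) ≡ S
  flip-involutive S h = trans (cong (λ p → toggle p (flip S)) (flip-first S h)) (toggle-involutive (first S) S h)

  flip-↭ : map flip (sublists N) ↭ sublists N
  flip-↭ = unique-⊆-length⇒↭ (map flip (sublists N)) (sublists N)
    (Unique-map flip (sublists N) (Unique-sublists N (Unique-range (n ∸ 1)))
      λ S S′ h h′ e → trans (sym (flip-involutive S h)) (trans (cong flip e) (flip-involutive S′ h′)))
    (λ R R∈ → let S , _ , e = ∈-map⁻ flip R∈ in subst Sub (sym e) (toggle-Sub (first S) S))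
    (length-map flip (sublists N))

  -- Flipping changes the parity of `S` but not `m S`, and not whether `S` contains `T`, since a
  -- free position lies outside `T`. The reindexed sum is thus its own negative; subsets without
  -- free positions contribute 0.
  ∑-free-cancel : (g : List ℕ → ℚ) →
    ∑ (sublists N) (λ S → signQ (suc (length S)) Q.* (𝟙 (subB T S) Q.* (𝟙 (anyFree S) Q.* g (m S)))) ≡ 0ℚ
  ∑-free-cancel g = self-neg⇒0 (∑ (sublists N) f) (begin
    ∑ (sublists N) f ≡⟨ sym (∑-↭ flip-↭ f) ⟩
    ∑ (map flip (sublists N)) f ≡⟨ ∑-map flip (sublists N) f ⟩
    ∑ (sublists N) (λ S → f (flip S)) ≡⟨ ∑-cong (sublists N) negate ⟩
    ∑ (sublists N) (λ S → - f S) ≡⟨ sym (∑-neg (sublists N) f) ⟩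
    - ∑ (sublists N) f ∎)
    where
    open ≡-Reasoning
    f : List ℕ → ℚ
    f S = signQ (suc (length S)) Q.* (𝟙 (subB T S) Q.* (𝟙 (anyFree S) Q.* g (m S)))
    vanish : ∀ S → anyFree S ≢ true → f S ≡ 0ℚ
    vanish S ne = trans (cong (λ z → signQ (suc (length S)) Q.* (𝟙 (subB T S) Q.* z)) (𝟙-false ne (g (m S))))
      (trans (cong (signQ (suc (length S)) Q.*_) (Qₚ.*-zeroʳ (𝟙 (subB T S)))) (Qₚ.*-zeroʳ (signQ (suc (length S)))))
    negate : ∀ S → S ∈ sublists N → f (flip S) ≡ - f S
    negate S h with bool? (anyFree S)
    ... | inj₂ ne = trans (cong f (flip-none S h ne)) (trans (vanish S ne) (cong -_ (sym (vanish S ne))))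
    ... | inj₁ e = begin
      f (flip S)
        ≡⟨ cong₂ (λ a b → - a Q.* (𝟙 b Q.* (𝟙 (anyFree (flip S)) Q.* g (m (flip S))))) (signQ-toggle p S h pN) sub≡ ⟩
      - (- signQ (length S)) Q.* (𝟙 (subB T S) Q.* (𝟙 (anyFree (flip S)) Q.* g (m (flip S))))
        ≡⟨ cong₂ (λ a b → - (- signQ (length S)) Q.* (𝟙 (subB T S) Q.* (𝟙 a Q.* g b)))
             (anyB-cong N (free-toggle h pN fp)) (proj₂ (proj₁ (free-true S p) fp)) ⟩
      - (- signQ (length S)) Q.* (𝟙 (subB T S) Q.* (𝟙 (anyFree S) Q.* g (m S)))
        ≡⟨ sym (Qₚ.neg-distribˡ-* (- signQ (length S)) _) ⟩
      - f S ∎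
      where
      p = first S
      pN = proj₁ (findB-found (free S) N e)
      fp = proj₂ (findB-found (free S) N e)
      p∉T = proj₁ (proj₁ (free-true S p) fp)
      sub≡ : subB T (flip S) ≡ subB T S
      sub≡ = bool-ext
        ((λ k → proj₂ (subB-true T S) λ t t∈ → proj₁ (toggle-≢ p S h t (λ { refl → p∉T t∈ })) (proj₁ (subB-true T (flip S)) k t t∈)) ,
         (λ k → proj₂ (subB-true T (flip S)) λ t t∈ → proj₂ (toggle-≢ p S h t (λ { refl → p∉T t∈ })) (proj₁ (subB-true T S) k t t∈)))

-- The condition defining κ, for a fixed ζ

maximalAgainst : List ℕ → List ℕ → List ℕ → List ℕ → List ℕ → Bool
maximalAgainst S v w ζ v′ = if weakLe v v′ ∧ weakLe (comp (restrictS S v′) (inverse ζ)) w then eqW v′ v else true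

minimalAgainst : List ℕ → List ℕ → List ℕ → List ℕ → List ℕ → Bool
minimalAgainst S v w ζ R = if subB (Des ζ) R ∧ weakLe (comp (restrictS R v) (inverse ζ)) w then eqW R S else true

-- The conjunction inside `kappa` with the length and the set of cuts as parameters. For v = m_S it
-- can then be proved with the given `n` and `S`, which are afterwards replaced by `length (m S)`
-- and `GDes (m S)`.
condition : ℕ → List ℕ → List ℕ → List ℕ → List ℕ → Bool
condition n S v w ζ = subB (Des ζ) S ∧ weakLe (comp (restrictS S v) (inverse ζ)) w 
  ∧ allB (maximalAgainst S v w ζ) (perms n) ∧ allB (minimalAgainst S v w ζ) (sublists S)

kappaCond : List ℕ → List ℕ → List ℕ → Bool
kappaCond v w ζ = condition (length v) (GDes v) v w ζ

if-true : ∀ a b → (if a then b else true) ≡ true ↔ (a ≡ true → b ≡ true)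
if-true true b = (λ h _ → h) , (λ h → h refl)
if-true false b = (λ _ ()) , (λ _ → refl)

-- From the conditions of κ to subsets without free positions

module PerShuffle {n : ℕ} {w ζ : List ℕ} (W : IsPerm n w) (Z : IsPerm n ζ) where

  x : List ℕ
  x = comp w ζ

  X : IsPerm n x
  X = comp-perm W Z

  open Free X (Des ζ) public

  ok : Bool
  ok = weakLe (inverse ζ) w

  below : List ℕ → List ℕ → Bool
  below S v = weakLe (comp (restrictS S v) (inverse ζ)) w

  at-x : ∀ i → Idx n i → at x i ≡ at w (at ζ i)
  at-x = at-comp w ζ (perm-length Z)

  module _ {S v : List ℕ} (D : DesSub n ζ S) (V : IsPerm n v) where

    r : List ℕ
    r = restrictS S v

    at-r : ∀ a → Idx n a → at (comp r (inverse ζ)) a ≡ at r (at (inverse ζ) a)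
    at-r = at-comp r (inverse ζ) (inverse-length Z)

    at-r-ζ : ∀ i → Idx n i → at (comp r (inverse ζ)) (at ζ i) ≡ at r i
    at-r-ζ i I = trans (at-r (at ζ i) (perm-Idx Z i I)) (cong (at r) (at-inverseˡ Z i I))

    below-perm : IsPerm n (comp r (inverse ζ))
    below-perm = comp-perm (restrictS-perm V S) (inverse-perm Z)

    unseparated-increasing : ∀ i j → 1 ≤ i → i < j → j ≤ n → ¬ Sep S i j → at ζ i < at ζ j
    unseparated-increasing i j a b c ns = increasing Z S D i j a b c λ s p q s∈ → ns (s , s∈ , p , q)

    -- `ζ` increases within blocks, so an inversion of ζ⁻¹ comes from two positions in different
    -- blocks and is an inversion of v_S ζ⁻¹. The remaining inversions of v_S ζ⁻¹ are the images
    -- under `ζ` of the unseparated inversions of `v`; these lie in `w` exactly if the originals are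
    -- inversions of x = wζ.
    below⇒ : below S v ≡ true → ok ∧ weakLe v (m S) ≡ true
    below⇒ e = ∧-intro (proj₂ (weakLe-true (inverse-perm Z) W) okay) (proj₂ (weakLe-true V (top-perm X S)) v≤m)
      where
      sub : InvSub n (comp r (inverse ζ)) w
      sub = proj₁ (weakLe-true below-perm W) e
      okay : InvSub n (inverse ζ) w
      okay a b p q s h = sub a b p q s (subst₂ _<_ (sym (at-r b B)) (sym (at-r a A)) ri<rj)
        where
        A = Idxˡ p q s
        B = Idxʳ p q s
        i = at (inverse ζ) b
        j = at (inverse ζ) a
        I = inverse-Idx Z b B
        J = inverse-Idx Z a A
        ri<rj : at r i < at r j
        ri<rj = perm-≮⇒> (restrictS-perm V S) j i J I (λ k → <⇒≢ h (sym k)) λ k →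
          <-asym q (subst₂ _<_ (at-inverseʳ Z b B) (at-inverseʳ Z a A)
            (unseparated-increasing i j (proj₁ I) h (proj₂ J) (proj₁ (proj₁ (restrictS-inv V S i j (proj₁ I) h (proj₂ J)) k))))
      v≤m : InvSub n v (m S)
      v≤m i j p q s h with sep? S i j
      ... | inj₁ sp = proj₂ (top-inv X S i j p q s) (inj₁ sp)
      ... | inj₂ ns = proj₂ (top-inv X S i j p q s) (inj₂ (subst₂ _<_ (sym (at-x j J)) (sym (at-x i I))
        (sub (at ζ i) (at ζ j) (proj₁ (perm-Idx Z i I)) (unseparated-increasing i j p q s ns) (proj₂ (perm-Idx Z j J))
          (subst₂ _<_ (sym (at-r-ζ j J)) (sym (at-r-ζ i I)) (proj₂ (restrictS-inv V S i j p q s) (ns , h))))))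
        where
        I = Idxˡ p q s
        J = Idxʳ p q s

    below⇐ : ok ∧ weakLe v (m S) ≡ true → below S v ≡ true
    below⇐ e = proj₂ (weakLe-true below-perm W) sub
      where
      okay : InvSub n (inverse ζ) w
      okay = proj₁ (weakLe-true (inverse-perm Z) W) (proj₁ (∧-elim e))
      v≤m : InvSub n v (m S)
      v≤m = proj₁ (weakLe-true V (top-perm X S)) (proj₂ (∧-elim {ok} e))
      sub : InvSub n (comp r (inverse ζ)) w
      sub a b p q s h = compare (<-cmp i j)
        where
        A = Idxˡ p q s
        B = Idxʳ p q s
        i = at (inverse ζ) a
        j = at (inverse ζ) b
        I = inverse-Idx Z a A
        J = inverse-Idx Z b B
        rj<ri : at r j < at r i
        rj<ri = subst₂ _<_ (at-r b B) (at-r a A) h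
        at-x-inverse : ∀ c → Idx n c → at x (at (inverse ζ) c) ≡ at w c
        at-x-inverse c C = trans (at-x _ (inverse-Idx Z c C)) (cong (at w) (at-inverseʳ Z c C))
        -- An inversion of v_S ζ⁻¹ is either one of ζ⁻¹, or it comes from an unseparated inversion i
        -- < j of `v`. The latter is an inversion of `m S`, and without a separating cut it must be
        -- one of `x`.
        compare : _ → at w b < at w a
        compare (tri> _ _ j<i) = okay a b p q s j<i
        compare (tri≈ _ k _) = ⊥-elim (<⇒≢ rj<ri (cong (at r) (sym k)))
        compare (tri< i<j _ _) = [ (λ sp → ⊥-elim (proj₁ r-inv sp)) , subst₂ _<_ (at-x-inverse b B) (at-x-inverse a A) ]′
          (proj₁ (top-inv X S i j (proj₁ I) i<j (proj₂ J)) (v≤m i j (proj₁ I) i<j (proj₂ J) (proj₂ r-inv)))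
          where
          r-inv = proj₁ (restrictS-inv V S i j (proj₁ I) i<j (proj₂ J)) rj<ri

  below-≡ : ∀ {S v} → subB (Des ζ) S ≡ true → IsPerm n v → below S v ≡ ok ∧ weakLe v (m S)
  below-≡ {S} {v} e V = bool-ext (below⇒ D V , below⇐ D V)
    where
    D = proj₁ (subB-Des ζ (perm-length Z) S) e

  -- Selects the subsets whose terms remain after the cancellation, for this `ζ` and `w`.
  good : List ℕ → Bool
  good S = subB (Des ζ) S ∧ (ok ∧ not (anyFree S))

  GDes-separates : ∀ {v p} → IsPerm n v → p ∈ N → p ∈ GDes v → ∀ i j → 1 ≤ i → i ≤ p → p < j → j ≤ n → at v j < at v i
  GDes-separates {v} {p} V pN = proj₁ (∈-GDes V p pN)

  ∈⇒GDes-top : ∀ S p → p ∈ N → p ∈ S → p ∈ GDes (m S)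
  ∈⇒GDes-top S p pN p∈ = proj₂ (∈-GDes (top-perm X S) p pN) λ i j a b c d →
    proj₂ (top-inv X S i j a (≤-<-trans b c) d) (inj₁ (p , p∈ , b , c))

  -- Condition (ii), tested on `m S`, gives m S = v. A free `p` outside `S` is a cut of
  -- `toggle p S`, hence a global descent of m (toggle p S) = v, although `S` contains all of these.
  -- A free `p` in `S` contradicts (iii) for the set with `p` removed.
  kappa⇒good : ∀ {v} → IsPerm n v → kappaCond v w ζ ≡ true → good (GDes v) ∧ eqW (m (GDes v)) v ≡ true
  kappa⇒good {v} V e = ∧-intro (∧-intro T⊆S (∧-intro okay (not-true nofree))) (proj₂ (eqW-true (m S) v) m≡v)
    where
    S = GDes v
    hS : Sub S
    hS = GDes-Sub V
    e₂ = proj₂ (∧-elim {subB (Des ζ) S} e)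
    e₃ = proj₂ (∧-elim {below S v} e₂)
    T⊆S = proj₁ (∧-elim {subB (Des ζ) S} e)
    lower = trans (sym (below-≡ {S} {v} T⊆S V)) (proj₁ (∧-elim {below S v} e₂))
    okay = proj₁ (∧-elim {ok} lower)
    v≤m = proj₂ (∧-elim {ok} lower)
    maximal = proj₁ (allB-true (maximalAgainst S v w ζ) (perms (length v)))
        (proj₁ (∧-elim {allB (maximalAgainst S v w ζ) (perms (length v))} e₃))
    minimal = proj₁ (allB-true (minimalAgainst S v w ζ) (sublists S)) (proj₂ (∧-elim {allB (maximalAgainst S v w ζ)
        (perms (length v))} e₃))
    m≡v : m S ≡ v
    m≡v = proj₁ (eqW-true (m S) v) (proj₁ (if-true (weakLe v (m S) ∧ below S (m S)) (eqW (m S) v))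
      (maximal (m S) (subst (λ ℓ → m S ∈ perms ℓ) (sym (perm-length V)) (proj₂ (∈-perms n (m S)) (top-perm X S))))
      (∧-intro v≤m (trans (below-≡ {S} {m S} T⊆S (top-perm X S)) (∧-intro okay (weakLe-refl (top-perm X S))))))
    nofree : anyFree S ≢ true
    nofree f with proj₁ (anyB-true (free S) N) f
    ... | p , pN , fp with proj₁ (free-true S p) fp
    ... | p∉T , mp≡ with mem? p S
    ... | inj₂ p∉S = p∉S (subst (λ u → p ∈ GDes u) (trans mp≡ m≡v) (∈⇒GDes-top (toggle p S) p pN (toggle-∈ p S pN p∉S)))
    ... | inj₁ p∈S = toggle-∉ p S (subst (p ∈_) (sym R≡S) p∈S) p∈S
      where
      R = toggle p S
      R⊆S : ∀ i → i ∈ R → i ∈ S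
      R⊆S i i∈ with i ≟ p
      ... | yes refl = p∈S
      ... | no ne = proj₁ (toggle-≢ p S hS i ne) i∈
      -- `toggle p S` is built as a filter of `N`, while (iii) ranges over sublists of `S`; so `S`
      -- too is written as a filter of `N`.
      R∈ : R ∈ sublists S
      R∈ = subst (λ Q → R ∈ sublists Q) (sym (sublist-filterB N (Unique-range (n ∸ 1)) S hS))
        (filterB∈sublists-filterB (λ i → memB i S) (toggled p S) N λ i iN k →
          proj₂ (memB-true i S) (R⊆S i (proj₂ (∈-filterB (toggled p S) N i) (iN , k))))
      T⊆R : subB (Des ζ) R ≡ true
      T⊆R = proj₂ (subB-true (Des ζ) R) λ t t∈ →
        proj₂ (toggle-≢ p S hS t (λ { refl → p∉T t∈ })) (proj₁ (subB-true (Des ζ) S) T⊆S t t∈)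
      R≡S : R ≡ S
      R≡S = proj₁ (eqW-true R S) (proj₁ (if-true (subB (Des ζ) R ∧ below R v) (eqW R S)) (minimal R R∈)
        (∧-intro T⊆R (trans (below-≡ {R} {v} T⊆R V) (∧-intro okay (subst (λ u → weakLe v u ≡ true) (sym mp≡) v≤m)))))

  -- Let `p` be a global descent of `m S` outside `S`. Every ascent of `x` crossing `p` is inverted
  -- in `m S`, so it is already separated by `S`. Adding `p` then changes nothing, and `p` would be
  -- free.
  good⇒GDes-top : ∀ S → Sub S → good S ≡ true → GDes (m S) ≡ S
  good⇒GDes-top S hS e = Sub-ext (GDes-Sub (top-perm X S)) hS λ p pN → to p pN , ∈⇒GDes-top S p pN
    where
    T⊆S = proj₁ (∧-elim {subB (Des ζ) S} e)
    nofree = not-false (proj₂ (∧-elim {ok} (proj₂ (∧-elim {subB (Des ζ) S} e))))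
    to : ∀ p → p ∈ N → p ∈ GDes (m S) → p ∈ S
    to p pN pG with mem? p S
    ... | inj₁ r = r
    ... | inj₂ p∉S = ⊥-elim (nofree (proj₂ (anyB-true (free S) N) (p , pN , proj₂ (free-true S p)
        ((λ p∈T → p∉S (proj₁ (subB-true (Des ζ) S) T⊆S p p∈T)) , top-ext (toggle p S) S same))))
      where
      same : ∀ i j → 1 ≤ i → i < j → j ≤ n → at x i < at x j → Sep (toggle p S) i j ↔ Sep S i j
      same i j a b c lt = fromToggle , λ (s , s∈ , r) → s , proj₂ (toggle-≢ p S hS s (λ { refl → p∉S s∈ })) s∈ , r
        where
        fromToggle : Sep (toggle p S) i j → Sep S i j
        fromToggle (s , s∈ , i≤s , s<j) with s ≟ p
        ... | no ne = s , proj₁ (toggle-≢ p S hS s ne) s∈ , i≤s , s<j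
        ... | yes refl with proj₁ (top-inv X S i j a b c) (GDes-separates (top-perm X S) pN pG i j a i≤s s<j c)
        ... | inj₁ sp = sp
        ... | inj₂ q = ⊥-elim (<-asym lt q)

  module _ (S : List ℕ) (hS : Sub S) (e : good S ≡ true) where

    good-Des : subB (Des ζ) S ≡ true
    good-Des = proj₁ (∧-elim {subB (Des ζ) S} e)

    good-ok : ok ≡ true
    good-ok = proj₁ (∧-elim {ok} (proj₂ (∧-elim {subB (Des ζ) S} e)))

    good-nofree : anyFree S ≢ true
    good-nofree = not-false (proj₂ (∧-elim {ok} (proj₂ (∧-elim {subB (Des ζ) S} e))))

    good-maximal : ∀ v → v ∈ perms n → maximalAgainst S (m S) w ζ v ≡ true
    good-maximal v v∈ = proj₂ (if-true (weakLe (m S) v ∧ below S v) (eqW v (m S))) λ k →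
      let m≤v , v-below = ∧-elim {weakLe (m S) v} {below S v} k
          v≤m = proj₂ (∧-elim {ok} {weakLe v (m S)} (trans (sym (below-≡ {S} {v} good-Des V)) v-below))
      in proj₂ (eqW-true v (m S)) (weakLe-antisym V (top-perm X S) v≤m m≤v)
      where
      V = proj₁ (∈-perms n v) v∈

    -- The hypothesis on `R` means m S ≤ m R, so `R` separates every ascent of `x` that `S`
    -- separates. If `p` were missing from `R`, then `S` without `p` would do so as well, and `p`
    -- would be free.
    separator-kept : ∀ R → R ∈ sublists S → subB (Des ζ) R ≡ true → below R (m S) ≡ true → ∀ p → p ∈ S → p ∈ R
    separator-kept R R∈ T⊆R k p p∈S with mem? p R
    ... | inj₁ q = q
    ... | inj₂ p∉R = ⊥-elim (good-nofree (proj₂ (anyB-true (free S) N) (p , pN , proj₂ (free-true S p)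
        ((λ p∈T → p∉R (proj₁ (subB-true (Des ζ) R) T⊆R p p∈T)) , top-ext (toggle p S) S same))))
      where
      pN = Sub⇒∈N hS p p∈S
      mS≤mR : InvSub n (m S) (m R)
      mS≤mR = proj₁ (weakLe-true (top-perm X S) (top-perm X R))
        (proj₂ (∧-elim {ok} {weakLe (m S) (m R)} (trans (sym (below-≡ {R} {m S} T⊆R (top-perm X S))) k)))
      same : ∀ i j → 1 ≤ i → i < j → j ≤ n → at x i < at x j → Sep (toggle p S) i j ↔ Sep S i j
      same i j a b c lt = fromToggle , toToggle
        where
        fromToggle : Sep (toggle p S) i j → Sep S i j
        fromToggle (s , s∈ , q) = s , proj₁ (toggle-≢ p S hS s (λ { refl → toggle-∉ p S s∈ p∈S })) s∈ , q
        toToggle : Sep S i j → Sep (toggle p S) i j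
        toToggle sp = fromR (proj₁ (top-inv X R i j a b c) (mS≤mR i j a b c (proj₂ (top-inv X S i j a b c) (inj₁ sp))))
          where
          fromR : Sep R i j ⊎ at x j < at x i → Sep (toggle p S) i j
          fromR (inj₂ q) = ⊥-elim (<-asym lt q)
          fromR (inj₁ (s , s∈R , q)) = s , proj₂ (toggle-≢ p S hS s (λ { refl → p∉R s∈R })) (∈-sublists-⊆ S R R∈ s s∈R) , q

    good-minimal : ∀ R → R ∈ sublists S → minimalAgainst S (m S) w ζ R ≡ true
    good-minimal R R∈ = proj₂ (if-true (subB (Des ζ) R ∧ below R (m S)) (eqW R S)) λ k →
      let T⊆R , R-below = ∧-elim {subB (Des ζ) R} {below R (m S)} k
      in proj₂ (eqW-true R S) (sublist-⊇⇒≡ S uniqueS R R∈ (separator-kept R R∈ T⊆R R-below))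
      where
      uniqueS : Unique S
      uniqueS = subst Unique (sym (sublist-filterB N (Unique-range (n ∸ 1)) S hS)) (Unique-filterB (λ i → memB i S) N
          (Unique-range (n ∸ 1)))

    good-below : below S (m S) ≡ true
    good-below = trans (below-≡ {S} {m S} good-Des (top-perm X S)) (∧-intro good-ok (weakLe-refl (top-perm X S)))

    good-condition : condition n S (m S) w ζ ≡ true
    good-condition = ∧-intro {subB (Des ζ) S} good-Des (∧-intro {below S (m S)} good-below
      (∧-intro {allB (maximalAgainst S (m S) w ζ) (perms n)} (proj₂ (allB-true (maximalAgainst S (m S) w ζ) (perms n)) good-maximal)
        (proj₂ (allB-true (minimalAgainst S (m S) w ζ) (sublists S)) good-minimal)))

    good⇒kappa : kappaCond (m S) w ζ ≡ true
    good⇒kappa = subst₂ (λ ℓ G → condition ℓ G (m S) w ζ ≡ true) (sym (perm-length (top-perm X S)))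
        (sym (good⇒GDes-top S hS e)) good-condition

  -- The correspondence between v and S in Boolean form: S = GDes(v) with `v` counted by κ, against
  -- v = m_S with `S` free of free positions. In this form it exchanges one delta for the other
  -- inside a double sum.
  kappa-good : ∀ {v S} → IsPerm n v → Sub S → eqW (GDes v) S ∧ kappaCond v w ζ ≡ good S ∧ eqW (m S) v
  kappa-good {v} {S} V hS = bool-ext (to , from)
    where
    to : eqW (GDes v) S ∧ kappaCond v w ζ ≡ true → good S ∧ eqW (m S) v ≡ true
    to e = subst (λ S → good S ∧ eqW (m S) v ≡ true) (proj₁ (eqW-true (GDes v) S) (proj₁ (∧-elim {eqW (GDes v) S} e)))
      (kappa⇒good V (proj₂ (∧-elim {eqW (GDes v) S} e)))
    from : good S ∧ eqW (m S) v ≡ true → eqW (GDes v) S ∧ kappaCond v w ζ ≡ true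
    from e = subst (λ v → eqW (GDes v) S ∧ kappaCond v w ζ ≡ true) (proj₁ (eqW-true (m S) v) (proj₂ (∧-elim {good S} e)))
      (∧-intro (proj₂ (eqW-true (GDes (m S)) S) (good⇒GDes-top S hS (proj₁ (∧-elim {good S} e))))
          (good⇒kappa S hS (proj₁ (∧-elim {good S} e))))

-- Coefficients on the monomial basis

-- The indicator of u ≤ w, extended by zero to words that are not permutations of [n]; `weakLe`
-- alone has no meaning on those.
upTo≤ : ℕ → List ℕ → List ℕ → ℚ
upTo≤ n w z = ∑ (perms n) (λ u → 𝟙 (weakLe u w) Q.* δ u z)

upTo≤-perm : ∀ {n z} w → IsPerm n z → upTo≤ n w z ≡ 𝟙 (weakLe z w)
upTo≤-perm {n} {z} w P = trans (∑-cong′ (perms n) λ u → Qₚ.*-comm (𝟙 (weakLe u w)) (δ u z)) (∑-perms-δ n z (λ u → 𝟙 (weakLe u w)) P)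

Mcoeff-pairing : ∀ n w x → Mcoeff n w (coeff x) ≡ ⟪ x , upTo≤ n w ⟫
Mcoeff-pairing n w x = begin
  ∑ (perms n) (λ u → 𝟙 (weakLe u w) Q.* coeff x u)
    ≡⟨ ∑-cong′ (perms n) (λ u → trans (cong (𝟙 (weakLe u w) Q.*_) (coeff-pairing x u))
        (∑-*ˡ (𝟙 (weakLe u w)) x (λ t → proj₁ t Q.* δ u (proj₂ t)))) ⟩
  ∑ (perms n) (λ u → ∑ x (λ t → 𝟙 (weakLe u w) Q.* (proj₁ t Q.* δ u (proj₂ t))))
    ≡⟨ ∑-swap (perms n) x (λ u t → 𝟙 (weakLe u w) Q.* (proj₁ t Q.* δ u (proj₂ t))) ⟩
  ∑ x (λ t → ∑ (perms n) (λ u → 𝟙 (weakLe u w) Q.* (proj₁ t Q.* δ u (proj₂ t))))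
    ≡⟨ ∑-cong′ x (λ t → trans (∑-cong′ (perms n) (λ u → *-leftComm (𝟙 (weakLe u w)) (proj₁ t) (δ u (proj₂ t))))
         (sym (∑-*ˡ (proj₁ t) (perms n) (λ u → 𝟙 (weakLe u w) Q.* δ u (proj₂ t))))) ⟩
  ⟪ x , upTo≤ n w ⟫ ∎
  where open ≡-Reasoning

pairing-M : ∀ {n v} → IsPerm n v → ∀ g → ⟪ M v , g ⟫ ≡ ∑ (perms n) (λ z → 𝟙 (weakLe v z) Q.* (mu v z Q.* g z))
pairing-M {n} {v} V g = begin
  ⟪ M v , g ⟫ ≡⟨ ∑-map (λ z → (mu v z , z)) (filterB (weakLe v) (perms (length v))) (λ t → proj₁ t Q.* g (proj₂ t)) ⟩
  ∑ (filterB (weakLe v) (perms (length v))) (λ z → mu v z Q.* g z) ≡⟨ ∑-filterB (weakLe v) (perms (length v)) (λ z → mu v z Q.* g z) ⟩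
  ∑ (perms (length v)) (λ z → 𝟙 (weakLe v z) Q.* (mu v z Q.* g z)) ≡⟨ cong
      (λ ℓ → ∑ (perms ℓ) (λ z → 𝟙 (weakLe v z) Q.* (mu v z Q.* g z))) (perm-length V) ⟩
  ∑ (perms n) (λ z → 𝟙 (weakLe v z) Q.* (mu v z Q.* g z)) ∎
  where open ≡-Reasoning

takeuchi-cong : ∀ {n v} g h → IsPerm n v → (∀ z → IsPerm n z → g z ≡ h z) → takeuchi n v g ≡ takeuchi n v h
takeuchi-cong {n} {v} g h V e = ∑-cong′ (sublists (range (n ∸ 1))) λ S → cong (signQ (suc (length S)) Q.*_)
  (∑-cong (perms n) λ ζ ζ∈ → cong (𝟙 (subB (Des ζ) S) Q.*_) (e (comp (restrictS S v) (inverse ζ))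
    (comp-perm (restrictS-perm V S) (inverse-perm (proj₁ (∈-perms n ζ) ζ∈)))))

sgn : List ℕ → ℚ
sgn S = signQ (suc (length S))

shuffle-sum : ∀ {n w ζ v} → IsPerm n w → IsPerm n ζ → IsPerm n v →
  ∑ (sublists (range (n ∸ 1))) (λ S → sgn S Q.* (𝟙 (subB (Des ζ) S) Q.* 𝟙 (weakLe (comp (restrictS S v) (inverse ζ)) w)))
  ≡ ∑ (perms n) (λ v′ → 𝟙 (weakLe v v′) Q.* (sgn (GDes v′) Q.* 𝟙 (kappaCond v′ w ζ)))
shuffle-sum {n} {w} {ζ} {v} W Z V = begin
  ∑ (sublists N) (λ S → sgn S Q.* (𝟙 (subB (Des ζ) S) Q.* 𝟙 (below S v)))
    ≡⟨ ∑-cong′ (sublists N) split ⟩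
  ∑ (sublists N) (λ S → sgn S Q.* (𝟙 (good S) Q.* 𝟙 (weakLe v (m S))) Q.+ sgn S Q.* (𝟙 (subB (Des ζ) S) Q.* (𝟙 (anyFree S) Q.* g (m S))))
    ≡⟨ ∑-+ (sublists N) _ _ ⟩
  ∑ (sublists N) (λ S → sgn S Q.* (𝟙 (good S) Q.* 𝟙 (weakLe v (m S)))) Q.+ ∑ (sublists N)
      (λ S → sgn S Q.* (𝟙 (subB (Des ζ) S) Q.* (𝟙 (anyFree S) Q.* g (m S))))
    ≡⟨ trans (cong (∑ (sublists N) (λ S → sgn S Q.* (𝟙 (good S) Q.* 𝟙 (weakLe v (m S)))) Q.+_) (∑-free-cancel g)) (Qₚ.+-identityʳ _) ⟩
  ∑ (sublists N) (λ S → sgn S Q.* (𝟙 (good S) Q.* 𝟙 (weakLe v (m S))))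
    -- The value at `m S` is written as a sum over v′ with the delta v′ = m S, which `kappa-good`
    -- exchanges for the delta S = GDes v′. After the swap the sum over `S` collapses instead.
    ≡⟨ ∑-cong (sublists N) expand ⟩
  ∑ (sublists N) (λ S → ∑ (perms n) (λ v′ → 𝟙 (eqW (GDes v′) S) Q.* (sgn S Q.* K v′)))
    ≡⟨ ∑-swap (sublists N) (perms n) _ ⟩
  ∑ (perms n) (λ v′ → ∑ (sublists N) (λ S → 𝟙 (eqW (GDes v′) S) Q.* (sgn S Q.* K v′)))
    ≡⟨ ∑-cong (perms n) (λ v′ v′∈ → trans
         (∑-δ (sublists N) (GDes v′) (λ S → sgn S Q.* K v′) (GDes-Sub (proj₁ (∈-perms n v′) v′∈))
             (Unique-sublists N (Unique-range (n ∸ 1))))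
         (*-leftComm (sgn (GDes v′)) (𝟙 (weakLe v v′)) (𝟙 (kappaCond v′ w ζ)))) ⟩
  ∑ (perms n) (λ v′ → 𝟙 (weakLe v v′) Q.* (sgn (GDes v′) Q.* 𝟙 (kappaCond v′ w ζ))) ∎
  where
  open ≡-Reasoning
  open PerShuffle W Z
  g : List ℕ → ℚ
  g u = 𝟙 ok Q.* 𝟙 (weakLe v u)
  K : List ℕ → ℚ
  K v′ = 𝟙 (weakLe v v′) Q.* 𝟙 (kappaCond v′ w ζ)
  cases : ∀ a b c d e → a Q.* (𝟙 b Q.* 𝟙 (c ∧ e)) ≡
    a Q.* (𝟙 (b ∧ (c ∧ not d)) Q.* 𝟙 e) Q.+ a Q.* (𝟙 b Q.* (𝟙 d Q.* (𝟙 c Q.* 𝟙 e)))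
  cases a b c d e = begin
    a Q.* (𝟙 b Q.* 𝟙 (c ∧ e)) ≡⟨ cong (λ z → a Q.* (𝟙 b Q.* z)) (𝟙-∧ c e) ⟩
    a Q.* (𝟙 b Q.* (𝟙 c Q.* 𝟙 e)) ≡⟨ cong (λ z → a Q.* (𝟙 b Q.* z)) (sym (Qₚ.*-identityˡ _)) ⟩
    a Q.* (𝟙 b Q.* (1ℚ Q.* (𝟙 c Q.* 𝟙 e))) ≡⟨ cong (λ z → a Q.* (𝟙 b Q.* (z Q.* (𝟙 c Q.* 𝟙 e)))) (sym (𝟙-not d)) ⟩
    a Q.* (𝟙 b Q.* ((𝟙 (not d) Q.+ 𝟙 d) Q.* (𝟙 c Q.* 𝟙 e)))
      ≡⟨ solve 6 (λ a b c d d′ e → a :* (b :* ((d′ :+ d) :* (c :* e))) := a :* (b :* (c :* d′) :* e) :+ a :*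
          (b :* (d :* (c :* e)))) refl a (𝟙 b) (𝟙 c) (𝟙 d) (𝟙 (not d)) (𝟙 e) ⟩
    a Q.* (𝟙 b Q.* (𝟙 c Q.* 𝟙 (not d)) Q.* 𝟙 e) Q.+ a Q.* (𝟙 b Q.* (𝟙 d Q.* (𝟙 c Q.* 𝟙 e)))
      ≡⟨ cong (λ z → a Q.* (z Q.* 𝟙 e) Q.+ a Q.* (𝟙 b Q.* (𝟙 d Q.* (𝟙 c Q.* 𝟙 e))))
          (sym (trans (𝟙-∧ b (c ∧ not d)) (cong (𝟙 b Q.*_) (𝟙-∧ c (not d))))) ⟩
    a Q.* (𝟙 (b ∧ (c ∧ not d)) Q.* 𝟙 e) Q.+ a Q.* (𝟙 b Q.* (𝟙 d Q.* (𝟙 c Q.* 𝟙 e))) ∎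
    where open +-*-Solver
  split : ∀ S → sgn S Q.* (𝟙 (subB (Des ζ) S) Q.* 𝟙 (below S v)) ≡
    sgn S Q.* (𝟙 (good S) Q.* 𝟙 (weakLe v (m S))) Q.+ sgn S Q.* (𝟙 (subB (Des ζ) S) Q.* (𝟙 (anyFree S) Q.* g (m S)))
  split S = trans (cong (sgn S Q.*_) (𝟙-guard (subB (Des ζ) S) λ e → cong 𝟙 (below-≡ {S} {v} e V)))
    (cases (sgn S) (subB (Des ζ) S) ok (anyFree S) (weakLe v (m S)))
  expand : ∀ S → S ∈ sublists N → sgn S Q.* (𝟙 (good S) Q.* 𝟙 (weakLe v (m S))) ≡
    ∑ (perms n) (λ v′ → 𝟙 (eqW (GDes v′) S) Q.* (sgn S Q.* K v′))
  expand S hS = begin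
    sgn S Q.* (𝟙 (good S) Q.* 𝟙 (weakLe v (m S)))
      ≡⟨ sym (Qₚ.*-assoc (sgn S) (𝟙 (good S)) _) ⟩
    sgn S Q.* 𝟙 (good S) Q.* 𝟙 (weakLe v (m S))
      ≡⟨ cong (sgn S Q.* 𝟙 (good S) Q.*_) (sym (∑-perms-δ n (m S) (λ v′ → 𝟙 (weakLe v v′)) (top-perm X S))) ⟩
    sgn S Q.* 𝟙 (good S) Q.* ∑ (perms n) (λ v′ → 𝟙 (eqW (m S) v′) Q.* 𝟙 (weakLe v v′))
      ≡⟨ ∑-*ˡ (sgn S Q.* 𝟙 (good S)) (perms n) _ ⟩
    ∑ (perms n) (λ v′ → sgn S Q.* 𝟙 (good S) Q.* (𝟙 (eqW (m S) v′) Q.* 𝟙 (weakLe v v′)))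
      ≡⟨ ∑-cong (perms n) (λ v′ v′∈ → regroup v′ (proj₁ (∈-perms n v′) v′∈)) ⟩
    ∑ (perms n) (λ v′ → 𝟙 (eqW (GDes v′) S) Q.* (sgn S Q.* K v′)) ∎
    where
    open +-*-Solver
    regroup : ∀ v′ → IsPerm n v′ → sgn S Q.* 𝟙 (good S) Q.* (𝟙 (eqW (m S) v′) Q.* 𝟙 (weakLe v v′)) ≡ 𝟙 (eqW (GDes v′) S) Q.*
        (sgn S Q.* K v′)
    regroup v′ V′ = begin
      sgn S Q.* 𝟙 (good S) Q.* (𝟙 (eqW (m S) v′) Q.* 𝟙 (weakLe v v′))
        ≡⟨ solve 4 (λ a b c d → a :* b :* (c :* d) := a :* d :* (b :* c)) refl (sgn S) (𝟙 (good S)) (𝟙 (eqW (m S) v′)) (𝟙 (weakLe v v′)) ⟩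
      sgn S Q.* 𝟙 (weakLe v v′) Q.* (𝟙 (good S) Q.* 𝟙 (eqW (m S) v′))
        ≡⟨ cong (sgn S Q.* 𝟙 (weakLe v v′) Q.*_) (trans (sym (𝟙-∧ (good S) (eqW (m S) v′)))
             (trans (cong 𝟙 (sym (kappa-good {v′} {S} V′ hS))) (𝟙-∧ (eqW (GDes v′) S) (kappaCond v′ w ζ)))) ⟩
      sgn S Q.* 𝟙 (weakLe v v′) Q.* (𝟙 (eqW (GDes v′) S) Q.* 𝟙 (kappaCond v′ w ζ))
        ≡⟨ solve 4 (λ a b c d → a :* d :* (b :* c) := b :* (a :* (d :* c))) refl (sgn S) (𝟙 (eqW (GDes v′) S))
            (𝟙 (kappaCond v′ w ζ)) (𝟙 (weakLe v v′)) ⟩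
      𝟙 (eqW (GDes v′) S) Q.* (sgn S Q.* K v′) ∎

takeuchi-kappa : ∀ {n v w} → IsPerm n v → IsPerm n w →
  takeuchi n v (λ z → 𝟙 (weakLe z w)) ≡ ∑ (perms n) (λ v′ → 𝟙 (weakLe v v′) Q.* (sgn (GDes v′) Q.* fromℕQ (kappa v′ w)))
takeuchi-kappa {n} {v} {w} V W = begin
  ∑ Ss (λ S → sgn S Q.* ∑ (perms n) (λ ζ → a S ζ)) ≡⟨ ∑-cong′ Ss (λ S → ∑-*ˡ (sgn S) (perms n) (a S)) ⟩
  ∑ Ss (λ S → ∑ (perms n) (λ ζ → sgn S Q.* a S ζ)) ≡⟨ ∑-swap Ss (perms n) (λ S ζ → sgn S Q.* a S ζ) ⟩
  ∑ (perms n) (λ ζ → ∑ Ss (λ S → sgn S Q.* a S ζ)) ≡⟨ ∑-cong (perms n) (λ ζ ζ∈ → shuffle-sum W (proj₁ (∈-perms n ζ) ζ∈) V) ⟩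
  ∑ (perms n) (λ ζ → ∑ (perms n) (λ v′ → b v′ ζ)) ≡⟨ ∑-swap (perms n) (perms n) (λ ζ v′ → b v′ ζ) ⟩
  ∑ (perms n) (λ v′ → ∑ (perms n) (λ ζ → b v′ ζ)) ≡⟨ ∑-cong (perms n) (λ v′ v′∈ → collect v′ (proj₁ (∈-perms n v′) v′∈)) ⟩
  ∑ (perms n) (λ v′ → 𝟙 (weakLe v v′) Q.* (sgn (GDes v′) Q.* fromℕQ (kappa v′ w))) ∎
  where
  open ≡-Reasoning
  Ss = sublists (range (n ∸ 1))
  a : List ℕ → List ℕ → ℚ
  a S ζ = 𝟙 (subB (Des ζ) S) Q.* 𝟙 (weakLe (comp (restrictS S v) (inverse ζ)) w)
  b : List ℕ → List ℕ → ℚ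
  b v′ ζ = 𝟙 (weakLe v v′) Q.* (sgn (GDes v′) Q.* 𝟙 (kappaCond v′ w ζ))
  collect : ∀ v′ → IsPerm n v′ → ∑ (perms n) (λ ζ → b v′ ζ) ≡ 𝟙 (weakLe v v′) Q.* (sgn (GDes v′) Q.* fromℕQ (kappa v′ w))
  collect v′ V′ = begin
    ∑ (perms n) (λ ζ → b v′ ζ) ≡⟨ sym (∑-*ˡ (𝟙 (weakLe v v′)) (perms n) (λ ζ → sgn (GDes v′) Q.* 𝟙 (kappaCond v′ w ζ))) ⟩
    𝟙 (weakLe v v′) Q.* ∑ (perms n) (λ ζ → sgn (GDes v′) Q.* 𝟙 (kappaCond v′ w ζ))
      ≡⟨ cong (𝟙 (weakLe v v′) Q.*_) (sym (∑-*ˡ (sgn (GDes v′)) (perms n) (λ ζ → 𝟙 (kappaCond v′ w ζ)))) ⟩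
    𝟙 (weakLe v v′) Q.* (sgn (GDes v′) Q.* ∑ (perms n) (λ ζ → 𝟙 (kappaCond v′ w ζ)))
      ≡⟨ cong (λ ℓ → 𝟙 (weakLe v v′) Q.* (sgn (GDes v′) Q.* ∑ (perms ℓ) (λ ζ → 𝟙 (kappaCond v′ w ζ)))) (sym (perm-length V′)) ⟩
    𝟙 (weakLe v v′) Q.* (sgn (GDes v′) Q.* ∑ (perms (length v′)) (λ ζ → 𝟙 (kappaCond v′ w ζ)))
      ≡⟨ cong (λ z → 𝟙 (weakLe v v′) Q.* (sgn (GDes v′) Q.* z)) (sym (fromℕQ-countB (kappaCond v′ w) (perms (length v′)))) ⟩
    𝟙 (weakLe v v′) Q.* (sgn (GDes v′) Q.* fromℕQ (kappa v′ w)) ∎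

pairing-M-upTo≤ : ∀ {n u w} → IsPerm n u → IsPerm n w → ⟪ M u , upTo≤ n w ⟫ ≡ 𝟙 (eqW u w)
pairing-M-upTo≤ {n} {u} {w} U W = trans (pairing-M U (upTo≤ n w)) (trans
  (∑-cong (perms n) λ z z∈ → cong (𝟙 (weakLe u z) Q.*_) (trans (cong (mu u z Q.*_) (upTo≤-perm w (proj₁ (∈-perms n z) z∈)))
      (Qₚ.*-comm (mu u z) (𝟙 (weakLe z w)))))
  (mu-sum U W))

-- Comparison of the two sides

module Main (n : ℕ) (1≤n : 1 ≤ n) (v : List ℕ) (V : IsPerm n v) (S : List ℕ → Elem) (antipode : IsAntipode S) where

  lhs : Elem
  lhs = lin S (M v)

  rhs : Elem
  rhs = scale (signQ (suc (length (GDes v)))) (concatMap (λ w → scale (fromℕQ (kappa v w)) (M w)) (perms n))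

  pairing-rhs : ∀ g → ⟪ rhs , g ⟫ ≡ sgn (GDes v) Q.* ∑ (perms n) (λ w → fromℕQ (kappa v w) Q.* ⟪ M w , g ⟫)
  pairing-rhs g = trans (pairing-scale (sgn (GDes v)) (concatMap (λ w → scale (fromℕQ (kappa v w)) (M w)) (perms n)) g)
    (cong (sgn (GDes v) Q.*_) (trans (pairing-concatMap (λ w → scale (fromℕQ (kappa v w)) (M w)) (perms n) g)
      (∑-cong′ (perms n) λ w → pairing-scale (fromℕQ (kappa v w)) (M w) g)))

  pairing-lhs : ∀ g → ⟪ lhs , g ⟫ ≡ ∑ (perms n) (λ z → 𝟙 (weakLe v z) Q.* (mu v z Q.* takeuchi n z g))
  pairing-lhs g = trans (pairing-lin S (M v) g) (trans (pairing-M V (λ z → ⟪ S z , g ⟫))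
    (∑-cong (perms n) λ z z∈ → cong (λ q → 𝟙 (weakLe v z) Q.* (mu v z Q.* q))
      (antipode-takeuchi S antipode n n z ≤-refl 1≤n (proj₁ (∈-perms n z) z∈) g)))

  K : List ℕ → List ℕ → ℚ
  K w v′ = sgn (GDes v′) Q.* fromℕQ (kappa v′ w)

  -- By `takeuchi-kappa`, the value of the antipode of F_z at this functional is the sum of `K w v′`
  -- over v′ ≥ z. Weighting by μ(v, z) and summing over z is Möbius inversion, which leaves only v′
  -- = v.
  lhs-Mcoeff : ∀ w → IsPerm n w → ⟪ lhs , upTo≤ n w ⟫ ≡ K w v
  lhs-Mcoeff w W = begin
    ⟪ lhs , upTo≤ n w ⟫ ≡⟨ pairing-lhs (upTo≤ n w) ⟩
    ∑ (perms n) (λ z → 𝟙 (weakLe v z) Q.* (mu v z Q.* takeuchi n z (upTo≤ n w)))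
      ≡⟨ ∑-cong (perms n) (λ z z∈ → cong (λ q → 𝟙 (weakLe v z) Q.* (mu v z Q.* q)) (trans
           (takeuchi-cong (upTo≤ n w) (λ u → 𝟙 (weakLe u w)) (proj₁ (∈-perms n z) z∈) (λ u U → upTo≤-perm w U))
           (takeuchi-kappa (proj₁ (∈-perms n z) z∈) W))) ⟩
    ∑ (perms n) (λ z → 𝟙 (weakLe v z) Q.* (mu v z Q.* ∑ (perms n) (λ v′ → 𝟙 (weakLe z v′) Q.* K w v′)))
      ≡⟨ ∑-cong′ (perms n) (λ z → trans (cong (𝟙 (weakLe v z) Q.*_) (∑-*ˡ (mu v z) (perms n) (λ v′ → 𝟙 (weakLe z v′) Q.* K w v′)))
           (trans (∑-*ˡ (𝟙 (weakLe v z)) (perms n) (λ v′ → mu v z Q.* (𝟙 (weakLe z v′) Q.* K w v′))) (∑-cong′ (perms n) (rearrange z)))) ⟩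
    ∑ (perms n) (λ z → ∑ (perms n) (λ v′ → K w v′ Q.* (𝟙 (weakLe v z) Q.* (𝟙 (weakLe z v′) Q.* mu v z))))
      ≡⟨ ∑-swap (perms n) (perms n) (λ z v′ → K w v′ Q.* (𝟙 (weakLe v z) Q.* (𝟙 (weakLe z v′) Q.* mu v z))) ⟩
    ∑ (perms n) (λ v′ → ∑ (perms n) (λ z → K w v′ Q.* (𝟙 (weakLe v z) Q.* (𝟙 (weakLe z v′) Q.* mu v z))))
      ≡⟨ ∑-cong (perms n) (λ v′ v′∈ → trans (sym (∑-*ˡ (K w v′) (perms n) (λ z → 𝟙 (weakLe v z) Q.* (𝟙 (weakLe z v′) Q.* mu v z))))
           (trans (cong (K w v′ Q.*_) (mu-sum V (proj₁ (∈-perms n v′) v′∈))) (Qₚ.*-comm (K w v′) (𝟙 (eqW v v′))))) ⟩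
    ∑ (perms n) (λ v′ → 𝟙 (eqW v v′) Q.* K w v′) ≡⟨ ∑-perms-δ n v (K w) V ⟩
    K w v ∎
    where
    open ≡-Reasoning
    open +-*-Solver
    rearrange : ∀ z v′ → 𝟙 (weakLe v z) Q.* (mu v z Q.* (𝟙 (weakLe z v′) Q.* K w v′)) ≡ K w v′ Q.*
        (𝟙 (weakLe v z) Q.* (𝟙 (weakLe z v′) Q.* mu v z))
    rearrange z v′ = solve 4 (λ a b c d → a :* (b :* (c :* d)) := d :* (a :* (c :* b))) refl (𝟙 (weakLe v z)) (mu v z)
        (𝟙 (weakLe z v′)) (K w v′)

  rhs-Mcoeff : ∀ w → IsPerm n w → ⟪ rhs , upTo≤ n w ⟫ ≡ K w v
  rhs-Mcoeff w W = trans (pairing-rhs (upTo≤ n w)) (cong (sgn (GDes v) Q.*_) (trans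
    (∑-cong (perms n) λ u u∈ → trans (cong (fromℕQ (kappa v u) Q.*_) (trans (pairing-M-upTo≤ (proj₁ (∈-perms n u) u∈) W)
        (cong 𝟙 (eqW-sym u w))))
      (Qₚ.*-comm (fromℕQ (kappa v u)) (𝟙 (eqW w u))))
    (∑-perms-δ n w (λ u → fromℕQ (kappa v u)) W)))

  on-perms : ∀ u → IsPerm n u → coeff lhs u ≡ coeff rhs u
  on-perms = Mcoeff-injective n (coeff lhs) (coeff rhs) λ w W →
    trans (Mcoeff-pairing n w lhs) (trans (lhs-Mcoeff w W) (sym (trans (Mcoeff-pairing n w rhs) (rhs-Mcoeff w W))))

  -- `≈` compares coefficients at all words. `S z` could list any words, but Takeuchi's formula
  -- evaluates functionals at permutations of [n] only, so the coefficient of any other word is 0 on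
  -- both sides.
  off-perms : ∀ u → ¬ IsPerm n u → coeff lhs u ≡ coeff rhs u
  off-perms u ¬U = trans (trans (coeff-pairing lhs u) lhs-0) (sym (trans (coeff-pairing rhs u) rhs-0))
    where
    δ-0 : ∀ z → IsPerm n z → δ u z ≡ 0ℚ
    δ-0 z Z = cong 𝟙 (eqW-false {z} {u} λ { refl → ¬U Z })
    *-*-0 : ∀ a b {c} → c ≡ 0ℚ → a Q.* (b Q.* c) ≡ 0ℚ
    *-*-0 a b refl = trans (cong (a Q.*_) (Qₚ.*-zeroʳ b)) (Qₚ.*-zeroʳ a)
    takeuchi-0 : ∀ z → IsPerm n z → takeuchi n z (δ u) ≡ 0ℚ
    takeuchi-0 z Z = trans (takeuchi-cong (δ u) (λ _ → 0ℚ) Z δ-0) (∑-0 (sublists (range (n ∸ 1))) λ R _ →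
      trans (cong (sgn R Q.*_) (∑-0 (perms n) λ ζ _ → Qₚ.*-zeroʳ (𝟙 (subB (Des ζ) R)))) (Qₚ.*-zeroʳ (sgn R)))
    lhs-0 : ⟪ lhs , δ u ⟫ ≡ 0ℚ
    lhs-0 = trans (pairing-lhs (δ u)) (∑-0 (perms n) λ z z∈ → *-*-0 (𝟙 (weakLe v z)) (mu v z) (takeuchi-0 z (proj₁ (∈-perms n z) z∈)))
    rhs-0 : ⟪ rhs , δ u ⟫ ≡ 0ℚ
    rhs-0 = trans (pairing-rhs (δ u)) (trans (cong (sgn (GDes v) Q.*_) (∑-0 (perms n) λ w w∈ → trans
      (cong (fromℕQ (kappa v w) Q.*_) (trans (pairing-M (proj₁ (∈-perms n w) w∈) (δ u)) (∑-0 (perms n) λ z z∈ →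
        *-*-0 (𝟙 (weakLe w z)) (mu w z) (δ-0 z (proj₁ (∈-perms n z) z∈)))))
      (Qₚ.*-zeroʳ (fromℕQ (kappa v w))))) (Qₚ.*-zeroʳ (sgn (GDes v))))

  isPerm? : ∀ u → IsPerm n u ⊎ ¬ IsPerm n u
  isPerm? u = [ (λ e → inj₁ (found (proj₁ (anyB-true (eqW u) (perms n)) e))) ,
                (λ ne → inj₂ λ U → ne (proj₂ (anyB-true (eqW u) (perms n)) (u , proj₂ (∈-perms n u) U , eqW-refl u))) ]′
    (bool? (anyB (eqW u) (perms n)))
    where
    found : ∃[ z ] (z ∈ perms n × eqW u z ≡ true) → IsPerm n u
    found (z , z∈ , q) = subst (IsPerm n) (sym (proj₁ (eqW-true u z) q)) (proj₁ (∈-perms n z) z∈)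

  lhs≈rhs : lhs ≈ rhs
  lhs≈rhs u = [ on-perms u , off-perms u ]′ (isPerm? u)

theorem2p4 : (n : ℕ) → 1 ≤ n → (v : List ℕ) → IsPerm n v →
    (S : List ℕ → Elem) → IsAntipode S →
    lin S (M v) ≈ scale (signQ (suc (length (GDes v))))
                        (concatMap (λ w → scale (fromℕQ (kappa v w)) (M w)) (perms n))
theorem2p4 n 1≤n v V S antipode = Main.lhs≈rhs n 1≤n v V S antipode
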